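{- Let $G$ be a graph (multigraph). Then $G$ is Mengerian for time if and only if $G$ does not have any of the graphs $M_1,M_2,M_3,M_4,M_5$ as m-topological minor. Moreover, there is a polynomial-time algorithm that, given a graph $G$, decides whether $G$ is Mengerian for time.
   Context: Graphs. A graph $G$ is a finite undirected multigraph without loops: a finite vertex set $V(G)$, a finite edge set $E(G)$, and each edge has an unordered pair $xy$ of distinct vertices as its endpoints; several edges may have the same endpoints. A pair $xy$ that is the pair of endpoints of some edge is called a multiedge, and its multiplicity is the number of edges with endpoints $xy$. m-topological minor. Given a multiedge $xy$ of $G$ of multiplicity $\mu$, the m-subdivision of $xy$ is the graph obtained by subdividing all edges with endpoints $xy$ and identifying all the new vertices into one vertex $v_{xy}$; i.e. the $\mu$ edges between $x$ and $y$ are removed, a new vertex $v_{xy}$ is added, together with $\mu$ edges with endpoints $xv_{xy}$ and $\mu$ edges with endpoints $v_{xy}y$. A graph $H$ is an m-topological minor of $G$ if $G$ has a subgraph (up to isomorphism) that can be obtained from $H$ by a (possibly empty) sequence of m-subdivisions. The graphs $M_1,\dots,M_5$ (multiedges have multiplicity 1 unless stated otherwise): - $M_1$: the path on 4 vertices in which each of the three multiedges has multiplicity 2. - $M_2$: a triangle together with one additional vertex joined to exactly one vertex of the triangle by a multiedge of multiplicity 2. - $M_3$: two triangles sharing exactly one vertex. - $M_4$: the cycle on 4 vertices in which exactly one multiedge has multiplicity 2 (the other three have multiplicity 1). - $M_5$: the cycle on 4 vertices plus one chord (i.e. $K_4$ minus an edge). Temporal graphs. A temporal graph is a pair $(G,\lambda)$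 with $G$ a graph and $\lambda:E(G)\to\mathbb{N}\setminus\{0\}$ (the timefunction); an edge $e$ is active at timestep $\lambda(e)$. It is assumed that edges with the same endpoints have distinct values of $\lambda$ (each snapshot is simple). The lifetime is $\tau=\max_{e\in E(G)}\lambda(e)$, and $[\tau]=\{1,\dots,\tau\}$. A temporal $s,z$-walk is a sequence $(s=x_0,e_1,x_1,\dots,e_q,x_q=z)$ where $e_i$ has endpoints $x_{i-1}x_i$ and $\lambda(e_1)\le\dots\le\lambda(e_q)$; it is a temporal $s,z$-path if its vertices are pairwise distinct. $E(P)$ denotes the set of edges of $P$. Two temporal $s,z$-paths $P,Q$ are snapshot disjoint if $\lambda(E(P))\cap\lambda(E(Q))=\emptyset$. A set $S\subseteq[\tau]$ is a snapshot $s,z$-cut if every temporal $s,z$-path uses an edge active at some timestep in $S$. Let $sp_{G,\lambda}(s,z)$ be the maximum number of pairwise snapshot disjoint temporal $s,z$-paths and $sc_{G,\lambda}(s,z)$ the minimum size of a snapshot $s,z$-cut. $G$ is Mengerian for time if for every timefunction $\lambda$ on $E(G)$ and all $s,z\in V(G)$ with $s\ne z$, $sp_{G,\lambda}(s,z)=sc_{G,\lambda}(s,z)$. -}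

module Defs where

open import Data.Bool using (Bool; true; false)
open import Data.Fin using (Fin; zero; suc; toℕ; #_)
open import Data.Fin.Properties using (_≟_; suc-injective; 0≢1+n)
open import Data.Fin.Subset using (Subset; ∣_∣) renaming (_∈_ to _∈ₛ_)
open import Data.List using (List; []; _∷_; length; lookup; map; foldr; allFin)
open import Data.List.Membership.Propositional using (_∈_)
open import Data.List.Relation.Binary.Disjoint.Propositional using (Disjoint)
open import Data.List.Relation.Unary.All using (All; []; _∷_; all?)
open import Data.List.Relation.Unary.Linked using (Linked)
open import Data.List.Relation.Unary.Unique.Propositional using (Unique)
open import Data.Nat using (ℕ; zero; suc; _+_; _*_; _^_; _⊔_; _≤_; _<_)
open import Data.Product using (Σ; ∃-syntax; _×_; _,_)
open import Data.Sum using (_⊎_)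
open import Data.Vec as Vec using (Vec)
open import Function using (_∘_)
open import Function.Bundles using (_⇔_)
open import Function.Definitions using (Injective)
open import Relation.Binary.Construct.Closure.ReflexiveTransitive using (Star)
open import Relation.Binary.PropositionalEquality using (_≡_; _≢_; sym)
open import Relation.Nullary using (Dec; yes; no)
open import Relation.Nullary.Decidable using (¬?; _×-dec_; _⊎-dec_; True; toWitness)

-- The edges are the positions of the list, so parallel edges are distinct.
-- The order inside a pair carries no meaning: endpoints are only ever
-- accessed through `Joins`.

NoLoop : ∀ {n} → Fin n × Fin n → Set
NoLoop (u , v) = u ≢ v

record Graph : Set where
  constructor graph
  field
    order    : ℕ
    edgeList : List (Fin order × Fin order)
    loopless : All NoLoop edgeList

open Graph public

Vertex : Graph → Set
Vertex G = Fin (order G)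

Edge : Graph → Set
Edge G = Fin (length (edgeList G))

JoinsPair : ∀ {n} → Fin n × Fin n → Fin n → Fin n → Set
JoinsPair (u , v) x y = (u ≡ x × v ≡ y) ⊎ (u ≡ y × v ≡ x)

joinsPair? : ∀ {n} (p : Fin n × Fin n) (x y : Fin n) → Dec (JoinsPair p x y)
joinsPair? (u , v) x y = (u ≟ x ×-dec v ≟ y) ⊎-dec (u ≟ y ×-dec v ≟ x)

Joins : (G : Graph) → Edge G → Vertex G → Vertex G → Set
Joins G e = JoinsPair (lookup (edgeList G) e)

IsMultiedge : (G : Graph) → Vertex G → Vertex G → Set
IsMultiedge G x y = ∃[ e ] Joins G e x y

-- The new vertex v_xy is `zero`; an old vertex v becomes `suc v`.

subdivideEdges : ∀ {n} (x y : Fin n) →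
                 List (Fin n × Fin n) → List (Fin (suc n) × Fin (suc n))
subdivideEdges x y []             = []
subdivideEdges x y ((u , v) ∷ es) with joinsPair? (u , v) x y
... | yes _ = (suc u , zero) ∷ (zero , suc v) ∷ subdivideEdges x y es
... | no  _ = (suc u , suc v) ∷ subdivideEdges x y es

subdivideEdges-loopless : ∀ {n} (x y : Fin n) {es} →
                          All NoLoop es → All NoLoop (subdivideEdges x y es)
subdivideEdges-loopless x y []                          = []
subdivideEdges-loopless x y {(u , v) ∷ _} (u≢v ∷ es) with joinsPair? (u , v) x y
... | yes _ = (0≢1+n ∘ sym) ∷ 0≢1+n ∷ subdivideEdges-loopless x y es
... | no  _ = (u≢v ∘ suc-injective) ∷ subdivideEdges-loopless x y es

mSubdivide : (H : Graph) → Vertex H → Vertex H → Graph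
mSubdivide H x y = record
  { order    = suc (order H)
  ; edgeList = subdivideEdges x y (edgeList H)
  ; loopless = subdivideEdges-loopless x y (loopless H)
  }

data _⟶ᵐ_ (H : Graph) : Graph → Set where
  subdivide : ∀ x y → IsMultiedge H x y → H ⟶ᵐ mSubdivide H x y

record IsoToSubgraph (K G : Graph) : Set where
  field
    onVertex        : Vertex K → Vertex G
    onEdge          : Edge K → Edge G
    vertexInjective : Injective _≡_ _≡_ onVertex
    edgeInjective   : Injective _≡_ _≡_ onEdge
    incidence       : ∀ {e x y} → Joins K e x y →
                      Joins G (onEdge e) (onVertex x) (onVertex y)

_IsMTopologicalMinorOf_ : Graph → Graph → Set
H IsMTopologicalMinorOf G = ∃[ K ] Star _⟶ᵐ_ H K × IsoToSubgraph K G

loopless? : ∀ {n} (es : List (Fin n × Fin n)) → Dec (All NoLoop es)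
loopless? = all? (λ (u , v) → ¬? (u ≟ v))

fromEdges : ∀ n (es : List (Fin n × Fin n)) {_ : True (loopless? es)} → Graph
fromEdges n es {p} = graph n es (toWitness p)

M₁ M₂ M₃ M₄ M₅ : Graph
M₁ = fromEdges 4
  ( (# 0 , # 1) ∷ (# 0 , # 1)
  ∷ (# 1 , # 2) ∷ (# 1 , # 2)
  ∷ (# 2 , # 3) ∷ (# 2 , # 3) ∷ [])
M₂ = fromEdges 4
  ( (# 0 , # 1) ∷ (# 1 , # 2) ∷ (# 2 , # 0)
  ∷ (# 0 , # 3) ∷ (# 0 , # 3) ∷ [])
M₃ = fromEdges 5
  ( (# 0 , # 1) ∷ (# 1 , # 2) ∷ (# 2 , # 0)
  ∷ (# 0 , # 3) ∷ (# 3 , # 4) ∷ (# 4 , # 0) ∷ [])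
M₄ = fromEdges 4
  ( (# 0 , # 1) ∷ (# 0 , # 1)
  ∷ (# 1 , # 2) ∷ (# 2 , # 3) ∷ (# 3 , # 0) ∷ [])
M₅ = fromEdges 4
  ( (# 0 , # 1) ∷ (# 1 , # 2) ∷ (# 2 , # 3) ∷ (# 3 , # 0)
  ∷ (# 0 , # 2) ∷ [])

record Timefunction (G : Graph) : Set where
  field
    time     : Edge G → ℕ
    positive : ∀ e → 0 < time e
    simple   : ∀ {e f x y} → Joins G e x y → Joins G f x y →
               time e ≡ time f → e ≡ f

module _ {G : Graph} where

  data Walk : Vertex G → Vertex G → Set where
    [_]     : ∀ x → Walk x x
    _-⟨_⟩-_ : ∀ x {y z e} → Joins G e x y → Walk y z → Walk x z

  vertices : ∀ {s z} → Walk s z → List (Vertex G)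
  vertices [ x ]          = x ∷ []
  vertices (x -⟨ _ ⟩- w) = x ∷ vertices w

  edges : ∀ {s z} → Walk s z → List (Edge G)
  edges [ _ ]                    = []
  edges (_-⟨_⟩-_ _ {e = e} _ w) = e ∷ edges w

module _ {G : Graph} (Λ : Timefunction G) where
  open Timefunction Λ

  lifetime : ℕ
  lifetime = foldr _⊔_ 0 (map time (allFin _))

  record TemporalPath (s z : Vertex G) : Set where
    field
      walk          : Walk {G} s z
      nondecreasing : Linked _≤_ (map time (edges walk))
      distinct      : Unique (vertices walk)

    pathEdges : List (Edge G)
    pathEdges = edges walk

    snapshots : List ℕ
    snapshots = map time pathEdges

  open TemporalPath

  SnapshotDisjoint : ∀ {s z} → TemporalPath s z → TemporalPath s z → Set
  SnapshotDisjoint P Q = Disjoint (snapshots P) (snapshots Q)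

  HasDisjointPaths : (s z : Vertex G) → ℕ → Set
  HasDisjointPaths s z k =
    Σ (Fin k → TemporalPath s z) λ P →
      ∀ i j → i ≢ j → SnapshotDisjoint (P i) (P j)

  -- t : Fin lifetime stands for the timestep suc (toℕ t) ∈ {1, …, τ}.
  ActiveIn : Edge G → Subset lifetime → Set
  ActiveIn e S = ∃[ t ] t ∈ₛ S × time e ≡ suc (toℕ t)

  IsSnapshotCut : (s z : Vertex G) → Subset lifetime → Set
  IsSnapshotCut s z S =
    (P : TemporalPath s z) → ∃[ e ] e ∈ pathEdges P × ActiveIn e S

  HasCutOfSize : (s z : Vertex G) → ℕ → Set
  HasCutOfSize s z k = ∃[ S ] IsSnapshotCut s z S × ∣ S ∣ ≡ k

IsMaximum IsMinimum : (ℕ → Set) → ℕ → Set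
IsMaximum A k = A k × (∀ j → A j → j ≤ k)
IsMinimum A k = A k × (∀ j → A j → k ≤ j)

-- Is-sp and Is-sc are the graphs of the functions sp and sc; for s ≢ z both
-- extrema exist and are unique, so sharing a value says sp(s,z) = sc(s,z).

Is-sp Is-sc : {G : Graph} → Timefunction G → Vertex G → Vertex G → ℕ → Set
Is-sp Λ s z = IsMaximum (HasDisjointPaths Λ s z)
Is-sc Λ s z = IsMinimum (HasCutOfSize Λ s z)

Mengerian : Graph → Set
Mengerian G = (Λ : Timefunction G) (s z : Vertex G) → s ≢ z →
              ∃[ k ] Is-sp Λ s z k × Is-sc Λ s z k

-- The machine model is Jones's WHILE language over binary trees
-- (Computability and Complexity, 1997), whose polynomial-time decidable
-- problems are exactly those of Turing machines.  There is no deep equality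
-- test, so every operation takes constant time on trees stored with sharing.

data Tree : Set where
  nil : Tree
  _∙_ : Tree → Tree → Tree

size : Tree → ℕ
size nil     = 1
size (l ∙ r) = suc (size l + size r)

data Expr (k : ℕ) : Set where
  var   : Fin k → Expr k
  nil   : Expr k
  cons  : Expr k → Expr k → Expr k
  hd tl : Expr k → Expr k

infixr 5 _⨾_
infix  6 _:=_

data Cmd (k : ℕ) : Set where
  _:=_           : Fin k → Expr k → Cmd k
  _⨾_            : Cmd k → Cmd k → Cmd k
  if_then_else_  : Expr k → Cmd k → Cmd k → Cmd k
  while_loop_    : Expr k → Cmd k → Cmd k

Store : ℕ → Set
Store k = Vec Tree k

left right : Tree → Tree
left  nil     = nil
left  (l ∙ _) = l
right nil     = nil
right (_ ∙ r) = r

eval : ∀ {k} → Expr k → Store k → Tree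
eval (var i)    σ = Vec.lookup σ i
eval nil        σ = nil
eval (cons a b) σ = eval a σ ∙ eval b σ
eval (hd a)     σ = left (eval a σ)
eval (tl a)     σ = right (eval a σ)

cost : ∀ {k} → Expr k → ℕ
cost (var _)    = 1
cost nil        = 1
cost (cons a b) = suc (cost a + cost b)
cost (hd a)     = suc (cost a)
cost (tl a)     = suc (cost a)

-- `nil` is the only false value.
truth : Tree → Bool
truth nil     = false
truth (_ ∙ _) = true

-- c ⊢ σ ⇓[ t ] σ′ : started in σ, the command c halts in σ′ after time t.

data _⊢_⇓[_]_ {k : ℕ} : Cmd k → Store k → ℕ → Store k → Set where
  assign : ∀ {i a σ} →
           (i := a) ⊢ σ ⇓[ suc (cost a) ] (σ Vec.[ i ]≔ eval a σ)
  seq    : ∀ {c d σ σ′ σ″ t u} →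
           c ⊢ σ ⇓[ t ] σ′ → d ⊢ σ′ ⇓[ u ] σ″ →
           (c ⨾ d) ⊢ σ ⇓[ t + u ] σ″
  ifT    : ∀ {a c d σ σ′ t} → truth (eval a σ) ≡ true →
           c ⊢ σ ⇓[ t ] σ′ →
           (if a then c else d) ⊢ σ ⇓[ suc (cost a + t) ] σ′
  ifF    : ∀ {a c d σ σ′ t} → truth (eval a σ) ≡ false →
           d ⊢ σ ⇓[ t ] σ′ →
           (if a then c else d) ⊢ σ ⇓[ suc (cost a + t) ] σ′
  whileT : ∀ {a c σ σ′ σ″ t u} → truth (eval a σ) ≡ true →
           c ⊢ σ ⇓[ t ] σ′ → (while a loop c) ⊢ σ′ ⇓[ u ] σ″ →
           (while a loop c) ⊢ σ ⇓[ suc (cost a + t + u) ] σ″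
  whileF : ∀ {a c σ} → truth (eval a σ) ≡ false →
           (while a loop c) ⊢ σ ⇓[ suc (cost a) ] σ

-- Variable 0 holds the input at the start and the answer at the end.

initial : ∀ {k} → Tree → Store (suc k)
initial d = d Vec.∷ Vec.replicate _ nil

answer : ∀ {k} → Store (suc k) → Bool
answer = truth ∘ Vec.head

-- Every polynomial is dominated by some n ↦ b * n ^ d + b.

PolyTimeDecidable : {A : Set} → (A → Tree) → (A → Set) → Set
PolyTimeDecidable {A} encode Q =
  ∃[ k ] Σ (Cmd (suc k)) λ program → ∃[ b ] ∃[ d ]
    ((x : A) → ∃[ t ] ∃[ σ ]
      program ⊢ initial (encode x) ⇓[ t ] σ
      × t ≤ b * size (encode x) ^ d + b
      × (answer σ ≡ true ⇔ Q x))

-- Vertices are written in unary; since the order is part of the input, the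
-- code still has size polynomial in |V(G)| + |E(G)|.

encodeℕ : ℕ → Tree
encodeℕ zero    = nil
encodeℕ (suc n) = nil ∙ encodeℕ n

encodeList : {A : Set} → (A → Tree) → List A → Tree
encodeList f []       = nil
encodeList f (x ∷ xs) = f x ∙ encodeList f xs

encodeGraph : Graph → Tree
encodeGraph G =
  encodeℕ (order G) ∙
  encodeList (λ (u , v) → encodeℕ (toℕ u) ∙ encodeℕ (toℕ v)) (edgeList G)

{-# OPTIONS --safe #-}

-- A graph has one of M₁, …, M₅ as an m-topological minor if and only if it
-- contains one of five configurations Bad₁, …, Bad₅, each described by at most
-- five vertices, some single and double adjacencies, and connectedness after
-- deleting one or two vertices.
--
-- In a bad configuration three times can be placed such that every s,z-path
-- using one of them uses a second one, while each of them is avoided by some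
-- path that uses only the other two.  Hence any two such paths meet, but every
-- cut contains two of the three times.  A cut as large as a family of disjoint
-- paths contains exactly one time from each path, so two of these paths meet.
--
-- Without bad configurations, either s lies on no cycle, and then the paths
-- share a single edge or have at most one inner vertex; or s lies on a cycle
-- which all paths leave through the same single edge, or in which they stay.
-- In a triangle a greedy matching by time gives the equality, and in a longer
-- cycle there are only two paths.
--
-- The five configurations are first-order conditions over adjacency, double
-- adjacency and reachability, hence are decided by nested loops over the
-- vertices.

module Submission where

open import Data.Bool using (Bool; true; false)
open import Data.Empty using (⊥; ⊥-elim)
open import Data.Fin using (Fin; zero; suc; toℕ; fromℕ<; #_)
open import Data.Fin.Properties using (_≟_; any?; toℕ<n; toℕ-injective; toℕ-fromℕ<; injective⇒≤; suc-injective)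
import Data.Fin.Properties as Fin
open import Data.Fin.Subset using (Subset; ∣_∣) renaming (_∈_ to _∈ₛ_)
open import Data.Fin.Subset using (_-_; inside; outside)
import Data.Fin.Subset as Subset
open import Data.Fin.Subset.Properties using (x∈p⇒∣p-x∣<∣p∣; x∈p∧x≢y⇒x∈p-y)
import Data.Fin.Subset.Properties as Subset
open import Data.List using (List; []; _∷_; _++_; length; lookup; map; foldr; allFin; tabulate; concatMap; take; drop)
import Data.List.Membership.DecPropositional as DecMembership
open import Data.List.Membership.Propositional using (_∈_; _∉_; find; lose)
open import Data.List.Membership.Propositional.Properties using (∈-lookup; ∈-map⁺; ∈-map⁻; ∈-allFin; ∈-++⁻)
open import Data.List.Properties using (++-identityʳ)
open import Data.List.Relation.Binary.Permutation.Propositional using (_↭_; ↭-refl; ↭-trans; ↭-sym; ↭⇒↭ₛ)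
open import Data.List.Relation.Binary.Permutation.Propositional.Properties using (shift; ++⁺ˡ; ↭-length; ∈-resp-↭)
open import Data.List.Relation.Binary.Permutation.Setoid.Properties using (Unique-resp-↭)
open import Data.List.Relation.Unary.All as All using (All; []; _∷_; all?)
open import Data.List.Relation.Unary.AllPairs as AllPairs using (AllPairs; []; _∷_)
open import Data.List.Relation.Unary.Any using (Any; here; there)
import Data.List.Relation.Unary.Any as Any
open import Data.List.Relation.Unary.Linked using (Linked; []; [-]; _∷_)
open import Data.List.Relation.Unary.Unique.Propositional using (Unique)
open import Data.List.Relation.Unary.Unique.Propositional.Properties using (Unique[x∷xs]⇒x∉xs)
import Data.List.Relation.Unary.Unique.Propositional.Properties as Unique
open import Data.Nat using (ℕ; zero; suc; _+_; _*_; _^_; _≤_; _<_; z≤n; s≤s; s≤s⁻¹; _≤?_; _<?_; _⊔_; _∸_)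
open import Data.Nat.Properties using (≤-refl; ≤-trans; ≤-reflexive; <-irrefl; m≤m+n; m≤n+m; n≤1+n; ≤-<-trans; +-mono-≤; +-monoʳ-≤; +-monoˡ-≤; *-mono-≤; +-cancelˡ-≡; ≮⇒≥)
import Data.Nat.Properties as ℕ
open import Data.Product using (Σ; ∃; ∃-syntax; _×_; _,_; proj₁; proj₂)
import Data.Product.Properties as Product
open import Data.Sum using (_⊎_; inj₁; inj₂; [_,_]′)
open import Data.Unit using (⊤; tt)
open import Data.Vec as Vec using (Vec)
import Data.Vec.Relation.Unary.All as VecAll
import Data.Vec.Relation.Unary.All.Properties as VecAll
import Data.Vec.Relation.Unary.AllPairs as VecAllPairs
import Data.Vec.Relation.Unary.Unique.Propositional as VecUnique
import Data.Vec.Relation.Unary.Unique.Propositional.Properties as VecUnique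
open import Function using (_∘_; id; case_of_)
open import Function.Bundles using (_⇔_; mk⇔; Equivalence)
open import Relation.Binary.Construct.Closure.ReflexiveTransitive using (Star; ε; _◅_; _◅◅_)
open import Relation.Binary.Construct.Closure.ReflexiveTransitive as Star using ()
open import Relation.Binary.PropositionalEquality using (_≡_; _≢_; refl; sym; trans; cong; cong₂; subst; ≢-sym; setoid)
open import Relation.Nullary using (Dec; yes; no; ¬_)
open import Relation.Nullary.Decidable using (¬?; _×-dec_; _⊎-dec_; True; toWitness; _→-dec_; False; toWitnessFalse)
open import Relation.Unary using (Decidable)
open import Defs

-- `Bad` is stated with reachability instead of paths or cycles because several arguments consume
-- it. When duality is refuted, a whole connected piece can receive one time, so no path in it has
-- to be selected; the program needs only a graph search; and reachability is easily carried through
-- an m-subdivision. Disjoint paths are extracted only where a minor has to be exhibited, by loop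
-- erasure and by stopping at a first intersection. Double adjacencies never have to be stretched:
-- when a double multiedge is m-subdivided, one half of it is again double and can replace it. The
-- refutation never computes sp or sc, since edges outside the configuration can carry many further
-- paths. It uses only that equality would make the map from the family to the times of the cut a
-- bijection. Three is the least number of times whose two-element subsets pairwise meet without
-- having a common element.

∈-resp : ∀ {A : Set} {x y : A} {l} → x ≡ y → x ∈ l → y ∈ l
∈-resp refl x∈l = x∈l

pairwise : ∀ {A : Set} {R : A → A → Set} {l x y} → AllPairs R l → x ∈ l → y ∈ l → x ≡ y ⊎ R x y ⊎ R y x
pairwise _        (here refl) (here refl) = inj₁ refl
pairwise (p ∷ _)  (here refl) (there j)   = inj₂ (inj₁ (All.lookup p j))
pairwise (p ∷ _)  (there i)   (here refl) = inj₂ (inj₂ (All.lookup p i))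
pairwise (_ ∷ ps) (there i)   (there j)   = pairwise ps i j

pattern first p q  = inj₁ (p , q)
pattern second p q = inj₂ (p , q)

-- Adjacency, double adjacency and reachability

module Theory (G : Graph) where

  Adjacent : Vertex G → Vertex G → Set
  Adjacent = IsMultiedge G

  Double : Vertex G → Vertex G → Set
  Double a b = ∃[ e ] ∃[ f ] e ≢ f × Joins G e a b × Joins G f a b

  noLoop : ∀ e → NoLoop (lookup (edgeList G) e)
  noLoop e = All.lookup (loopless G) (∈-lookup e)

  joins-sym : ∀ {e a b} → Joins G e a b → Joins G e b a
  joins-sym (inj₁ p) = inj₂ p
  joins-sym (inj₂ p) = inj₁ p

  joins-≢ : ∀ {e a b} → Joins G e a b → a ≢ b
  joins-≢ {e} (first p q)  a≡b = noLoop e (trans p (trans a≡b (sym q)))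
  joins-≢ {e} (second p q) a≡b = noLoop e (trans p (trans (sym a≡b) (sym q)))

  sameEnds : ∀ {e a b c d} → Joins G e a b → Joins G e c d → (a ≡ c × b ≡ d) ⊎ (a ≡ d × b ≡ c)
  sameEnds (first refl refl)  (first refl refl)  = inj₁ (refl , refl)
  sameEnds (first refl refl)  (second refl refl) = inj₂ (refl , refl)
  sameEnds (second refl refl) (first refl refl)  = inj₂ (refl , refl)
  sameEnds (second refl refl) (second refl refl) = inj₁ (refl , refl)

  adj-sym : ∀ {a b} → Adjacent a b → Adjacent b a
  adj-sym (e , j) = e , joins-sym j

  adj-≢ : ∀ {a b} → Adjacent a b → a ≢ b
  adj-≢ (e , j) = joins-≢ j

  joins? : ∀ e a b → Dec (Joins G e a b)
  joins? e = joinsPair? (lookup (edgeList G) e)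

  adj? : ∀ a b → Dec (Adjacent a b)
  adj? a b = any? λ e → joins? e a b

  double? : ∀ a b → Dec (Double a b)
  double? a b = any? λ e → any? λ f → ¬? (e ≟ f) ×-dec joins? e a b ×-dec joins? f a b

  double-sym : ∀ {a b} → Double a b → Double b a
  double-sym (e , f , n , j , k) = e , f , n , joins-sym j , joins-sym k

  double⇒adj : ∀ {a b} → Double a b → Adjacent a b
  double⇒adj (e , _ , _ , j , _) = e , j

  single : ∀ {a b e f} → ¬ Double a b → Joins G e a b → Joins G f a b → e ≡ f
  single {e = e} {f} nd j k with e ≟ f
  ... | yes p = p
  ... | no  p = ⊥-elim (nd (e , f , p , j , k))

  Step : (Vertex G → Set) → Vertex G → Vertex G → Set
  Step P a b = Adjacent a b × P a × P b

  Conn : (Vertex G → Set) → Vertex G → Vertex G → Set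
  Conn P = Star (Step P)

  conn-sym : ∀ {P a b} → Conn P a b → Conn P b a
  conn-sym = Star.reverse λ (j , p , q) → adj-sym j , q , p

  conn-mono : ∀ {P Q : Vertex G → Set} → (∀ {v} → P v → Q v) → ∀ {a b} → Conn P a b → Conn Q a b
  conn-mono f = Star.map λ (j , p , q) → j , f p , f q

  conn-end : ∀ {P : Vertex G → Set} {a b} → P a → Conn P a b → P b
  conn-end p ε                  = p
  conn-end p ((_ , _ , q) ◅ c) = conn-end q c

  conn-invariant : ∀ {P X : Vertex G → Set} → (∀ {a b} → Step P a b → X a → X b) →
                   ∀ {a b} → X a → Conn P a b → X b
  conn-invariant f x ε       = x
  conn-invariant f x (s ◅ c) = conn-invariant f (f s x) c

  -- The walk is cut at its first visit to `t`, so the part that is kept misses `t` altogether.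
  conn-until : ∀ {P : Vertex G → Set} {a} t → P a → a ≢ t → Conn P a t →
               ∃[ q ] Conn (λ v → P v × v ≢ t) a q × Adjacent q t × P q × q ≢ t
  conn-until t pa a≢t ε = ⊥-elim (a≢t refl)
  conn-until {a = a} t pa a≢t (_◅_ {j = b} (j , p , q) c) with b ≟ t
  ... | yes refl = a , ε , j , pa , a≢t
  ... | no b≢t with conn-until t q b≢t c
  ...   | r , d , k , pr , r≢t = r , (j , (p , a≢t) , (q , b≢t)) ◅ d , k , pr , r≢t

  Away : Vertex G → Vertex G → Vertex G → Set
  Away u v p = p ≢ u × p ≢ v

  away? : ∀ u v → Decidable (Away u v)
  away? u v p = ¬? (p ≟ u) ×-dec ¬? (p ≟ v)

  -- Walks and simple paths

  -- Nondecreasing times from t on; a bound makes suffixes inherit the property.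
  Timed : (Edge G → ℕ) → ℕ → ∀ {a b} → Walk {G} a b → Set
  Timed τ t [ _ ]                      = ⊤
  Timed τ t (_-⟨_⟩-_ _ {e = e} _ w) = t ≤ τ e × Timed τ (τ e) w

  timed-weaken : ∀ {τ t u a b} (w : Walk {G} a b) → u ≤ t → Timed τ t w → Timed τ u w
  timed-weaken [ _ ]          _   _       = tt
  timed-weaken (_ -⟨ _ ⟩- w) u≤t (p , q) = ≤-trans u≤t p , q

  start∈ : ∀ {a b} (w : Walk {G} a b) → a ∈ vertices w
  start∈ [ _ ]          = here refl
  start∈ (_ -⟨ _ ⟩- _) = here refl

  end∈ : ∀ {a b} (w : Walk {G} a b) → b ∈ vertices w
  end∈ [ _ ]          = here refl
  end∈ (_ -⟨ _ ⟩- w) = there (end∈ w)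

  record Shortened (τ : Edge G → ℕ) (t : ℕ) {a b c} (w : Walk {G} a c) : Set where
    constructor shortened
    field
      path      : Walk {G} b c
      timed     : Timed τ t path
      simple    : Unique (vertices path)
      vertices⊆ : ∀ {v} → v ∈ vertices path → v ∈ vertices w
      edges⊆    : ∀ {e} → e ∈ edges path → e ∈ edges w

  suffix : ∀ {τ t a b c} (w : Walk {G} a c) → Timed τ t w → Unique (vertices w) → b ∈ vertices w →
           Shortened τ t {b = b} w
  suffix w@([ _ ])        p u        (here refl) = shortened w p u id id
  suffix w@(_ -⟨ _ ⟩- _)  p u        (here refl) = shortened w p u id id
  suffix (_ -⟨ _ ⟩- w) (p , q) (_ ∷ u) (there i) with suffix w (timed-weaken w p q) u i
  ... | shortened w′ p′ u′ v⊆ e⊆ = shortened w′ p′ u′ (there ∘ v⊆) (there ∘ e⊆)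

  All≢ : ∀ {a : Vertex G} {l} → a ∉ l → All (a ≢_) l
  All≢ a∉l = All.tabulate λ i a≡ → a∉l (∈-resp (sym a≡) i)

  open import Data.List.Membership.DecPropositional (_≟_ {order G}) using (_∈?_) public

  -- Loop erasure. If the start recurs, the suffix from its recurrence is taken; dropping earlier
  -- edges only weakens the lower bound on the times, so their order survives.
  shorten : ∀ {τ t a c} (w : Walk {G} a c) → Timed τ t w → Shortened τ t {b = a} w
  shorten w@([ _ ]) p = shortened w p ([] ∷ []) id id
  shorten (_-⟨_⟩-_ a {e = e} j w) (p , q) with shorten w q
  ... | shortened w′ q′ u v⊆ e⊆ with a ∈? vertices w′
  ...   | no a∉ = shortened (a -⟨ j ⟩- w′) (p , q′) (All≢ a∉ ∷ u)
                    (λ { (here r) → here r ; (there i) → there (v⊆ i) })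
                    (λ { (here r) → here r ; (there i) → there (e⊆ i) })
  ...   | yes a∈ with suffix w′ (timed-weaken w′ p q′) u a∈
  ...     | shortened w″ p″ u″ v⊆′ e⊆′ = shortened w″ p″ u″ (there ∘ v⊆ ∘ v⊆′) (there ∘ e⊆ ∘ e⊆′)

  record SimplePath (P : Vertex G → Set) (a b : Vertex G) : Set where
    constructor simplePath
    field
      walk   : Walk {G} a b
      unique : Unique (vertices walk)
      within : ∀ {v} → v ∈ vertices walk → P v

  conn⇒walk : ∀ {P : Vertex G → Set} {a b} → P a → Conn P a b →
              Σ (Walk {G} a b) λ w → ∀ {v} → v ∈ vertices w → P v
  conn⇒walk p ε = [ _ ] , λ { (here refl) → p }
  conn⇒walk p (((e , j) , _ , q) ◅ c) with conn⇒walk q c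
  ... | w , all = _ -⟨ j ⟩- w , λ { (here refl) → p ; (there i) → all i }

  untimed : ∀ {a b} (w : Walk {G} a b) → Timed (λ _ → 0) 0 w
  untimed [ _ ]          = tt
  untimed (_ -⟨ _ ⟩- w) = z≤n , untimed w

  conn⇒path : ∀ {P : Vertex G → Set} {a b} → P a → Conn P a b → SimplePath P a b
  conn⇒path p c with conn⇒walk p c
  ... | w , all with shorten w (untimed w)
  ...   | shortened w′ _ u v⊆ _ = simplePath w′ u (all ∘ v⊆)

  walk⇒conn : ∀ {P : Vertex G → Set} {a b} (w : Walk {G} a b) → (∀ {v} → v ∈ vertices w → P v) → Conn P a b
  walk⇒conn [ _ ]          all = ε
  walk⇒conn (_ -⟨ j ⟩- w) all =
    ((_ , j) , all (here refl) , all (there (start∈ w))) ◅ walk⇒conn w (all ∘ there)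

  unique⇒length≤ : ∀ {l : List (Vertex G)} → Unique l → length l ≤ order G
  unique⇒length≤ {l} u = injective⇒≤ {f = lookup l} (inj u)
    where
    inj : ∀ {l : List (Vertex G)} → Unique l → ∀ {i j} → lookup l i ≡ lookup l j → i ≡ j
    inj (_ ∷ _)  {zero}  {zero}  _ = refl
    inj (x ∷ _)  {zero}  {suc j} p = ⊥-elim (All.lookup x (∈-lookup j) p)
    inj (x ∷ _)  {suc i} {zero}  p = ⊥-elim (All.lookup x (∈-lookup i) (sym p))
    inj (_ ∷ u)  {suc i} {suc j} p = cong suc (inj u p)

  module _ {P : Vertex G → Set} (P? : Decidable P) (τ : Edge G → ℕ) where

    Within : ℕ → ℕ → Vertex G → Vertex G → Set
    Within zero    t a b = ⊥
    Within (suc k) t a b = P a × (a ≡ b ⊎ ∃[ e ] ∃[ c ] Joins G e a c × t ≤ τ e × Within k (τ e) c b)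

    within? : ∀ k t a b → Dec (Within k t a b)
    within? zero    t a b = no λ ()
    within? (suc k) t a b = P? a ×-dec (a ≟ b ⊎-dec any? λ e → any? λ c →
      joins? e a c ×-dec t ≤? τ e ×-dec within? k (τ e) c b)

    TimedWalk : ℕ → Vertex G → Vertex G → Set
    TimedWalk t a b = Σ (Walk {G} a b) λ w → Timed τ t w × (∀ {v} → v ∈ vertices w → P v)

    within-sound : ∀ k {t a b} → Within k t a b → TimedWalk t a b
    within-sound (suc k) (p , inj₁ refl) = [ _ ] , tt , λ { (here refl) → p }
    within-sound (suc k) (p , inj₂ (e , c , j , t≤ , r)) with within-sound k r
    ... | w , q , all = _ -⟨ j ⟩- w , (t≤ , q) , λ { (here refl) → p ; (there i) → all i }

    within-complete : ∀ k {t a b} (w : Walk {G} a b) → Timed τ t w → (∀ {v} → v ∈ vertices w → P v) →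
                      length (vertices w) ≤ k → Within k t a b
    within-complete (suc k) [ _ ]          q       all l       = all (here refl) , inj₁ refl
    within-complete (suc k) (_ -⟨ j ⟩- w) (t≤ , q) all (s≤s l) =
      all (here refl) , inj₂ (_ , _ , j , t≤ , within-complete k w q (all ∘ there) l)

    -- Fuel `order G` misses nothing: after loop erasure no vertex is repeated.
    timedWalk? : ∀ t a b → Dec (TimedWalk t a b)
    timedWalk? t a b with within? (order G) t a b
    ... | yes r = yes (within-sound _ r)
    ... | no ¬r = no λ (w , q , all) → let open Shortened (shorten w q) in
      ¬r (within-complete _ path timed (all ∘ vertices⊆) (unique⇒length≤ simple))

  conn? : ∀ {P : Vertex G → Set} → Decidable P → ∀ a b → Dec (Conn P a b)
  conn? P? a b with a ≟ b
  ... | yes refl = yes ε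
  ... | no  a≢b with timedWalk? P? (λ _ → 0) 0 a b
  ...   | yes (w , _ , all) = yes (walk⇒conn w all)
  ...   | no ¬w = no λ { ε → a≢b refl
                       ; c@((_ , p , _) ◅ _) → case conn⇒walk p c of λ (w , all) → ¬w (w , untimed w , all) }

  -- The forbidden configurations.  The cycles of Bad₃ may meet outside u, but then Bad₅ holds as well.

  Bad₁ Bad₂ Bad₃ Bad₄ Bad₅ Bad : Set
  Bad₁ = ∃[ a ] ∃[ b ] ∃[ c ] ∃[ d ] a ≢ c × a ≢ d × b ≢ d
       × Double a b × Double b c × Double c d
  Bad₂ = ∃[ u ] ∃[ v ] ∃[ x ] ∃[ y ] x ≢ y × x ≢ v × y ≢ v
       × Double u v × Adjacent u x × Adjacent u y × Conn (Away u v) x y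
  Bad₃ = ∃[ u ] ∃[ a ] ∃[ b ] ∃[ c ] ∃[ d ] a ≢ b × a ≢ c × a ≢ d × b ≢ c × b ≢ d × c ≢ d
       × Adjacent u a × Adjacent u b × Adjacent u c × Adjacent u d
       × Conn (Away u u) a b × Conn (Away u u) c d
  Bad₄ = ∃[ x ] ∃[ y ] ∃[ a ] ∃[ b ] a ≢ b × a ≢ y × b ≢ x
       × Double x y × Adjacent x a × Adjacent y b × Conn (Away x y) a b
  Bad₅ = ∃[ u ] ∃[ a ] ∃[ b ] ∃[ c ] a ≢ b × a ≢ c × b ≢ c
       × Adjacent u a × Adjacent u b × Adjacent u c
       × Conn (Away u u) a b × Conn (Away u u) b c
  Bad = Bad₁ ⊎ Bad₂ ⊎ Bad₃ ⊎ Bad₄ ⊎ Bad₅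

-- Temporal paths and weak duality

module _ {n : ℕ} where

  injection⇒≤∣∣ : ∀ {k} (f : Fin k → Fin n) → (∀ {i j} → f i ≡ f j → i ≡ j) →
                  (S : Subset n) → (∀ i → f i ∈ₛ S) → k ≤ ∣ S ∣
  injection⇒≤∣∣ {zero}  f inj S f∈ = z≤n
  injection⇒≤∣∣ {suc k} f inj S f∈ = ≤-trans
    (s≤s (injection⇒≤∣∣ (f ∘ suc) (λ p → suc-injective (inj p)) (S - f zero)
      λ i → x∈p∧x≢y⇒x∈p-y (f∈ (suc i)) λ p → case inj p of λ ()))
    (x∈p⇒∣p-x∣<∣p∣ (f∈ zero))

  -- A missed element could be deleted from `S`, and the injection would still land in the smaller
  -- set.
  injection⇒surjection : ∀ {k} (f : Fin k → Fin n) → (∀ {i j} → f i ≡ f j → i ≡ j) →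
                         (S : Subset n) → (∀ i → f i ∈ₛ S) → ∣ S ∣ ≡ k →
                         ∀ {c} → c ∈ₛ S → ∃[ i ] f i ≡ c
  injection⇒surjection f inj S f∈ eq {c} c∈ with any? (λ i → f i ≟ c)
  ... | yes p = p
  ... | no ¬p = ⊥-elim (<-irrefl (sym eq) (≤-<-trans
          (injection⇒≤∣∣ f inj (S - c) λ i → x∈p∧x≢y⇒x∈p-y (f∈ i) λ q → ¬p (i , q))
          (x∈p⇒∣p-x∣<∣p∣ c∈)))

module Temporal {G : Graph} (Λ : Timefunction G) where
  open Theory G
  open Timefunction Λ
  open TemporalPath

  timed⇒linked : ∀ {t a b} (w : Walk {G} a b) → Timed time t w → Linked _≤_ (map time (edges w))
  timed⇒linked [ _ ]                          _           = []
  timed⇒linked (_ -⟨ _ ⟩- [ _ ])              _           = [-]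
  timed⇒linked (_ -⟨ _ ⟩- w@(_ -⟨ _ ⟩- _)) (_ , q , r) = q ∷ timed⇒linked w (q , r)

  linked⇒timed : ∀ {a b} (w : Walk {G} a b) → Linked _≤_ (map time (edges w)) → Timed time 0 w
  linked⇒timed [ _ ]          _ = tt
  linked⇒timed (_ -⟨ _ ⟩- w) l = z≤n , go w l
    where
    go : ∀ {t a b} (w : Walk {G} a b) → Linked _≤_ (t ∷ map time (edges w)) → Timed time t w
    go [ _ ]          _       = tt
    go (_ -⟨ _ ⟩- w) (p ∷ l) = p , go w l

  timed-lower : ∀ {t a b} (w : Walk {G} a b) → Timed time t w → ∀ {e} → e ∈ edges w → t ≤ time e
  timed-lower (_ -⟨ _ ⟩- w) (p , q) (here refl) = p
  timed-lower (_ -⟨ _ ⟩- w) (p , q) (there i)   = ≤-trans p (timed-lower w q i)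

  timed⇒path : ∀ {t a b} (w : Walk {G} a b) → Timed time t w →
               Σ (TemporalPath Λ a b) λ P → ∀ {e} → e ∈ pathEdges P → e ∈ edges w
  timed⇒path w p with shorten w p
  ... | shortened w′ p′ u _ e⊆ = record { walk = w′ ; nondecreasing = timed⇒linked w′ p′ ; distinct = u } , e⊆

  module Duality {s z : Vertex G} {k : ℕ} (P : Fin k → TemporalPath Λ s z)
                 (disjoint : ∀ i j → i ≢ j → SnapshotDisjoint Λ (P i) (P j))
                 (S : Subset (lifetime Λ)) (cut : IsSnapshotCut Λ s z S) where

    hit : Fin k → Fin (lifetime Λ)
    hit i with cut (P i)
    ... | _ , _ , t , _ = t

    hit∈ : ∀ i → hit i ∈ₛ S
    hit∈ i with cut (P i)
    ... | _ , _ , _ , t∈ , _ = t∈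

    hit-snapshot : ∀ i → suc (toℕ (hit i)) ∈ snapshots (P i)
    hit-snapshot i with cut (P i)
    ... | _ , e∈ , _ , _ , eq = ∈-resp eq (∈-map⁺ time e∈)

    hit-injective : ∀ {i j} → hit i ≡ hit j → i ≡ j
    hit-injective {i} {j} eq with i ≟ j
    ... | yes p = p
    ... | no  p = ⊥-elim (disjoint i j p
            (hit-snapshot i , subst (λ t → suc (toℕ t) ∈ snapshots (P j)) (sym eq) (hit-snapshot j)))

    k≤∣S∣ : k ≤ ∣ S ∣
    k≤∣S∣ = injection⇒≤∣∣ hit hit-injective S hit∈

    -- In the case of equality every time of the cut is spent on a path of the family. This yields
    -- contradictions without any knowledge of the other paths of the graph.
    hit-surjective : ∣ S ∣ ≡ k → ∀ {c} → c ∈ₛ S → ∃[ i ] hit i ≡ c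
    hit-surjective = injection⇒surjection hit hit-injective S hit∈

-- Timefunctions with three distinguished times

opaque

  -- Checked by evaluating all cases. For `i ≢ j` and `k ≢ l` this is the fact that two pairs of
  -- colours out of three have a common colour.
  share₃ : ∀ (i j k l : Fin 3) → i ≡ j ⊎ k ≡ l ⊎ ∃[ c ] (c ≡ i ⊎ c ≡ j) × (c ≡ k ⊎ c ≡ l)
  share₃ = toWitness {a? = Fin.all? λ i → Fin.all? λ j → Fin.all? λ k → Fin.all? λ l →
    i ≟ j ⊎-dec k ≟ l ⊎-dec any? λ c → (c ≟ i ⊎-dec c ≟ j) ×-dec (c ≟ k ⊎-dec c ≟ l)} tt

-- Coloured edges get three consecutive times.  The remaining edges get pairwise
-- distinct times, before all coloured ones at z and after them elsewhere, so
-- that no s,z-path combines them with coloured edges.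
module Gadget (G : Graph) {s z : Vertex G} (s≢z : s ≢ z)
  (Col : Fin 3 → Edge G → Set) (col? : ∀ i → Decidable (Col i))
  (functional : ∀ {i j e} → Col i e → Col j e → i ≡ j)
  (separate : ∀ {i e f a b} → Col i e → Col i f → Joins G e a b → Joins G f a b → e ≡ f)
  where
  open Theory G

  m : ℕ
  m = length (edgeList G)

  T : Fin 3 → ℕ
  T i = suc (m + toℕ i)

  Meets : Edge G → Set
  Meets e = ∃[ a ] Joins G e a z

  -- The early times lie in 1 to `m`, the coloured ones are `m + 1` to `m + 3`, and the late ones
  -- begin at `m + 4`. Using the edge index makes the early times pairwise distinct, and likewise
  -- the late ones.
  data Kind (e : Edge G) : ℕ → Set where
    early : Meets e → Kind e (suc (toℕ e))
    core  : ∀ {i} → Col i e → Kind e (T i)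
    late  : ¬ Meets e → Kind e (m + (4 + toℕ e))

  opaque

    kind : ∀ e → ∃ (Kind e)
    kind e with any? (λ i → col? i e) | any? (λ a → joins? e a z)
    ... | yes (_ , c) | _     = _ , core c
    ... | no  _       | yes p = _ , early p
    ... | no  _       | no  p = _ , late p

    kind-col : ∀ {i e} → Col i e → proj₁ (kind e) ≡ T i
    kind-col {e = e} c with any? (λ i → col? i e)
    ... | yes (j , d) = cong T (functional d c)
    ... | no ¬c       = ⊥-elim (¬c (_ , c))

  early≤ : ∀ (e : Edge G) → suc (toℕ e) ≤ m
  early≤ = toℕ<n

  core> : ∀ i → m < T i
  core> i = s≤s (m≤m+n m _)

  core≤ : ∀ i → T i ≤ m + 3
  core≤ i = subst (_≤ m + 3) (ℕ.+-suc m (toℕ i)) (+-monoʳ-≤ m (toℕ<n i))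

  late> : ∀ (e : Edge G) → m + 3 < m + (4 + toℕ e)
  late> e = subst (_≤ m + (4 + toℕ e)) (ℕ.+-suc m 3) (+-monoʳ-≤ m (m≤m+n 4 _))

  apart : ∀ {t u b} → t ≤ b → b < u → t ≢ u
  apart p q refl = <-irrefl refl (≤-trans q p)

  m≤m+3 : m ≤ m + 3
  m≤m+3 = m≤m+n m 3

  simple′ : ∀ {e f x y t u} → Kind e t → Kind f u → Joins G e x y → Joins G f x y → t ≡ u → e ≡ f
  simple′ (early _)        (early _)        _ _ p = toℕ-injective (ℕ.suc-injective p)
  simple′ {e} (early _)    (core {i} _)     _ _ p = ⊥-elim (apart (early≤ e) (core> i) p)
  simple′ {e} {f} (early _) (late _)        _ _ p = ⊥-elim (apart (≤-trans (early≤ e) m≤m+3) (late> f) p)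
  simple′ {f = f} (core {i} _) (early _)    _ _ p = ⊥-elim (apart (early≤ f) (core> i) (sym p))
  simple′ (core {i} c) (core {j} d)         h k p
    with toℕ-injective (+-cancelˡ-≡ m _ _ (ℕ.suc-injective p))
  ... | refl = separate c d h k
  simple′ {f = f} (core {i} _) (late _)     _ _ p = ⊥-elim (apart (core≤ i) (late> f) p)
  simple′ {e} {f} (late _) (early _)        _ _ p = ⊥-elim (apart (≤-trans (early≤ f) m≤m+3) (late> e) (sym p))
  simple′ {e} (late _) (core {i} _)         _ _ p = ⊥-elim (apart (core≤ i) (late> e) (sym p))
  simple′ {e} {f} (late _) (late _)         _ _ p =
    toℕ-injective (+-cancelˡ-≡ 4 _ _ (+-cancelˡ-≡ m _ _ p))

  kind>0 : ∀ {e t} → Kind e t → 0 < t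
  kind>0 (early _) = s≤s z≤n
  kind>0 (core _)  = s≤s z≤n
  kind>0 {e} (late _) = ≤-trans (s≤s z≤n) (late> e)

  Λ : Timefunction G
  Λ = record
    { time     = λ e → proj₁ (kind e)
    ; positive = λ e → kind>0 (proj₂ (kind e))
    ; simple   = λ {e} {f} → simple′ (proj₂ (kind e)) (proj₂ (kind f))
    }

  open Timefunction Λ
  open Temporal Λ
  open TemporalPath

  view : ∀ e → Kind e (time e)
  view e = proj₂ (kind e)

  meets⇒≤ : ∀ {e} → Meets e → time e ≤ m + 3
  meets⇒≤ {e} p with time e | view e
  ... | _ | early _    = ≤-trans (early≤ e) m≤m+3
  ... | _ | core {i} _ = core≤ i
  ... | _ | late ¬p    = ⊥-elim (¬p p)

  ¬meets⇒> : ∀ {e} → ¬ Meets e → m < time e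
  ¬meets⇒> {e} p with time e | view e
  ... | _ | early q    = ⊥-elim (p q)
  ... | _ | core {i} _ = core> i
  ... | _ | late _     = ≤-<-trans m≤m+3 (late> e)

  between⇒col : ∀ {e} → m < time e → time e ≤ m + 3 → ∃[ i ] Col i e
  between⇒col {e} p q with time e | view e
  ... | _ | early _    = ⊥-elim (apart (early≤ e) p refl)
  ... | _ | core {i} c = i , c
  ... | _ | late _     = ⊥-elim (apart q (late> e) refl)

  -- The last edge meets `z` and so is early or coloured; no other edge of the walk is later than
  -- it.
  never-late : ∀ {t x} (w : Walk {G} x z) → Timed time t w → ∀ {e} → e ∈ edges w → time e ≤ m + 3
  never-late (_ -⟨ j ⟩- [ _ ]) _ (here refl) = meets⇒≤ (_ , j)
  never-late (_ -⟨ j ⟩- w@(_ -⟨ _ ⟩- _)) (_ , q) (here refl) =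
    ≤-trans (proj₁ q) (never-late w q (here refl))
  never-late (_ -⟨ j ⟩- w@(_ -⟨ _ ⟩- _)) (_ , q) (there i) = never-late w q i

  -- A path of two or more edges begins with an edge that misses `z` and so is not early; with
  -- `never-late` this confines all its times to the coloured ones. A single edge is coloured
  -- because its own time is.
  all-coloured : ∀ (P : TemporalPath Λ s z) {c} → T c ∈ snapshots P →
                 ∀ {e} → e ∈ pathEdges P → ∃[ i ] Col i e
  all-coloured P {c} c∈ {e} e∈ = go (walk P) (linked⇒timed (walk P) (nondecreasing P)) (distinct P) c∈ e∈
    where
    go : (w : Walk {G} s z) → Timed time 0 w → Unique (vertices w) → T c ∈ map time (edges w) →
         e ∈ edges w → ∃[ i ] Col i e
    go w@(_ -⟨ j ⟩- [ _ ]) p _ (here eq) (here refl) =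
      between⇒col (subst (m <_) eq (core> c)) (never-late w p (here refl))
    go w@(_-⟨_⟩-_ x {y} {e = f} j v@(_ -⟨ k ⟩- v′)) p ((x≢y ∷ x∉) ∷ y∉ ∷ _) _ i =
      between⇒col (later i) (never-late w p i)
      where
      z∈ : z ∈ vertices v′
      z∈ = end∈ v′
      first> : m < time f
      first> = ¬meets⇒> λ (_ , l) → case sameEnds j l of λ
        { (inj₁ (_ , y≡z)) → All.lookup y∉ z∈ y≡z
        ; (inj₂ (x≡z , _)) → All.lookup x∉ z∈ x≡z }
      later : ∀ {g} → g ∈ edges w → m < time g
      later (here refl) = first>
      later (there i)   = ≤-trans first> (timed-lower v (proj₂ p) i)

  Class : Fin 3 → Vertex G → Vertex G → Set
  Class i a b = ∃[ e ] Joins G e a b × Col i e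

  Chain : Fin 3 → Fin 3 → Set
  Chain i j = ∃[ p ] Star (Class i) s p × Star (Class j) p z

  module _ (apart? : ∀ i → ¬ Star (Class i) s z) where

    monochrome : ∀ i {a b} (w : Walk {G} a b) → (∀ {e} → e ∈ edges w → ∃[ i ] Col i e) →
                 Star (Class i) a b ⊎ ∃[ j ] j ≢ i × T j ∈ map time (edges w)
    monochrome i [ _ ] all = inj₁ ε
    monochrome i (_ -⟨ h ⟩- w) all with all (here refl)
    ... | j , c with j ≟ i
    ...   | no j≢i = inj₂ (j , j≢i , here (sym (kind-col c)))
    ...   | yes refl with monochrome i w (all ∘ there)
    ...     | inj₁ st          = inj₁ ((_ , h , c) ◅ st)
    ...     | inj₂ (k , n , t) = inj₂ (k , n , there t)

    other-colour : ∀ (P : TemporalPath Λ s z) {i} → T i ∈ snapshots P → ∃[ j ] j ≢ i × T j ∈ snapshots P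
    other-colour P {i} i∈ with monochrome i (walk P) (all-coloured P i∈)
    ... | inj₁ st = ⊥-elim (apart? i st)
    ... | inj₂ r  = r

    meet : ∀ (P Q : TemporalPath Λ s z) {i j} → T i ∈ snapshots P → T j ∈ snapshots Q →
           ¬ SnapshotDisjoint Λ P Q
    meet P Q {i} {j} i∈ j∈ dis with other-colour P i∈ | other-colour Q j∈
    ... | k , k≢i , k∈ | l , l≢j , l∈ with share₃ k i l j
    ... | inj₁ k≡i = k≢i k≡i
    ... | inj₂ (inj₁ l≡j) = l≢j l≡j
    ... | inj₂ (inj₂ (c , p , q)) = dis (pick p k∈ i∈ , pick q l∈ j∈)
      where
      pick : ∀ {c x y l} → c ≡ x ⊎ c ≡ y → T x ∈ l → T y ∈ l → T c ∈ l
      pick (inj₁ refl) a _ = a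
      pick (inj₂ refl) _ b = b

    -- All edges of a colour have the same time, so every walk inside a colour class is temporal.
    prepend : ∀ {i a b c} → Star (Class i) a b → (w : Walk {G} b c) → Timed time (T i) w →
              Σ (Walk {G} a c) λ w′ → Timed time (T i) w′ ×
                (∀ {e} → e ∈ edges w′ → Col i e ⊎ e ∈ edges w)
    prepend ε w p = w , p , inj₂
    prepend {i} ((e , j , col) ◅ st) w p with prepend st w p
    ... | w′ , p′ , f = _ -⟨ j ⟩- w′ , (≤-reflexive (sym (kind-col col)) ,
            subst (λ t → Timed time t w′) (sym (kind-col col)) p′) ,
            λ { (here refl) → inj₁ col ; (there i) → f i }

    chain-path : ∀ {i j} → T i ≤ T j → Chain i j →
                 Σ (TemporalPath Λ s z) λ P → ∀ {e} → e ∈ pathEdges P → Col i e ⊎ Col j e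
    chain-path {i} {j} i≤j (p , a , b) with prepend b [ z ] tt
    ... | w , q , f with prepend a w (timed-weaken w i≤j q)
    ...   | w′ , q′ , f′ with timed⇒path w′ q′
    ...     | P , e⊆ = P , λ i → case f′ (e⊆ i) of λ
              { (inj₁ c) → inj₁ c
              ; (inj₂ k) → case f k of λ { (inj₁ c) → inj₂ c } }

    ¬mengerian : Chain (# 0) (# 1) → Chain (# 0) (# 2) → Chain (# 1) (# 2) → ¬ Mengerian G
    ¬mengerian c₀₁ c₀₂ c₁₂ men with men Λ s z s≢z
    ... | k , ((P , dis) , _) , ((S , cut , ∣S∣≡k) , _) = finish
      where
      open Duality P dis S cut
      In : Fin 3 → Set
      In i = ∃[ t ] t ∈ₛ S × T i ≡ suc (toℕ t)
      one-of : ∀ {i j} → T i ≤ T j → Chain i j → In i ⊎ In j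
      one-of i≤j c with chain-path i≤j c
      ... | Q , cols with cut Q
      ... | e , e∈ , t , t∈ , eq with cols e∈
      ... | inj₁ d = inj₁ (t , t∈ , trans (sym (kind-col d)) eq)
      ... | inj₂ d = inj₂ (t , t∈ , trans (sym (kind-col d)) eq)
      T-mono : ∀ {i j} → toℕ i ≤ toℕ j → T i ≤ T j
      T-mono p = s≤s (+-monoʳ-≤ m p)
      clash : ∀ {i j} → i ≢ j → In i → In j → ⊥
      clash {i} {j} i≢j (t , t∈ , p) (u , u∈ , q)
        with hit-surjective ∣S∣≡k t∈ | hit-surjective ∣S∣≡k u∈
      ... | x , refl | y , refl = meet (P x) (P y) {i} {j}
        (∈-resp (sym p) (hit-snapshot x)) (∈-resp (sym q) (hit-snapshot y))
        (dis x y λ { refl → i≢j (toℕ-injective (+-cancelˡ-≡ m _ _ (ℕ.suc-injective (trans p (sym q))))) })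
      finish : ⊥
      finish with one-of {# 0} {# 1} (T-mono z≤n) c₀₁ | one-of {# 0} {# 2} (T-mono z≤n) c₀₂
                | one-of {# 1} {# 2} (T-mono (s≤s z≤n)) c₁₂
      ... | inj₁ a | _      | inj₁ c = clash {# 0} {# 1} (λ ()) a c
      ... | inj₁ a | _      | inj₂ c = clash {# 0} {# 2} (λ ()) a c
      ... | inj₂ b | inj₁ a | _      = clash {# 1} {# 0} (λ ()) b a
      ... | inj₂ b | inj₂ c | _      = clash {# 1} {# 2} (λ ()) b c

-- Bad configurations refute duality

module Colouring (G : Graph) where
  open Theory G public

  end₁ end₂ : Edge G → Vertex G
  end₁ e = proj₁ (lookup (edgeList G) e)
  end₂ e = proj₂ (lookup (edgeList G) e)

  ends : ∀ e → Joins G e (end₁ e) (end₂ e)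
  ends e = inj₁ (refl , refl)

  parallel : ∀ {e f a b c d} → Joins G e a b → Joins G e c d → Joins G f a b → Joins G f c d
  parallel j k l with sameEnds j k
  ... | inj₁ (refl , refl) = l
  ... | inj₂ (refl , refl) = joins-sym l

  -- Parallel edges need distinct times, so a colour spread over a whole region may use only one
  -- edge of each parallel class. The least index selects it.
  Canonical : Edge G → Set
  Canonical e = ∀ f → Joins G f (end₁ e) (end₂ e) → toℕ e ≤ toℕ f

  canonical? : Decidable Canonical
  canonical? e = Fin.all? λ f → joins? f _ _ →-dec toℕ e ≤? toℕ f

  canonical-unique : ∀ {e f a b} → Canonical e → Canonical f → Joins G e a b → Joins G f a b → e ≡ f
  canonical-unique {e} {f} p q j k =
    toℕ-injective (ℕ.≤-antisym (p f (parallel j (ends e) k)) (q e (parallel k (ends f) j)))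

  canonical : ∀ {a b} → Adjacent a b → ∃[ e ] Canonical e × Joins G e a b
  canonical {a} {b} (e , j) = go (toℕ e) e ≤-refl j
    where
    go : ∀ k e → toℕ e ≤ k → Joins G e a b → ∃[ e ] Canonical e × Joins G e a b
    go k e e≤k j with any? (λ f → toℕ f <? toℕ e ×-dec joins? f a b)
    go k e e≤k j | no ¬s = e , (λ f l → ≮⇒≥ λ f<e → ¬s (f , f<e , parallel (ends e) j l)) , j
    go zero e e≤k j    | yes (f , f<e , l) = case ≤-trans f<e e≤k of λ ()
    go (suc k) e e≤k j | yes (f , f<e , l) = go k f (s≤s⁻¹ (≤-trans f<e e≤k)) l

  -- Parallel edges must get different colours, since a colour is a single time; `e ≢ f` prevents
  -- one edge from getting two colours.
  Compatible : Edge G × Fin 3 → Edge G × Fin 3 → Set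
  Compatible (e , i) (f , j) = ∀ {a b} → Joins G e a b → Joins G f a b → i ≢ j × e ≢ f

  off : ∀ {e f i j a b c d} → Joins G e a b → Joins G f c d → a ≢ c → a ≢ d → Compatible (e , i) (f , j)
  off j k p q j′ k′ = ⊥-elim (case sameEnds (parallel j′ j k′) k of λ
    { (inj₁ (r , _)) → p r ; (inj₂ (r , _)) → q r })

  twin : ∀ {e f i j} → i ≢ j → e ≢ f → Compatible (e , i) (f , j)
  twin p q _ _ = p , q

  Closed : (Vertex G → Set) → Edge G → Set
  Closed X e = ∀ {a b} → Joins G e a b → X a → X b

  keep : ∀ {X : Vertex G → Set} {e a b} → Joins G e a b → (X a → X b) → (X b → X a) → Closed X e
  keep j f g k with sameEnds j k
  ... | inj₁ (refl , refl) = f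
  ... | inj₂ (refl , refl) = g

  missing : ∀ {t e a b} → Joins G e a b → a ≢ t → b ≢ t → Closed (_≢ t) e
  missing j p q = keep j (λ _ → q) (λ _ → p)

  avoiding : ∀ {t e a b} → Joins G e a b → a ≢ t → b ≢ t → Closed (_≡ t) e
  avoiding j p q = keep j (⊥-elim ∘ p) (⊥-elim ∘ q)

  -- A colouring consists of the list `spec` and of one colour `back` on all canonical edges inside
  -- the region `P`. Every listed edge has an end outside `P`, so the two sources of colour never
  -- compete for an edge or a parallel class.
  module Scheme {s z : Vertex G} (s≢z : s ≢ z) (spec : List (Edge G × Fin 3))
                (compatible : AllPairs Compatible spec)
                {P : Vertex G → Set} (P? : Decidable P) (back : Fin 3)
                (touching : All (λ x → ∃[ p ] ∃[ q ] Joins G (proj₁ x) p q × ¬ P p) spec) where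

    Back : Edge G → Set
    Back e = Canonical e × P (end₁ e) × P (end₂ e)

    back-ends : ∀ {e a b} → Back e → Joins G e a b → P a × P b
    back-ends {e} (_ , p , q) j with sameEnds (ends e) j
    ... | inj₁ (refl , refl) = p , q
    ... | inj₂ (refl , refl) = q , p

    Col : Fin 3 → Edge G → Set
    Col i e = (e , i) ∈ spec ⊎ (i ≡ back × Back e)

    col? : ∀ i → Decidable (Col i)
    col? i e = Any.any? (Product.≡-dec _≟_ _≟_ (e , i)) spec ⊎-dec
      (i ≟ back ×-dec canonical? e ×-dec P? _ ×-dec P? _)

    spec-back : ∀ {e f i} {A : Set} {a b} → (e , i) ∈ spec → Back f → Joins G e a b → Joins G f a b → A
    spec-back i q j k with All.lookup touching i
    ... | _ , _ , l , ¬p = ⊥-elim (¬p (proj₁ (back-ends q (parallel j l k))))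

    functional : ∀ {i j e} → Col i e → Col j e → i ≡ j
    functional {e = e} (inj₁ x) (inj₁ y) with pairwise {R = Compatible} compatible x y
    ... | inj₁ refl     = refl
    ... | inj₂ (inj₁ c) = ⊥-elim (proj₂ (c (ends e) (ends e)) refl)
    ... | inj₂ (inj₂ c) = ⊥-elim (proj₂ (c (ends e) (ends e)) refl)
    functional {e = e} (inj₁ x) (inj₂ (_ , q)) = spec-back x q (ends e) (ends e)
    functional {e = e} (inj₂ (_ , q)) (inj₁ x) = spec-back x q (ends e) (ends e)
    functional (inj₂ (refl , _)) (inj₂ (refl , _)) = refl

    separate : ∀ {i e f a b} → Col i e → Col i f → Joins G e a b → Joins G f a b → e ≡ f
    separate (inj₁ x) (inj₁ y) j k with pairwise {R = Compatible} compatible x y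
    ... | inj₁ refl     = refl
    ... | inj₂ (inj₁ c) = ⊥-elim (proj₁ (c j k) refl)
    ... | inj₂ (inj₂ c) = ⊥-elim (proj₁ (c k j) refl)
    separate (inj₁ x) (inj₂ (_ , q)) j k = spec-back x q j k
    separate (inj₂ (_ , q)) (inj₁ x) j k = spec-back x q k j
    separate (inj₂ (_ , p , _)) (inj₂ (_ , q , _)) j k = canonical-unique p q j k

    open Gadget G s≢z Col col? functional separate public

    -- `X` is an invariant that separates `s` from `z`: no edge of colour `i` leaves it.
    confined : ∀ {i} (X : Vertex G → Set) → X s → ¬ X z →
               All (λ x → proj₂ x ≡ i → Closed X (proj₁ x)) spec →
               (i ≡ back → ∀ {a b} → Step P a b → X a → X b) → ¬ Star (Class i) s z
    confined {i} X x ¬x cl bk st = ¬x (go x st)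
      where
      go : ∀ {a} → X a → Star (Class i) a z → X z
      go x ε = x
      go x ((e , j , inj₁ m) ◅ st) = go (All.lookup cl m refl j x) st
      go x ((e , j , inj₂ (p , q)) ◅ st) = go (bk p ((e , j) , back-ends q j) x) st

    conn⇒class : ∀ {a b} → Conn P a b → Star (Class back) a b
    conn⇒class = Star.map λ (adj , p , q) → case canonical adj of λ
      { (e , can , j) → e , j , inj₂ (refl , can , ends-in e j p q) }
      where
      ends-in : ∀ e {a b} → Joins G e a b → P a → P b → P (end₁ e) × P (end₂ e)
      ends-in e j p q with sameEnds (ends e) j
      ... | inj₁ (refl , refl) = p , q
      ... | inj₂ (refl , refl) = q , p

  ¬away₁ : ∀ {u v} → ¬ Away u v u
  ¬away₁ (p , _) = p refl

  ¬away₂ : ∀ {u v} → ¬ Away u v v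
  ¬away₂ (_ , p) = p refl

  pattern 0th = here refl
  pattern 1st = there 0th
  pattern 2nd = there 1st
  pattern 3rd = there 2nd
  pattern 4th = there 3rd
  pattern 5th = there 4th

  -- Along the path of three double edges each colour omits one of them: colour 0 the last, colour 1
  -- the middle, colour 2 the first.
  bad₁⇒¬mengerian : Bad₁ → ¬ Mengerian G
  bad₁⇒¬mengerian (a , b , c , d , a≢c , a≢d , b≢d , (e₁ , e₂ , e≢ , E₁ , E₂)
                  , (f₁ , f₂ , f≢ , F₁ , F₂) , (g₁ , g₂ , g≢ , G₁ , G₂)) =
    ¬mengerian
      (λ { zero → confined (_≢ d) a≢d (λ p → p refl)
             ((λ _ → missing E₁ a≢d b≢d) ∷ (λ _ → missing F₁ b≢d c≢d) ∷ (λ ()) ∷ (λ ()) ∷ (λ ()) ∷ (λ ()) ∷ [])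
             (λ { _ (_ , () , _) })
         ; (suc zero) → confined (λ v → v ≡ a ⊎ v ≡ b) (inj₁ refl)
             (λ { (inj₁ p) → a≢d (sym p) ; (inj₂ p) → b≢d (sym p) })
             ((λ ()) ∷ (λ ()) ∷ (λ _ → keep E₂ (λ _ → inj₂ refl) (λ _ → inj₁ refl))
               ∷ (λ _ → keep G₁ (λ { (inj₁ p) → ⊥-elim (a≢c (sym p)) ; (inj₂ p) → ⊥-elim (b≢c (sym p)) })
                                (λ { (inj₁ p) → ⊥-elim (a≢d (sym p)) ; (inj₂ p) → ⊥-elim (b≢d (sym p)) }))
               ∷ (λ ()) ∷ (λ ()) ∷ [])
             (λ { _ (_ , () , _) })
         ; (suc (suc zero)) → confined (_≡ a) refl (≢-sym a≢d)
             ((λ ()) ∷ (λ ()) ∷ (λ ()) ∷ (λ ()) ∷ (λ _ → avoiding F₂ (≢-sym a≢b) (≢-sym a≢c))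
               ∷ (λ _ → avoiding G₂ (≢-sym a≢c) (≢-sym a≢d)) ∷ [])
             (λ { _ (_ , () , _) }) })
      (c , (e₁ , E₁ , inj₁ 0th) ◅ (f₁ , F₁ , inj₁ 1st) ◅ ε , (g₁ , G₁ , inj₁ 3rd) ◅ ε)
      (c , (e₁ , E₁ , inj₁ 0th) ◅ (f₁ , F₁ , inj₁ 1st) ◅ ε , (g₂ , G₂ , inj₁ 5th) ◅ ε)
      (b , (e₂ , E₂ , inj₁ 2nd) ◅ ε , (f₂ , F₂ , inj₁ 4th) ◅ (g₂ , G₂ , inj₁ 5th) ◅ ε)
    where
    a≢b = joins-≢ E₁
    b≢c = joins-≢ F₁
    c≢d = joins-≢ G₁
    spec = (e₁ , # 0) ∷ (f₁ , # 0) ∷ (e₂ , # 1) ∷ (g₁ , # 1) ∷ (f₂ , # 2) ∷ (g₂ , # 2) ∷ []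
    compatible : AllPairs Compatible spec
    compatible =
        (off E₁ F₁ a≢b a≢c ∷ twin (λ ()) e≢ ∷ off E₁ G₁ a≢c a≢d ∷ off E₁ F₂ a≢b a≢c ∷ off E₁ G₂ a≢c a≢d ∷ [])
      ∷ (off (joins-sym F₁) E₂ (≢-sym a≢c) (≢-sym b≢c) ∷ off F₁ G₁ b≢c b≢d ∷ twin (λ ()) f≢ ∷ off F₁ G₂ b≢c b≢d ∷ [])
      ∷ (off E₂ G₁ a≢c a≢d ∷ off E₂ F₂ a≢b a≢c ∷ off E₂ G₂ a≢c a≢d ∷ [])
      ∷ (off (joins-sym G₁) F₂ (≢-sym b≢d) (≢-sym c≢d) ∷ twin (λ ()) g≢ ∷ [])
      ∷ (off F₂ G₂ b≢c b≢d ∷ [])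
      ∷ [] ∷ []
    none? : Decidable {A = Vertex G} (λ _ → ⊥)
    none? _ = no λ ()
    touching : All (λ x → ∃[ p ] ∃[ q ] Joins G (proj₁ x) p q × ¬ ⊥) spec
    touching = (_ , _ , E₁ , id) ∷ (_ , _ , F₁ , id) ∷ (_ , _ , E₂ , id)
             ∷ (_ , _ , G₁ , id) ∷ (_ , _ , F₂ , id) ∷ (_ , _ , G₂ , id) ∷ []
    open Scheme a≢d spec compatible none? (# 0) touching

  -- From `x` to `v`: the edge `xu` has colour 0, and the double edge `uv` can be taken in colour 1
  -- or 2. The detour from `x` to `y` through the region has colour 1 and is continued by `yu` and
  -- `uv` in colour 2.
  bad₂⇒¬mengerian : Bad₂ → ¬ Mengerian G
  bad₂⇒¬mengerian (u , v , x , y , x≢y , x≢v , y≢v , (e , f , e≢f , E , F) , (g , G₁) , (h , H) , x~y) =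
    ¬mengerian
      (λ { zero → confined (_≢ v) x≢v (λ p → p refl)
             ((λ _ → missing G₁ u≢v x≢v) ∷ (λ ()) ∷ (λ ()) ∷ (λ ()) ∷ []) (λ ())
         ; (suc zero) → confined (Away u v) (≢-sym u≢x , x≢v) ¬away₂
             ((λ ()) ∷ (λ _ → keep E (⊥-elim ∘ ¬away₁) (⊥-elim ∘ ¬away₂)) ∷ (λ ()) ∷ (λ ()) ∷ [])
             (λ { _ (_ , _ , q) _ → q })
         ; (suc (suc zero)) → confined (_≡ x) refl (≢-sym x≢v)
             ((λ ()) ∷ (λ ()) ∷ (λ _ → avoiding H u≢x (≢-sym x≢y)) ∷ (λ _ → avoiding F u≢x (≢-sym x≢v)) ∷ [])
             (λ ()) })
      (u , (g , joins-sym G₁ , inj₁ 0th) ◅ ε , (e , E , inj₁ 1st) ◅ ε)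
      (u , (g , joins-sym G₁ , inj₁ 0th) ◅ ε , (f , F , inj₁ 3rd) ◅ ε)
      (y , conn⇒class x~y , (h , joins-sym H , inj₁ 2nd) ◅ (f , F , inj₁ 3rd) ◅ ε)
    where
    u≢v = joins-≢ E
    u≢x = joins-≢ G₁
    u≢y = joins-≢ H
    spec = (g , # 0) ∷ (e , # 1) ∷ (h , # 2) ∷ (f , # 2) ∷ []
    compatible : AllPairs Compatible spec
    compatible =
        (off (joins-sym G₁) E (≢-sym u≢x) x≢v ∷ off (joins-sym G₁) H (≢-sym u≢x) x≢y
          ∷ off (joins-sym G₁) F (≢-sym u≢x) x≢v ∷ [])
      ∷ (off (joins-sym E) H (≢-sym u≢v) (≢-sym y≢v) ∷ twin (λ ()) e≢f ∷ [])
      ∷ (off (joins-sym H) F (≢-sym u≢y) y≢v ∷ [])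
      ∷ [] ∷ []
    touching : All (λ x → ∃[ p ] ∃[ q ] Joins G (proj₁ x) p q × ¬ Away u v p) spec
    touching = (_ , _ , G₁ , ¬away₁) ∷ (_ , _ , E , ¬away₁) ∷ (_ , _ , H , ¬away₁) ∷ (_ , _ , F , ¬away₁) ∷ []
    open Scheme x≢v spec compatible (away? u v) (# 1) touching

  -- From `x` to `b`: one way round takes `xa` in colour 0 and the region in colour 1; the other
  -- takes the double edge in colour 0 or 1 and then `yb` in colour 2.
  bad₄⇒¬mengerian : Bad₄ → ¬ Mengerian G
  bad₄⇒¬mengerian (x , y , a , b , a≢b , a≢y , b≢x , (e , f , e≢f , E , F) , (g , G₁) , (h , H) , a~b) =
    ¬mengerian
      (λ { zero → confined (_≢ b) x≢b (λ p → p refl)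
             ((λ _ → missing E x≢b y≢b) ∷ (λ _ → missing G₁ x≢b a≢b) ∷ (λ ()) ∷ (λ ()) ∷ []) (λ ())
         ; (suc zero) → confined (λ v → v ≡ x ⊎ v ≡ y) (inj₁ refl)
             (λ { (inj₁ p) → b≢x p ; (inj₂ p) → y≢b (sym p) })
             ((λ ()) ∷ (λ ()) ∷ (λ _ → keep F (λ _ → inj₂ refl) (λ _ → inj₁ refl)) ∷ (λ ()) ∷ [])
             (λ { _ (_ , (p , q) , _) → λ { (inj₁ r) → ⊥-elim (p r) ; (inj₂ r) → ⊥-elim (q r) } })
         ; (suc (suc zero)) → confined (_≡ x) refl b≢x
             ((λ ()) ∷ (λ ()) ∷ (λ ()) ∷ (λ _ → avoiding H (≢-sym x≢y) b≢x) ∷ []) (λ ()) })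
      (a , (g , G₁ , inj₁ 1st) ◅ ε , conn⇒class a~b)
      (y , (e , E , inj₁ 0th) ◅ ε , (h , H , inj₁ 3rd) ◅ ε)
      (y , (f , F , inj₁ 2nd) ◅ ε , (h , H , inj₁ 3rd) ◅ ε)
    where
    x≢y = joins-≢ E
    x≢a = joins-≢ G₁
    y≢b = joins-≢ H
    x≢b = ≢-sym b≢x
    spec = (e , # 0) ∷ (g , # 0) ∷ (f , # 1) ∷ (h , # 2) ∷ []
    compatible : AllPairs Compatible spec
    compatible =
        (off (joins-sym E) G₁ (≢-sym x≢y) (≢-sym a≢y) ∷ twin (λ ()) e≢f ∷ off E H x≢y x≢b ∷ [])
      ∷ (off (joins-sym G₁) F (≢-sym x≢a) a≢y ∷ off G₁ H x≢y x≢b ∷ [])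
      ∷ (off F H x≢y x≢b ∷ [])
      ∷ [] ∷ []
    touching : All (λ w → ∃[ p ] ∃[ q ] Joins G (proj₁ w) p q × ¬ Away x y p) spec
    touching = (_ , _ , E , ¬away₁) ∷ (_ , _ , G₁ , ¬away₁) ∷ (_ , _ , F , ¬away₁) ∷ (_ , _ , H , ¬away₂) ∷ []
    open Scheme x≢b spec compatible (away? x y) (# 1) touching

  -- A theta graph with branch vertex u, whose other branch vertex lies on a
  -- walk w ~ a ~ b avoiding the neighbour c of u.
  Theta : Set
  Theta = ∃[ u ] ∃[ a ] ∃[ b ] ∃[ c ] ∃[ w ] a ≢ b × a ≢ c × b ≢ c × w ≢ u × w ≢ a
        × Adjacent u a × Adjacent u b × Adjacent u c × Adjacent c w
        × Conn (Away u c) w a × Conn (Away u c) a b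

  away-nbr : ∀ {u v} → Adjacent u v → Away u u v
  away-nbr A = ≢-sym (adj-≢ A) , ≢-sym (adj-≢ A)

  away-≢ : ∀ {u c v} → Away u u v × v ≢ c → Away u c v
  away-≢ ((p , _) , q) = p , q

  -- `w` is the vertex from which a walk starting in `a` first enters `c`. If it is `a` itself,
  -- exchanging `a` and `b` restores `w ≢ a`.
  theta : ∀ {u a b c} → a ≢ b → a ≢ c → b ≢ c → Adjacent u a → Adjacent u b → Adjacent u c →
          Conn (Away u c) a b → Conn (Away u u) a c → Theta
  theta {u} {a} {b} {c} a≢b a≢c b≢c A B C a~b a~c with conn-until c (away-nbr A) a≢c a~c
  ... | w , d , k , (w≢u , _) , w≢c with w ≟ a
  ...   | no w≢a = u , a , b , c , w , a≢b , a≢c , b≢c , w≢u , w≢a , A , B , C , adj-sym k ,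
                   conn-sym (conn-mono away-≢ d) , a~b
  ...   | yes refl = u , b , a , c , a , ≢-sym a≢b , b≢c , a≢c , w≢u , a≢b , B , A , C , adj-sym k ,
                     a~b , conn-sym a~b

  -- Every vertex on the way is reached from `a` while avoiding `b`, hence is not `c`.
  reroute : ∀ {u a b c v t} → ¬ Conn (Away u b) a c →
            Conn (Away u b) a v → Conn (Away u b) v t → Conn (Away u c) v t
  reroute ¬q d ε = ε
  reroute ¬q d (s@(j , (p , _) , (p′ , _)) ◅ r) =
    (j , (p , λ { refl → ¬q d }) , (p′ , λ { refl → ¬q d′ })) ◅ reroute ¬q d′ r
    where d′ = d ◅◅ (s ◅ ε)

  -- On a walk from a to b, either c comes before b or b before c; in both
  -- cases the earlier one is reached while avoiding the other.
  bad₅⇒theta : Bad₅ → Theta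
  bad₅⇒theta (u , a , b , c , a≢b , a≢c , b≢c , A , B , C , a~b , b~c)
    with conn? (away? u c) a b | conn? (away? u b) a c
  ... | yes p | _     = theta a≢b a≢c b≢c A B C p (a~b ◅◅ b~c)
  ... | no _  | yes q = theta a≢c a≢b (≢-sym b≢c) A C B q a~b
  ... | no ¬p | no ¬q with conn-until b (away-nbr A) a≢b a~b
  ...   | q , d , k , (q≢u , _) , q≢b = ⊥-elim (¬p (reroute ¬q ε d′
            ◅◅ (k , (q≢u , λ { refl → ¬q d′ }) , (≢-sym (adj-≢ B) , b≢c)) ◅ ε))
    where d′ = conn-mono away-≢ d

  -- From `c` to `a`: `c u a` has colours 0, 1; `c u b` followed by the region has 0, 2; `c w`
  -- followed by the region has 1, 2. As `w` is neither `a` nor `u`, the edges `ua` and `cw` of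
  -- colour 1 do not join `c` to `a`.
  theta⇒¬mengerian : Theta → ¬ Mengerian G
  theta⇒¬mengerian (u , a , b , c , w , a≢b , a≢c , b≢c , w≢u , w≢a , (e , A) , (f , B) , (g , C) , (h , W) , w~a , a~b) =
    ¬mengerian
      (λ { zero → confined (_≢ a) c≢a (λ p → p refl)
             ((λ _ → missing C u≢a c≢a) ∷ (λ ()) ∷ (λ ()) ∷ (λ ()) ∷ []) (λ ())
         ; (suc zero) → confined (λ v → v ≡ c ⊎ v ≡ w) (inj₁ refl)
             (λ { (inj₁ p) → a≢c p ; (inj₂ p) → w≢a (sym p) })
             ((λ ()) ∷ (λ _ → keep A (λ { (inj₁ p) → ⊥-elim (u≢c p) ; (inj₂ p) → ⊥-elim (w≢u (sym p)) })
                                     (λ { (inj₁ p) → ⊥-elim (a≢c p) ; (inj₂ p) → ⊥-elim (w≢a (sym p)) }))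
               ∷ (λ _ → keep W (λ _ → inj₂ refl) (λ _ → inj₁ refl)) ∷ (λ ()) ∷ []) (λ ())
         ; (suc (suc zero)) → confined (_≡ c) refl a≢c
             ((λ ()) ∷ (λ ()) ∷ (λ ()) ∷ (λ _ → avoiding B u≢c b≢c) ∷ [])
             (λ { _ (_ , (_ , p) , _) r → ⊥-elim (p r) }) })
      (u , (g , joins-sym C , inj₁ 0th) ◅ ε , (e , A , inj₁ 1st) ◅ ε)
      (u , (g , joins-sym C , inj₁ 0th) ◅ ε , (f , B , inj₁ 3rd) ◅ conn⇒class (conn-sym a~b))
      (w , (h , W , inj₁ 2nd) ◅ ε , conn⇒class w~a)
    where
    c≢a = ≢-sym a≢c
    u≢a = joins-≢ A
    u≢c = joins-≢ C
    u≢b = joins-≢ B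
    spec = (g , # 0) ∷ (e , # 1) ∷ (h , # 1) ∷ (f , # 2) ∷ []
    compatible : AllPairs Compatible spec
    compatible =
        (off (joins-sym C) A (≢-sym u≢c) c≢a ∷ off C W u≢c (≢-sym w≢u) ∷ off (joins-sym C) B (≢-sym u≢c) (≢-sym b≢c) ∷ [])
      ∷ (off A W u≢c (≢-sym w≢u) ∷ off (joins-sym A) B (≢-sym u≢a) a≢b ∷ [])
      ∷ (off W B (≢-sym u≢c) (≢-sym b≢c) ∷ [])
      ∷ [] ∷ []
    touching : All (λ x → ∃[ p ] ∃[ q ] Joins G (proj₁ x) p q × ¬ Away u c p) spec
    touching = (_ , _ , C , ¬away₁) ∷ (_ , _ , A , ¬away₁) ∷ (_ , _ , W , ¬away₂) ∷ (_ , _ , B , ¬away₁) ∷ []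
    open Scheme c≢a spec compatible (away? u c) (# 2) touching

  -- Two cycles through u without a further common vertex.
  Bowtie : Set
  Bowtie = ∃[ u ] ∃[ a ] ∃[ b ] ∃[ c ] ∃[ d ] a ≢ b × a ≢ c × a ≢ d × b ≢ c × b ≢ d × c ≢ d
         × Adjacent u a × Adjacent u b × Adjacent u c × Adjacent u d
         × Conn (Away u u) a b × Conn (Away u u) c d × ¬ Conn (Away u u) a c

  -- If the two cycles are connected outside `u`, three of the neighbours of `u` lie in one
  -- component of the rest.
  bad₃⇒bowtie⊎bad₅ : Bad₃ → Bowtie ⊎ Bad₅
  bad₃⇒bowtie⊎bad₅ (u , a , b , c , d , ab , ac , ad , bc , bd , cd , A , B , C , D , a~b , c~d)
    with conn? (away? u u) a c
  ... | yes a~c = inj₂ (u , a , b , c , ab , ac , bc , A , B , C , a~b , conn-sym a~b ◅◅ a~c)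
  ... | no ¬a~c = inj₁ (u , a , b , c , d , ab , ac , ad , bc , bd , cd , A , B , C , D , a~b , c~d , ¬a~c)

  -- From `a` to `c`. Both arcs off `u` get colour 1, which does not join `a` to `c` because they
  -- lie in different components after deleting `u`. The chains are `a u d` with the second arc,
  -- `a u` with `u c`, and the first arc with `b u c`.
  bowtie⇒¬mengerian : Bowtie → ¬ Mengerian G
  bowtie⇒¬mengerian (u , a , b , c , d , a≢b , a≢c , a≢d , b≢c , b≢d , c≢d
                    , (e , A) , (f , B) , (g , C) , (h , D) , a~b , c~d , ¬a~c) =
    ¬mengerian
      (λ { zero → confined (_≢ c) a≢c (λ p → p refl)
             ((λ _ → missing A u≢c a≢c) ∷ (λ _ → missing D u≢c (≢-sym c≢d)) ∷ (λ ()) ∷ (λ ()) ∷ []) (λ ())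
         ; (suc zero) → confined (Conn (Away u u) a) ε ¬a~c
             ((λ ()) ∷ (λ ()) ∷ (λ ()) ∷ (λ ()) ∷ []) (λ _ s r → r ◅◅ (s ◅ ε))
         ; (suc (suc zero)) → confined (_≡ a) refl (≢-sym a≢c)
             ((λ ()) ∷ (λ ()) ∷ (λ _ → avoiding C u≢a (≢-sym a≢c)) ∷ (λ _ → avoiding B u≢a (≢-sym a≢b)) ∷ [])
             (λ ()) })
      (d , (e , joins-sym A , inj₁ 0th) ◅ (h , D , inj₁ 1st) ◅ ε , conn⇒class (conn-sym c~d))
      (u , (e , joins-sym A , inj₁ 0th) ◅ ε , (g , C , inj₁ 2nd) ◅ ε)
      (b , conn⇒class a~b , (f , joins-sym B , inj₁ 3rd) ◅ (g , C , inj₁ 2nd) ◅ ε)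
    where
    u≢a = joins-≢ A
    u≢c = joins-≢ C
    u≢d = joins-≢ D
    spec = (e , # 0) ∷ (h , # 0) ∷ (g , # 2) ∷ (f , # 2) ∷ []
    compatible : AllPairs Compatible spec
    compatible =
        (off (joins-sym A) D (≢-sym u≢a) a≢d ∷ off (joins-sym A) C (≢-sym u≢a) a≢c ∷ off (joins-sym A) B (≢-sym u≢a) a≢b ∷ [])
      ∷ (off (joins-sym D) C (≢-sym u≢d) (≢-sym c≢d) ∷ off (joins-sym D) B (≢-sym u≢d) (≢-sym b≢d) ∷ [])
      ∷ (off (joins-sym C) B (≢-sym u≢c) (≢-sym b≢c) ∷ [])
      ∷ [] ∷ []
    touching : All (λ x → ∃[ p ] ∃[ q ] Joins G (proj₁ x) p q × ¬ Away u u p) spec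
    touching = (_ , _ , A , ¬away₁) ∷ (_ , _ , D , ¬away₁) ∷ (_ , _ , C , ¬away₁) ∷ (_ , _ , B , ¬away₁) ∷ []
    open Scheme a≢c spec compatible (away? u u) (# 1) touching

  bad⇒¬mengerian : Bad → ¬ Mengerian G
  bad⇒¬mengerian (inj₁ b)                      = bad₁⇒¬mengerian b
  bad⇒¬mengerian (inj₂ (inj₁ b))               = bad₂⇒¬mengerian b
  bad⇒¬mengerian (inj₂ (inj₂ (inj₁ b)))        =
    [ bowtie⇒¬mengerian , theta⇒¬mengerian ∘ bad₅⇒theta ]′ (bad₃⇒bowtie⊎bad₅ b)
  bad⇒¬mengerian (inj₂ (inj₂ (inj₂ (inj₁ b)))) = bad₄⇒¬mengerian b
  bad⇒¬mengerian (inj₂ (inj₂ (inj₂ (inj₂ b)))) = theta⇒¬mengerian (bad₅⇒theta b)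

-- Cuts given by lists of timesteps

insert : ∀ {n} → Fin n → Subset n → Subset n
insert zero    (_ Vec.∷ S) = inside Vec.∷ S
insert (suc i) (b Vec.∷ S) = b Vec.∷ insert i S

∣insert∣≤ : ∀ {n} (i : Fin n) S → ∣ insert i S ∣ ≤ suc ∣ S ∣
∣insert∣≤ zero    (inside  Vec.∷ S) = n≤1+n _
∣insert∣≤ zero    (outside Vec.∷ S) = ≤-refl
∣insert∣≤ (suc i) (inside  Vec.∷ S) = s≤s (∣insert∣≤ i S)
∣insert∣≤ (suc i) (outside Vec.∷ S) = ∣insert∣≤ i S

∈-insert : ∀ {n} (i : Fin n) S → i ∈ₛ insert i S
∈-insert zero    (_ Vec.∷ S) = Vec.here
∈-insert (suc i) (_ Vec.∷ S) = Vec.there (∈-insert i S)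

⊆-insert : ∀ {n} (i : Fin n) {j} S → j ∈ₛ S → j ∈ₛ insert i S
⊆-insert zero    (_ Vec.∷ S) Vec.here      = Vec.here
⊆-insert zero    (_ Vec.∷ S) (Vec.there p) = Vec.there p
⊆-insert (suc i) (_ Vec.∷ S) Vec.here      = Vec.here
⊆-insert (suc i) (_ Vec.∷ S) (Vec.there p) = Vec.there (⊆-insert i S p)

-- The timestep t is represented by the index t − 1.
timesteps : ∀ n → List ℕ → Subset n
timesteps n []          = Subset.⊥
timesteps n (zero ∷ l)  = timesteps n l
timesteps n (suc t ∷ l) with t <? n
... | yes t<n = insert (fromℕ< t<n) (timesteps n l)
... | no  _   = timesteps n l

∣timesteps∣≤ : ∀ n l → ∣ timesteps n l ∣ ≤ length l
∣timesteps∣≤ n []          = ≤-reflexive (Subset.∣⊥∣≡0 n)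
∣timesteps∣≤ n (zero ∷ l)  = ≤-trans (∣timesteps∣≤ n l) (n≤1+n _)
∣timesteps∣≤ n (suc t ∷ l) with t <? n
... | yes t<n = ≤-trans (∣insert∣≤ (fromℕ< t<n) (timesteps n l)) (s≤s (∣timesteps∣≤ n l))
... | no  _   = ≤-trans (∣timesteps∣≤ n l) (n≤1+n _)

timesteps-complete : ∀ n l {t} → 0 < t → t ≤ n → t ∈ l → ∃[ i ] i ∈ₛ timesteps n l × t ≡ suc (toℕ i)
timesteps-complete n (zero ∷ l) () q (here refl)
timesteps-complete n (zero ∷ l) p q (there i) = timesteps-complete n l p q i
timesteps-complete n (suc t ∷ l) p q i with t <? n
timesteps-complete n (suc t ∷ l) p q (here refl) | yes t<n =
  fromℕ< t<n , ∈-insert _ _ , cong suc (sym (toℕ-fromℕ< t<n))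
timesteps-complete n (suc t ∷ l) p q (here refl) | no ¬t<n = ⊥-elim (¬t<n q)
timesteps-complete n (suc t ∷ l) p q (there i) | yes t<n with timesteps-complete n l p q i
... | j , j∈ , eq = j , ⊆-insert _ _ j∈ , eq
timesteps-complete n (suc t ∷ l) p q (there i) | no _ = timesteps-complete n l p q i

first-edge : ∀ {G : Graph} {a b} (w : Walk {G} a b) → a ≢ b → ∃[ e ] e ∈ edges w
first-edge [ _ ]          a≢b = ⊥-elim (a≢b refl)
first-edge (_ -⟨ _ ⟩- _) _   = _ , here refl

-- Equality of sp and sc for one pair of terminals

module Flow {G : Graph} (Λ : Timefunction G) {s z : Vertex G} (s≢z : s ≢ z) where
  open Theory G
  open Timefunction Λ
  open Temporal Λ
  open TemporalPath

  Path : Set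
  Path = TemporalPath Λ s z

  Balanced : Set
  Balanced = ∃[ k ] Is-sp Λ s z k × Is-sc Λ s z k

  time≤lifetime : ∀ e → time e ≤ lifetime Λ
  time≤lifetime e = go (allFin _) (∈-allFin e)
    where
    go : ∀ l → e ∈ l → time e ≤ foldr _⊔_ 0 (map time l)
    go (_ ∷ l) (here refl) = ℕ.m≤m⊔n _ _
    go (f ∷ l) (there i)   = ≤-trans (go l i) (ℕ.m≤n⊔m (time f) _)

  -- The family bounds every cut from below and the cut bounds every family from above, so both are
  -- optimal by weak duality.
  balanced : ∀ {k} → HasDisjointPaths Λ s z k → (l : List ℕ) → length l ≤ k →
             (∀ (P : Path) → ∃[ t ] t ∈ l × t ∈ snapshots P) → Balanced
  balanced {k} (P , dis) l l≤k hits = k ,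
    ((P , dis) , λ j (Q , dis′) → ≤-trans (Duality.k≤∣S∣ Q dis′ S cut) ∣S∣≤k) ,
    ((S , cut , ℕ.≤-antisym ∣S∣≤k (Duality.k≤∣S∣ P dis S cut)) ,
     λ j (S′ , cut′ , eq) → subst (k ≤_) eq (Duality.k≤∣S∣ P dis S′ cut′))
    where
    S = timesteps (lifetime Λ) l
    ∣S∣≤k = ≤-trans (∣timesteps∣≤ _ l) l≤k
    cut : IsSnapshotCut Λ s z S
    cut P with hits P
    ... | t , t∈l , t∈P with ∈-map⁻ time t∈P
    ... | e , e∈ , refl with timesteps-complete _ l (positive e) (time≤lifetime e) t∈l
    ... | i , i∈ , eq = e , e∈ , i , i∈ , eq

  Via : (Vertex G → Set) → ∀ {a b} → Walk {G} a b → Set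
  Via F [ _ ]                   = ⊥
  Via F (_-⟨_⟩-_ _ {y = y} _ _) = F y

  -- `F` restricts the second vertex. Behind it the search avoids `s`, so that prefixing `s` to the
  -- loop-erased remainder gives a path.
  path-via? : ∀ {F : Vertex G → Set} → Decidable F → Dec (Σ Path λ P → Via F (walk P))
  path-via? {F} F? with any? (λ e → any? λ y → joins? e s y ×-dec F? y ×-dec
                                timedWalk? (λ v → ¬? (v ≟ s)) time (time e) y z)
  ... | yes (e , y , j , f , w , p , all) with shorten w p
  ...   | shortened w′ p′ u v⊆ _ = yes (record
          { walk = s -⟨ j ⟩- w′
          ; nondecreasing = timed⇒linked {t = 0} (s -⟨ j ⟩- w′) (z≤n , p′)
          ; distinct = All≢ (λ s∈ → all (v⊆ s∈) refl) ∷ u } , f)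
  path-via? {F} F? | no ¬p = no λ (P , f) →
    go (walk P) (linked⇒timed (walk P) (nondecreasing P)) (distinct P) f
    where
    go : (w : Walk {G} s z) → Timed time 0 w → Unique (vertices w) → Via F w → ⊥
    go (_ -⟨ j ⟩- w) (_ , q) (x ∷ _) f =
      ¬p (_ , _ , j , f , w , q , λ i v≡s → All.lookup x i (sym v≡s))

  path? : Dec Path
  path? with path-via? {λ _ → ⊤} (λ _ → yes tt)
  ... | yes (P , _) = yes P
  ... | no ¬p = no λ P → ¬p (P , via (walk P))
    where
    via : (w : Walk {G} s z) → Via (λ _ → ⊤) w
    via [ _ ]          = ⊥-elim (s≢z refl)
    via (_ -⟨ _ ⟩- _) = tt

  one-cut : ∀ t → (∀ (P : Path) → t ∈ snapshots P) → Balanced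
  one-cut t hits with path?
  ... | yes P = balanced {1} ((λ _ → P) , λ { zero zero n → ⊥-elim (n refl) }) (t ∷ []) ≤-refl
                  λ Q → t , here refl , hits Q
  ... | no ¬P = balanced {0} ((λ ()) , λ ()) [] z≤n λ Q → ⊥-elim (¬P Q)

  edge-cut : ∀ e → (∀ (P : Path) → e ∈ pathEdges P) → Balanced
  edge-cut e hits = one-cut (time e) λ P → ∈-map⁺ time (hits P)

  extend : ∀ {k} (P : HasDisjointPaths Λ s z k) (Q : Path) →
           (∀ i → SnapshotDisjoint Λ Q (proj₁ P i)) → HasDisjointPaths Λ s z (suc k)
  extend {k} (P , dis) Q new = P′ , dis′
    where
    P′ : Fin (suc k) → Path
    P′ zero    = Q
    P′ (suc i) = P i
    dis′ : ∀ i j → i ≢ j → SnapshotDisjoint Λ (P′ i) (P′ j)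
    dis′ zero    zero    n         = ⊥-elim (n refl)
    dis′ zero    (suc j) n         = new j
    dis′ (suc i) zero    n (a , b) = new i (b , a)
    dis′ (suc i) (suc j) n         = dis i j (n ∘ cong suc)

  -- Comparing edge lists suffices, as times are read off them. A common time is a cut of size one;
  -- otherwise `P` and `Q` are disjoint and the times of their first edges form a cut.
  two-cut : (P Q : Path) → (∀ (R : Path) → pathEdges R ≡ pathEdges P ⊎ pathEdges R ≡ pathEdges Q) → Balanced
  two-cut P Q cover with Any.any? (λ t → t ∈?ℕ snapshots Q) (snapshots P)
    where open DecMembership ℕ._≟_ renaming (_∈?_ to _∈?ℕ_)
  ... | yes common = one-cut _ λ R → common∈ R (cover R)
    where
    t = proj₁ (find common)
    common∈ : ∀ (R : Path) → pathEdges R ≡ pathEdges P ⊎ pathEdges R ≡ pathEdges Q → t ∈ snapshots R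
    common∈ R (inj₁ eq) = subst (λ l → t ∈ map time l) (sym eq) (proj₁ (proj₂ (find common)))
    common∈ R (inj₂ eq) = subst (λ l → t ∈ map time l) (sym eq) (proj₂ (proj₂ (find common)))
  ... | no ¬common = balanced (extend ((λ _ → Q) , λ { zero zero n → ⊥-elim (n refl) }) P
            λ { zero (a , b) → ¬common (lose a b) })
          (time e ∷ time f ∷ []) ≤-refl λ R → hit R (cover R)
    where
    e = proj₁ (first-edge (walk P) s≢z)
    f = proj₁ (first-edge (walk Q) s≢z)
    hit : ∀ (R : Path) → pathEdges R ≡ pathEdges P ⊎ pathEdges R ≡ pathEdges Q →
          ∃[ t ] t ∈ (time e ∷ time f ∷ []) × t ∈ snapshots R
    hit R (inj₁ eq) = time e , here refl ,
      subst (λ l → _ ∈ map time l) (sym eq) (∈-map⁺ time (proj₂ (first-edge (walk P) s≢z)))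
    hit R (inj₂ eq) = time f , there (here refl) ,
      subst (λ l → _ ∈ map time l) (sym eq) (∈-map⁺ time (proj₂ (first-edge (walk Q) s≢z)))

  -- All paths have at most one inner vertex, and it is w: scanning time
  -- forwards, each arrival at z is matched with an unused departure from s.
  module Greedy (w : Vertex G) where

    At : Vertex G → Vertex G → ℕ → Set
    At a b t = ∃[ e ] Joins G e a b × time e ≡ t

    at? : ∀ a b t → Dec (At a b t)
    at? a b t = any? λ e → joins? e a b ×-dec time e ℕ.≟ t

    ¬at-0 : ∀ {a b} → ¬ At a b 0
    ¬at-0 (e , _ , eq) = <-irrefl (sym eq) (positive e)

    direct : ∀ {t} → At s z t → Σ Path λ P → ∀ {x} → x ∈ snapshots P → x ≡ t
    direct (e , j , refl) = record
      { walk = s -⟨ j ⟩- [ z ] ; nondecreasing = [-] ; distinct = (s≢z ∷ []) ∷ [] ∷ [] } ,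
      λ { (here p) → p }

    through : ∀ {a b} → At s w a → At w z b → a ≤ b → Σ Path λ P → ∀ {x} → x ∈ snapshots P → x ≡ a ⊎ x ≡ b
    through (e , j , refl) (f , k , refl) a≤b = record
      { walk = s -⟨ j ⟩- (w -⟨ k ⟩- [ z ]) ; nondecreasing = a≤b ∷ [-]
      ; distinct = (joins-≢ j ∷ s≢z ∷ []) ∷ (joins-≢ k ∷ []) ∷ [] ∷ [] } ,
      λ { (here p) → inj₁ p ; (there (here p)) → inj₂ p }

    -- pending: unmatched departures; cover: an optimal cut for the paths seen
    -- so far; departures: the cut consisting of all first edges seen so far.
    record State (t : ℕ) : Set where
      field
        {m}         : ℕ
        family      : HasDisjointPaths Λ s z m
        past        : ∀ i {x} → x ∈ snapshots (proj₁ family i) → x ≤ t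
        pending     : List ℕ
        pending-at  : ∀ {a} → a ∈ pending → At s w a × a ≤ t
        unused      : ∀ {a} → a ∈ pending → ∀ i → a ∉ snapshots (proj₁ family i)
        unique      : Unique pending
        cover       : List ℕ
        cover-size  : length cover ≡ m
        covers₁     : ∀ {d} → d ≤ t → At s z d → d ∈ cover
        covers₂     : ∀ {a b} → a ≤ b → b ≤ t → At s w a → At w z b → a ∈ cover ⊎ b ∈ cover
        departures  : List ℕ
        departures-size : length departures ≡ m + length pending
        departs     : ∀ {x} → x ≤ t → At s z x ⊎ At s w x → x ∈ departures

    start : State 0
    start = record
      { family = (λ ()) , λ () ; past = λ () ; pending = [] ; pending-at = λ () ; unused = λ () ; unique = []
      ; cover = [] ; cover-size = refl
      ; covers₁ = λ { z≤n d → ⊥-elim (¬at-0 d) } ; covers₂ = λ { z≤n z≤n a → ⊥-elim (¬at-0 a) }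
      ; departures = [] ; departures-size = refl
      ; departs = λ { z≤n (inj₁ a) → ⊥-elim (¬at-0 a) ; z≤n (inj₂ a) → ⊥-elim (¬at-0 a) } }

    split : ∀ {x t} → x ≤ suc t → x ≤ t ⊎ x ≡ suc t
    split p with ℕ.m≤n⇒m<n∨m≡n p
    ... | inj₁ (s≤s q) = inj₁ q
    ... | inj₂ q       = inj₂ q

    later : ∀ {t x} → x ≤ t → x ≢ suc t
    later p refl = <-irrefl refl p

    module _ {t} (σ : State t) where
      open State σ

      -- A path active only at `suc t` forces this time into every cut. Having it in both cuts also
      -- takes care of any departure at that time, which therefore does not become pending.
      instantly : (P : Path) → (∀ {x} → x ∈ snapshots P → x ≡ suc t) → State (suc t)
      instantly P only = record
        { family = extend family P λ i (a , b) → later (past i b) (only a)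
        ; past = λ { zero x → ≤-reflexive (only x) ; (suc i) x → ℕ.m≤n⇒m≤1+n (past i x) }
        ; pending = pending
        ; pending-at = λ a∈ → let at , a≤ = pending-at a∈ in at , ℕ.m≤n⇒m≤1+n a≤
        ; unused = λ { a∈ zero x → later (proj₂ (pending-at a∈)) (only x) ; a∈ (suc i) → unused a∈ i }
        ; unique = unique
        ; cover = suc t ∷ cover ; cover-size = cong suc cover-size
        ; covers₁ = λ p d → case split p of λ { (inj₁ q) → there (covers₁ q d) ; (inj₂ q) → here q }
        ; covers₂ = λ a≤b p a b → case split p of λ
            { (inj₁ q) → [ inj₁ ∘ there , inj₂ ∘ there ]′ (covers₂ a≤b q a b) ; (inj₂ q) → inj₂ (here q) }
        ; departures = suc t ∷ departures ; departures-size = cong suc departures-size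
        ; departs = λ p d → case split p of λ { (inj₁ q) → there (departs q d) ; (inj₂ q) → here q } }

      -- Without an arrival at `suc t` the new departure completes no path yet, so the optimal cut
      -- stays and only the cut by departures grows.
      departure : ¬ At s z (suc t) → At s w (suc t) → ¬ At w z (suc t) → State (suc t)
      departure ¬d a ¬b = record
        { family = family
        ; past = λ i x → ℕ.m≤n⇒m≤1+n (past i x)
        ; pending = suc t ∷ pending
        ; pending-at = λ { (here refl) → a , ≤-refl
                         ; (there a∈) → let at , a≤ = pending-at a∈ in at , ℕ.m≤n⇒m≤1+n a≤ }
        ; unused = λ { (here refl) i x → later (past i x) refl ; (there a∈) i → unused a∈ i }
        ; unique = All.tabulate (λ a∈ eq → later (proj₂ (pending-at a∈)) (sym eq)) ∷ unique
        ; cover = cover ; cover-size = cover-size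
        ; covers₁ = λ p d → case split p of λ { (inj₁ q) → covers₁ q d ; (inj₂ refl) → ⊥-elim (¬d d) }
        ; covers₂ = λ a≤b p a b → case split p of λ
            { (inj₁ q) → covers₂ a≤b q a b ; (inj₂ refl) → ⊥-elim (¬b b) }
        ; departures = suc t ∷ departures
        ; departures-size = trans (cong suc departures-size) (sym (ℕ.+-suc m (length pending)))
        ; departs = λ p d → case split p of λ { (inj₁ q) → there (departs q d) ; (inj₂ q) → here q } }

      wait : ¬ At s z (suc t) → ¬ At s w (suc t) → ¬ At w z (suc t) → State (suc t)
      wait ¬d ¬a ¬b = record
        { family = family
        ; past = λ i x → ℕ.m≤n⇒m≤1+n (past i x)
        ; pending = pending
        ; pending-at = λ a∈ → let at , a≤ = pending-at a∈ in at , ℕ.m≤n⇒m≤1+n a≤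
        ; unused = unused ; unique = unique
        ; cover = cover ; cover-size = cover-size
        ; covers₁ = λ p d → case split p of λ { (inj₁ q) → covers₁ q d ; (inj₂ refl) → ⊥-elim (¬d d) }
        ; covers₂ = λ a≤b p a b → case split p of λ
            { (inj₁ q) → covers₂ a≤b q a b ; (inj₂ refl) → ⊥-elim (¬b b) }
        ; departures = departures ; departures-size = departures-size
        ; departs = λ p d → case split p of λ
            { (inj₁ q) → departs q d
            ; (inj₂ refl) → ⊥-elim ([ ¬d , ¬a ]′ d) } }

      -- Without pending departures the cut by all departures is optimal.
      arrival : ¬ At s z (suc t) → ¬ At s w (suc t) → At w z (suc t) → State (suc t)
      arrival ¬d ¬a b with pending in eq
      ... | [] = record
        { family = family
        ; past = λ i x → ℕ.m≤n⇒m≤1+n (past i x)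
        ; pending = [] ; pending-at = λ () ; unused = λ () ; unique = []
        ; cover = departures
        ; cover-size = trans departures-size (trans (cong (λ l → m + length l) eq) (ℕ.+-identityʳ m))
        ; covers₁ = λ p d → case split p of λ { (inj₁ q) → departs q (inj₁ d) ; (inj₂ refl) → ⊥-elim (¬d d) }
        ; covers₂ = λ a≤b p a b → case split (≤-trans a≤b p) of λ
            { (inj₁ q) → inj₁ (departs q (inj₂ a)) ; (inj₂ refl) → ⊥-elim (¬a a) }
        ; departures = departures
        ; departures-size = trans departures-size (cong (λ l → m + length l) eq)
        ; departs = λ p d → case split p of λ
            { (inj₁ q) → departs q d
            ; (inj₂ refl) → ⊥-elim ([ ¬d , ¬a ]′ d) } }
      -- Any pending departure may be matched: each precedes this arrival, and to later arrivals
      -- they all look alike.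
      ... | a ∷ rest = record
        { family = extend family P λ i (x , y) → case only x of λ
            { (inj₁ refl) → unused (∈p (here refl)) i y ; (inj₂ q) → later (past i y) q }
        ; past = λ { zero x → [ (λ { refl → ℕ.m≤n⇒m≤1+n a≤t }) , ≤-reflexive ]′ (only x)
                   ; (suc i) x → ℕ.m≤n⇒m≤1+n (past i x) }
        ; pending = rest
        ; pending-at = λ a∈ → let at , a≤ = pending-at (∈p (there a∈)) in at , ℕ.m≤n⇒m≤1+n a≤
        ; unused = λ { a∈ zero x → case only x of λ
                         { (inj₁ refl) → Unique[x∷xs]⇒x∉xs uniq a∈
                         ; (inj₂ q) → later (proj₂ (pending-at (∈p (there a∈)))) q }
                     ; a∈ (suc i) → unused (∈p (there a∈)) i }
        ; unique = AllPairs.tail uniq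
        ; cover = suc t ∷ cover ; cover-size = cong suc cover-size
        ; covers₁ = λ p d → case split p of λ { (inj₁ q) → there (covers₁ q d) ; (inj₂ q) → here q }
        ; covers₂ = λ a≤b p a b → case split p of λ
            { (inj₁ q) → [ inj₁ ∘ there , inj₂ ∘ there ]′ (covers₂ a≤b q a b) ; (inj₂ q) → inj₂ (here q) }
        ; departures = departures
        ; departures-size = trans departures-size (trans (cong (λ l → m + length l) eq) (ℕ.+-suc m (length rest)))
        ; departs = λ p d → case split p of λ
            { (inj₁ q) → departs q d
            ; (inj₂ refl) → ⊥-elim ([ ¬d , ¬a ]′ d) } }
        where
        ∈p : ∀ {x} → x ∈ a ∷ rest → x ∈ pending
        ∈p = subst (_ ∈_) (sym eq)
        uniq : Unique (a ∷ rest)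
        uniq = subst Unique eq unique
        a≤t : a ≤ t
        a≤t = proj₂ (pending-at (∈p (here refl)))
        new = through (proj₁ (pending-at (∈p (here refl)))) b (ℕ.m≤n⇒m≤1+n a≤t)
        P = proj₁ new
        only = proj₂ new

      advance : State (suc t)
      advance with at? s z (suc t) | at? s w (suc t) | at? w z (suc t)
      ... | yes d | _     | _     = let P , only = direct d in instantly P only
      ... | no ¬d | yes a | yes b = let P , only = through a b ≤-refl in instantly P λ x → [ id , id ]′ (only x)
      ... | no ¬d | yes a | no ¬b = departure ¬d a ¬b
      ... | no ¬d | no ¬a | yes b = arrival ¬d ¬a b
      ... | no ¬d | no ¬a | no ¬b = wait ¬d ¬a ¬b

    state : ∀ t → State t
    state zero    = start
    state (suc t) = advance (state t)

    Short : ∀ {a b} → Walk {G} a b → Set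
    Short [ _ ]                                     = ⊥
    Short (_ -⟨ _ ⟩- [ _ ])                         = ⊤
    Short (_-⟨_⟩-_ _ {y = y} _ (_ -⟨ _ ⟩- [ _ ])) = y ≡ w
    Short (_ -⟨ _ ⟩- (_ -⟨ _ ⟩- (_ -⟨ _ ⟩- _)))   = ⊥

    short-balanced : (∀ (P : Path) → Short (walk P)) → Balanced
    short-balanced short = balanced family cover (≤-reflexive cover-size) λ P →
      hit (walk P) (linked⇒timed (walk P) (nondecreasing P)) (short P)
      where
      open State (state (lifetime Λ))
      hit : (v : Walk {G} s z) → Timed time 0 v → Short v → ∃[ t ] t ∈ cover × t ∈ map time (edges v)
      hit (_-⟨_⟩-_ _ {e = e} j [ _ ]) _ _ =
        time e , covers₁ (time≤lifetime e) (e , j , refl) , here refl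
      hit (_-⟨_⟩-_ _ {e = e} j (_-⟨_⟩-_ _ {e = f} k [ _ ])) (_ , e≤f , _) refl
        with covers₂ e≤f (time≤lifetime f) (e , j , refl) (f , k , refl)
      ... | inj₁ i = time e , i , here refl
      ... | inj₂ i = time f , i , there (here refl)

-- Duality in graphs without bad configurations

module Cycles (G : Graph) where
  open Theory G

  In : List (Vertex G) → Vertex G → Vertex G → Set
  In C v q = q ∈ C × q ≢ v

  -- A cycle is kept as a vertex set without a cyclic order: each vertex has two neighbours in the
  -- set, and the rest of the set is connected without it. Absence of `Bad₅` then makes these two
  -- the only neighbours in the set.
  record Around (C : List (Vertex G)) (v : Vertex G) : Set where
    constructor around
    field
      {x y}   : Vertex G
      x≢y     : x ≢ y
      x∈      : x ∈ C
      y∈      : y ∈ C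
      vx      : Adjacent v x
      vy      : Adjacent v y
      reach   : ∀ {g} → g ∈ C → g ≢ v → Conn (In C v) x g

  prefix-conn : ∀ {P : Vertex G → Set} {a b g} (w : Walk {G} a b) → (∀ {v} → v ∈ vertices w → P v) →
                g ∈ vertices w → Conn P a g
  prefix-conn [ _ ]          all (here refl) = ε
  prefix-conn (_ -⟨ _ ⟩- _) all (here refl) = ε
  prefix-conn (_ -⟨ j ⟩- w) all (there i)   =
    ((_ , j) , all (here refl) , all (there (start∈ w))) ◅ prefix-conn w (all ∘ there) i

  module _ {s : Vertex G} {C : List (Vertex G)} (s∈C : s ∈ C) where

    -- Induction along the part `w` of the cycle still to be treated, with `p` the predecessor of
    -- its start. A vertex `g` is either behind, connected to `s` without `v`, or still in `w`; in
    -- the second case it is reached through `s` and the end `b`. The alternative `p ≢ s ⊎ a ≢ b`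
    -- excludes a degenerate cycle of two vertices.
    cycle-from : ∀ {p a b} (w : Walk {G} a b) → Unique (vertices w) → Adjacent b s →
      (∀ {v} → v ∈ vertices w → v ∈ C × v ≢ s) → p ∈ C → Adjacent p a → p ∉ vertices w → p ≢ s ⊎ a ≢ b →
      (∀ {v} → v ∈ vertices w → Conn (In C v) s p) →
      (∀ {v g} → v ∈ vertices w → g ∈ C → Conn (In C v) s g ⊎ g ∈ vertices w) →
      ∀ {v} → v ∈ vertices w → Around C v
    cycle-from [ a ] u bs all p∈ pa p∉ (inj₂ n) _ pre (here refl) = ⊥-elim (n refl)
    cycle-from [ a ] u bs all p∈ pa p∉ (inj₁ p≢s) sp pre (here refl) =
      around p≢s p∈ s∈C (adj-sym pa) bs λ g∈ g≢ → conn-sym (sp (here refl)) ◅◅ (case pre (here refl) g∈ of λ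
        { (inj₁ c) → c ; (inj₂ (here eq)) → ⊥-elim (g≢ eq) })
    cycle-from {p} {b = b} (_-⟨_⟩-_ a {y = c} j w) (x ∷ u) bs all p∈ pa p∉ _ sp pre (here refl) =
      around (λ { refl → p∉ (there (start∈ w)) }) p∈ (proj₁ (all (there (start∈ w)))) (adj-sym pa) (_ , j)
        λ g∈ g≢ → conn-sym (sp (here refl)) ◅◅ (case pre (here refl) g∈ of λ
          { (inj₁ r) → r ; (inj₂ (here eq)) → ⊥-elim (g≢ eq)
          ; (inj₂ (there i)) → (adj-sym bs , (s∈C , s≢a) , in′ (end∈ w)) ◅
              (conn-sym (walk⇒conn w in′) ◅◅ prefix-conn w in′ i) })
      where
      s≢a : s ≢ a
      s≢a = ≢-sym (proj₂ (all (here refl)))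
      in′ : ∀ {v} → v ∈ vertices w → In C a v
      in′ i = proj₁ (all (there i)) , λ { refl → All.lookup x i refl }
    cycle-from {p} (_-⟨_⟩-_ a {y = c} j w) (x ∷ u) bs all p∈ pa p∉ _ sp pre (there i) =
      cycle-from w u bs (all ∘ there) a∈ (_ , j) (λ k → All.lookup x k refl) (inj₁ (proj₂ (all (here refl))))
        sa (λ k g∈ → case pre (there k) g∈ of λ
          { (inj₁ r) → inj₁ r ; (inj₂ (here refl)) → inj₁ (sa k) ; (inj₂ (there l)) → inj₂ l }) i
      where
      a∈ = proj₁ (all (here refl))
      sa : ∀ {v} → v ∈ vertices w → Conn (In C v) s a
      sa k = sp (there k) ◅◅ (pa , (p∈ , λ { refl → p∉ (there k) }) , (a∈ , λ { refl → All.lookup x k refl })) ◅ ε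

  Cyclic : List (Vertex G) → Set
  Cyclic C = ∀ {v} → v ∈ C → Around C v

  cycle : ∀ {s a b} → a ≢ b → Adjacent s a → Adjacent s b → Conn (Away s s) a b → ∃[ C ] s ∈ C × Cyclic C
  cycle {s} {a} {b} a≢b sa sb a~b with conn⇒path (≢-sym (adj-≢ sa) , ≢-sym (adj-≢ sa)) a~b
  ... | simplePath w u within = C , here refl , λ
    { (here refl) → around a≢b (there (start∈ w)) (there (end∈ w)) sa sb λ
        { (here refl) g≢ → ⊥-elim (g≢ refl)
        ; (there i) _ → prefix-conn w (λ k → there k , proj₁ (within k)) i }
    ; (there i) → cycle-from (here refl) w u (adj-sym sb) (λ k → there k , proj₁ (within k)) (here refl) sa
        (λ k → proj₁ (within k) refl) (inj₂ a≢b) (λ _ → ε)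
        (λ { _ (here refl) → inj₁ ε ; _ (there k) → inj₂ k }) i }
    where
    C = s ∷ vertices w

  module _ (¬bad : ¬ Bad) where

    ¬bad₁ : ¬ Bad₁
    ¬bad₁ = ¬bad ∘ inj₁
    ¬bad₂ : ¬ Bad₂
    ¬bad₂ = ¬bad ∘ inj₂ ∘ inj₁
    ¬bad₃ : ¬ Bad₃
    ¬bad₃ = ¬bad ∘ inj₂ ∘ inj₂ ∘ inj₁
    ¬bad₄ : ¬ Bad₄
    ¬bad₄ = ¬bad ∘ inj₂ ∘ inj₂ ∘ inj₂ ∘ inj₁
    ¬bad₅ : ¬ Bad₅
    ¬bad₅ = ¬bad ∘ inj₂ ∘ inj₂ ∘ inj₂ ∘ inj₂

    module OnCycle {C : List (Vertex G)} (cyclic : Cyclic C) where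

      in⇒away : ∀ {v q} → In C v q → Away v v q
      in⇒away (_ , n) = n , n

      -- A third neighbour from which the cycle can be reached without `v` would form `Bad₅` with
      -- `x` and `y`.
      two-neighbours : ∀ {v r g} (v∈ : v ∈ C) → Adjacent v r → g ∈ C → g ≢ v → Conn (Away v v) r g →
                       let open Around (cyclic v∈) in r ≡ x ⊎ r ≡ y
      two-neighbours {v} {r} v∈ vr g∈ g≢v r~g with cyclic v∈
      ... | around {x} {y} x≢y x∈ y∈ vx vy reach with r ≟ x | r ≟ y
      ...   | yes p | _     = inj₁ p
      ...   | no _  | yes p = inj₂ p
      ...   | no ¬p | no ¬q = ⊥-elim (¬bad₅ (v , r , x , y , ¬p , ¬q , x≢y , vr , vx , vy ,
                r~g ◅◅ conn-mono in⇒away (conn-sym (reach g∈ g≢v)) ,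
                conn-mono in⇒away (reach y∈ (≢-sym (adj-≢ vy)))))

      neighbour∈C : ∀ {v r g} → v ∈ C → Adjacent v r → g ∈ C → g ≢ v → Conn (Away v v) r g → r ∈ C
      neighbour∈C v∈ vr g∈ g≢v r~g with two-neighbours v∈ vr g∈ g≢v r~g
      ... | inj₁ refl = Around.x∈ (cyclic v∈)
      ... | inj₂ refl = Around.y∈ (cyclic v∈)

      third : ∀ {v p q r} → v ∈ C → Adjacent v p → Adjacent v q → Adjacent v r →
              p ∈ C → q ∈ C → r ∈ C → p ≢ q → p ≢ r → q ≡ r
      third v∈ vp vq vr p∈ q∈ r∈ p≢q p≢r with two-neighbours v∈ vp p∈ (≢-sym (adj-≢ vp)) ε
        | two-neighbours v∈ vq q∈ (≢-sym (adj-≢ vq)) ε | two-neighbours v∈ vr r∈ (≢-sym (adj-≢ vr)) ε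
      ... | inj₁ a | inj₁ b | _      = ⊥-elim (p≢q (trans a (sym b)))
      ... | inj₁ a | inj₂ _ | inj₁ c = ⊥-elim (p≢r (trans a (sym c)))
      ... | inj₁ _ | inj₂ b | inj₂ c = trans b (sym c)
      ... | inj₂ _ | inj₁ b | inj₁ c = trans b (sym c)
      ... | inj₂ a | inj₁ _ | inj₂ c = ⊥-elim (p≢r (trans a (sym c)))
      ... | inj₂ a | inj₂ b | _      = ⊥-elim (p≢q (trans a (sym b)))

      another : ∀ {v} → v ∈ C → ∀ n → ∃[ r ] r ≢ n × r ∈ C × Adjacent v r
      another v∈ n with cyclic v∈
      ... | around {x} {y} x≢y x∈ y∈ vx vy _ with x ≟ n
      ...   | no p     = x , p , x∈ , vx
      ...   | yes refl = y , ≢-sym x≢y , y∈ , vy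

      connected : ∀ {v g h} → v ∈ C → g ∈ C → h ∈ C → g ≢ v → h ≢ v → Conn (In C v) g h
      connected v∈ g∈ h∈ g≢ h≢ = conn-sym (reach g∈ g≢) ◅◅ reach h∈ h≢
        where open Around (cyclic v∈)

      -- A double edge closes up to a triangle, by the absence of M₄.
      triangle : ∀ {v n} → v ∈ C → n ∈ C → Double v n → ∃[ w ] ∀ {g} → g ∈ C → g ≡ v ⊎ g ≡ n ⊎ g ≡ w
      triangle {v} {n} v∈ n∈ vn with another v∈ n | another n∈ v
      ... | v′ , v′≢n , v′∈ , vv′ | n′ , n′≢v , n′∈ , nn′ = v′ , covers
        where
        v≢n : v ≢ n
        v≢n = adj-≢ (double⇒adj vn)
        v′≢v : v′ ≢ v
        v′≢v = ≢-sym (adj-≢ vv′)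
        v′≡n′ : v′ ≡ n′
        v′≡n′ with conn-until n (v′∈ , v′≢v) v′≢n (connected v∈ v′∈ n∈ v′≢v (≢-sym v≢n))
        ... | q , d , qn , (q∈ , q≢v) , q≢n
          with third n∈ (adj-sym (double⇒adj vn)) (adj-sym qn) nn′ v∈ q∈ n′∈ (≢-sym q≢v) (≢-sym n′≢v) | v′ ≟ n′
        ... | _    | yes p = p
        ... | refl | no ¬p = ⊥-elim (¬bad₄ (v , n , v′ , n′ , ¬p , v′≢n , n′≢v , vn , vv′ , nn′ ,
                conn-mono (λ { ((_ , a) , b) → a , b }) d))
        nv′ : Adjacent n v′
        nv′ = subst (Adjacent n) (sym v′≡n′) nn′
        step : ∀ {a b} → Step (In C v′) a b → a ≡ v ⊎ a ≡ n → b ≡ v ⊎ b ≡ n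
        step (ab , _ , (b∈ , b≢)) (inj₁ refl) = inj₂ (sym (third v∈ vv′ (double⇒adj vn) ab v′∈ n∈ b∈ v′≢n (≢-sym b≢)))
        step (ab , _ , (b∈ , b≢)) (inj₂ refl) = inj₁ (sym (third n∈ nv′ (adj-sym (double⇒adj vn)) ab v′∈ v∈ b∈ v′≢v (≢-sym b≢)))
        covers : ∀ {g} → g ∈ C → g ≡ v ⊎ g ≡ n ⊎ g ≡ v′
        covers {g} g∈ with g ≟ v′
        ... | yes p = inj₂ (inj₂ p)
        ... | no g≢ = [ inj₁ , inj₂ ∘ inj₁ ]′
                (conn-invariant step (inj₁ refl) (connected v′∈ v∈ g∈ (≢-sym v′≢v) g≢))

      -- The rest of the path leads from the next vertex to `z` without returning to the current
      -- one, so `neighbour∈C` puts the next vertex on the cycle.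
      stays : ∀ {a z} (w : Walk {G} a z) → Unique (vertices w) → a ∈ C → z ∈ C →
              ∀ {v} → v ∈ vertices w → v ∈ C
      stays [ _ ]          _       a∈ z∈ (here refl) = a∈
      stays (_ -⟨ _ ⟩- _) _       a∈ z∈ (here refl) = a∈
      stays (a -⟨ j ⟩- w) (x ∷ u) a∈ z∈ (there i)   =
        stays w u (neighbour∈C a∈ (_ , j) z∈ (λ { refl → off (end∈ w) }) (walk⇒conn w λ k →
          (λ { refl → off k }) , (λ { refl → off k }))) z∈ i
        where
        off : a ∉ vertices w
        off i = All.lookup x i refl

      module _ (simple : ∀ {v n} → v ∈ C → n ∈ C → ¬ Double v n) where

        -- The predecessor `p` occupies one of the two cycle neighbours, so the next vertex is
        -- forced; without double edges so is the edge.
        determined : ∀ {p a z} (v w : Walk {G} a z) → Unique (vertices v) → Unique (vertices w) →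
                     (∀ {q} → q ∈ vertices v → q ∈ C) → (∀ {q} → q ∈ vertices w → q ∈ C) →
                     p ∈ C → Adjacent p a → p ∉ vertices v → p ∉ vertices w → edges v ≡ edges w
        determined [ _ ] [ _ ] _ _ _ _ _ _ _ _ = refl
        determined [ _ ] (_ -⟨ _ ⟩- w) _ (x ∷ _) _ _ _ _ _ _ = ⊥-elim (All.lookup x (end∈ w) refl)
        determined (_ -⟨ _ ⟩- v) [ _ ] (x ∷ _) _ _ _ _ _ _ _ = ⊥-elim (All.lookup x (end∈ v) refl)
        determined (a -⟨ j ⟩- v) (_ -⟨ k ⟩- w) (x ∷ u) (x′ ∷ u′) inC inC′ p∈ pa p∉ p∉′
          with third (inC (here refl)) (adj-sym pa) (_ , j) (_ , k) p∈
                 (inC (there (start∈ v))) (inC′ (there (start∈ w)))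
                 (λ { refl → p∉ (there (start∈ v)) }) (λ { refl → p∉′ (there (start∈ w)) })
        ... | refl with single (simple (inC (here refl)) (inC (there (start∈ v)))) j k
        ...   | refl = cong (_ ∷_) (determined v w u u′ (inC ∘ there) (inC′ ∘ there) (inC (here refl)) (_ , j)
                  (λ i → All.lookup x i refl) (λ i → All.lookup x′ i refl))

      record Exit {a z} (w : Walk {G} a z) : Set where
        constructor exit
        field
          {g r} : Vertex G
          {e}   : Edge G
          g∈    : g ∈ C
          r∉    : r ∉ C
          joins : Joins G e g r
          e∈    : e ∈ edges w
          rest  : Conn (_∉ C) r z

      exits : ∀ {a z} (w : Walk {G} a z) → z ∉ C → (∀ {v} → v ∈ vertices w → v ∉ C) ⊎ Exit w
      exits [ _ ] z∉ = inj₁ λ { (here refl) → z∉ }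
      exits (a -⟨ j ⟩- w) z∉ with exits w z∉
      ... | inj₂ (exit g∈ r∉ k e∈ rest) = inj₂ (exit g∈ r∉ k (there e∈) rest)
      ... | inj₁ out with a ∈? C
      ...   | yes a∈ = inj₂ (exit a∈ (out (start∈ w)) j (here refl) (walk⇒conn w out))
      ...   | no a∉  = inj₁ λ { (here refl) → a∉ ; (there i) → out i }

      -- With two exit vertices the outside leads back to the cycle and `r` would lie on it. Two
      -- outer ends at one exit vertex give `Bad₃`, and two parallel exit edges give `Bad₂`.
      same-exit : ∀ {a z} {v w : Walk {G} a z} (X : Exit v) (Y : Exit w) → Exit.e X ≡ Exit.e Y
      same-exit {a} {z} {v} {w} (exit {g} {r} g∈ r∉ j e∈ rest) (exit {g′} {r′} g∈′ r∉′ j′ e∈′ rest′)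
        with cyclic g∈ | g ≟ g′ | r ≟ r′
      ... | _ | no g≢g′ | _ = ⊥-elim (r∉ (neighbour∈C g∈ (_ , j) g∈′ (≢-sym g≢g′)
              ((conn-mono out (rest ◅◅ conn-sym rest′)) ◅◅
                (_ , joins-sym j′) ◅′ (out r∉′ , ((≢-sym g≢g′) , (≢-sym g≢g′))))))
        where
        out : ∀ {q} → q ∉ C → Away g g q
        out q∉ = (λ { refl → q∉ g∈ }) , (λ { refl → q∉ g∈ })
        _◅′_ : ∀ {a b} → Adjacent a b → Away g g a × Away g g b → Conn (Away g g) a b
        ab ◅′ (p , q) = (ab , p , q) ◅ ε
      ... | around x≢y x∈ y∈ vx vy reach | yes refl | no r≢r′ = ⊥-elim (¬bad₃ (g , _ , _ , r , r′ , x≢y ,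
              (λ { refl → r∉ x∈ }) , (λ { refl → r∉′ x∈ }) , (λ { refl → r∉ y∈ }) , (λ { refl → r∉′ y∈ }) , r≢r′ ,
              vx , vy , (_ , j) , (_ , j′) , conn-mono in⇒away (reach y∈ (≢-sym (adj-≢ vy))) ,
              conn-mono (λ q∉ → (λ { refl → q∉ g∈ }) , (λ { refl → q∉ g∈ })) (rest ◅◅ conn-sym rest′)))
      ... | around x≢y x∈ y∈ vx vy reach | yes refl | yes refl = single (λ gr → ¬bad₂ (g , r , _ , _ , x≢y ,
              (λ { refl → r∉ x∈ }) , (λ { refl → r∉ y∈ }) , gr , vx , vy ,
              conn-mono (λ { (q∈ , q≢) → q≢ , λ { refl → r∉ q∈ } }) (reach y∈ (≢-sym (adj-≢ vy))))) j j′

    record Next {u z} (w : Walk {G} u z) : Set where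
      constructor next
      field
        {y}      : Vertex G
        {e}      : Edge G
        joins    : Joins G e u y
        e∈       : e ∈ edges w
        rest     : Walk {G} y z
        unique   : Unique (vertices rest)
        u∉       : u ∉ vertices rest
        vertices⊆ : ∀ {v} → v ∈ vertices rest → v ∈ vertices w
        edges⊆   : ∀ {f} → f ∈ edges rest → f ∈ edges w

    follow : ∀ {u z} (w : Walk {G} u z) → Unique (vertices w) → u ≢ z → Next w
    follow [ _ ]          _       u≢z = ⊥-elim (u≢z refl)
    follow (u -⟨ j ⟩- w) (x ∷ p) _   = next j (here refl) w p (λ i → All.lookup x i refl) there there

    -- Different continuations are connected through `z` away from `u` and `p`; with the double edge
    -- `up` this is `Bad₂`.
    same-next : ∀ {u p z} {v w : Walk {G} u z} → Double u p → p ∉ vertices v → p ∉ vertices w →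
                (X : Next v) (Y : Next w) → Next.y X ≡ Next.y Y
    same-next {u} {p} up p∉ p∉′ (next {y} j _ v _ u∉ v⊆ _) (next {y′} j′ _ w _ u∉′ w⊆ _) with y ≟ y′
    ... | yes eq = eq
    ... | no y≢y′ = ⊥-elim (¬bad₂ (u , p , y , y′ , y≢y′ , (λ { refl → p∉ (v⊆ (start∈ v)) }) ,
            (λ { refl → p∉′ (w⊆ (start∈ w)) }) , up , (_ , j) , (_ , j′) ,
            walk⇒conn v (λ i → (λ { refl → u∉ i }) , (λ { refl → p∉ (v⊆ i) })) ◅◅
            conn-sym (walk⇒conn w (λ i → (λ { refl → u∉′ i }) , (λ { refl → p∉′ (w⊆ i) })))))

    module _ (Λ : Timefunction G) {s z : Vertex G} (s≢z : s ≢ z) where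
      open Flow Λ s≢z
      open TemporalPath

      short-in : ∀ {t} → (∀ (P : Path) {v} → v ∈ vertices (walk P) → v ≡ s ⊎ v ≡ z ⊎ v ≡ t) → Balanced
      short-in {t} contained = short-balanced λ P → go (walk P) (distinct P) (contained P)
        where
        open Greedy t
        go : (w : Walk {G} s z) → Unique (vertices w) →
             (∀ {v} → v ∈ vertices w → v ≡ s ⊎ v ≡ z ⊎ v ≡ t) → Short w
        go [ _ ]                                  u f = s≢z refl
        go (_ -⟨ _ ⟩- [ _ ])                      u f = tt
        go (_ -⟨ _ ⟩- (y -⟨ _ ⟩- [ _ ]))         ((a ∷ _) ∷ (b ∷ _) ∷ _) f with f (there (here refl))
        ... | inj₁ p        = ⊥-elim (a (sym p))
        ... | inj₂ (inj₁ p) = ⊥-elim (b p)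
        ... | inj₂ (inj₂ p) = p
        go (_ -⟨ _ ⟩- (y -⟨ _ ⟩- (x -⟨ _ ⟩- w))) ((a ∷ a′ ∷ a″) ∷ (b ∷ b′) ∷ c ∷ _) f
          with f (there (here refl)) | f (there (there (here refl)))
        ... | inj₁ p        | _             = ⊥-elim (a (sym p))
        ... | inj₂ (inj₁ p) | _             = ⊥-elim (All.lookup b′ (end∈ w) p)
        ... | inj₂ (inj₂ _) | inj₁ q        = ⊥-elim (a′ (sym q))
        ... | inj₂ (inj₂ _) | inj₂ (inj₁ q) = ⊥-elim (All.lookup c (end∈ w) q)
        ... | inj₂ (inj₂ p) | inj₂ (inj₂ q) = ⊥-elim (b (trans p (sym q)))

      third-vertex : ∀ {p q r} → s ≡ p ⊎ s ≡ q ⊎ s ≡ r → z ≡ p ⊎ z ≡ q ⊎ z ≡ r →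
                     ∃[ t ] ∀ {g} → g ≡ p ⊎ g ≡ q ⊎ g ≡ r → g ≡ s ⊎ g ≡ z ⊎ g ≡ t
      third-vertex (inj₁ refl) (inj₁ refl) = ⊥-elim (s≢z refl)
      third-vertex (inj₁ refl) (inj₂ (inj₁ refl)) = _ , id
      third-vertex (inj₁ refl) (inj₂ (inj₂ refl)) = _ , λ
        { (inj₁ a) → inj₁ a ; (inj₂ (inj₁ a)) → inj₂ (inj₂ a) ; (inj₂ (inj₂ a)) → inj₂ (inj₁ a) }
      third-vertex (inj₂ (inj₁ refl)) (inj₁ refl) = _ , λ
        { (inj₁ a) → inj₂ (inj₁ a) ; (inj₂ (inj₁ a)) → inj₁ a ; (inj₂ (inj₂ a)) → inj₂ (inj₂ a) }
      third-vertex (inj₂ (inj₁ refl)) (inj₂ (inj₁ refl)) = ⊥-elim (s≢z refl)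
      third-vertex (inj₂ (inj₁ refl)) (inj₂ (inj₂ refl)) = _ , λ
        { (inj₁ a) → inj₂ (inj₂ a) ; (inj₂ (inj₁ a)) → inj₁ a ; (inj₂ (inj₂ a)) → inj₂ (inj₁ a) }
      third-vertex (inj₂ (inj₂ refl)) (inj₁ refl) = _ , λ
        { (inj₁ a) → inj₂ (inj₁ a) ; (inj₂ (inj₁ a)) → inj₂ (inj₂ a) ; (inj₂ (inj₂ a)) → inj₁ a }
      third-vertex (inj₂ (inj₂ refl)) (inj₂ (inj₁ refl)) = _ , λ
        { (inj₁ a) → inj₂ (inj₂ a) ; (inj₂ (inj₁ a)) → inj₂ (inj₁ a) ; (inj₂ (inj₂ a)) → inj₁ a }
      third-vertex (inj₂ (inj₂ refl)) (inj₂ (inj₂ refl)) = ⊥-elim (s≢z refl)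

      module _ {C : List (Vertex G)} (s∈ : s ∈ C) (cyclic : Cyclic C) where
        open OnCycle cyclic

        z-off-cycle : z ∉ C → Balanced
        z-off-cycle z∉ with path?
        ... | no ¬P = balanced {0} ((λ ()) , λ ()) [] z≤n λ Q → ⊥-elim (¬P Q)
        ... | yes R with exits (walk R) z∉
        ...   | inj₁ out = ⊥-elim (out (start∈ (walk R)) s∈)
        ...   | inj₂ X = edge-cut (Exit.e X) hit
          where
          hit : ∀ (P : Path) → Exit.e X ∈ pathEdges P
          hit P with exits (walk P) z∉
          ... | inj₁ out = ⊥-elim (out (start∈ (walk P)) s∈)
          ... | inj₂ Y = ∈-resp (sym (same-exit X Y)) (Exit.e∈ Y)

        on-cycle : z ∈ C → ∀ (P : Path) {v} → v ∈ vertices (walk P) → v ∈ C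
        on-cycle z∈ P = stays (walk P) (distinct P) s∈ z∈

        z-on-triangle : z ∈ C → ∀ {v n} → v ∈ C → n ∈ C → Double v n → Balanced
        z-on-triangle z∈ v∈ n∈ vn with triangle v∈ n∈ vn
        ... | w , cover with third-vertex (cover s∈) (cover z∈)
        ...   | t , f = short-in λ P i → f (cover (on-cycle z∈ P i))

        module _ (z∈ : z ∈ C) (simple : ∀ {v n} → v ∈ C → n ∈ C → ¬ Double v n) where

          second-vertex : ∀ {f} (v w : Walk {G} s z) → Unique (vertices v) → Unique (vertices w) →
            (∀ {q} → q ∈ vertices v → q ∈ C) → (∀ {q} → q ∈ vertices w → q ∈ C) →
            Via (_≡ f) v → Via (_≡ f) w → edges v ≡ edges w
          second-vertex (_ -⟨ j ⟩- v) (_ -⟨ k ⟩- w) (x ∷ u) (x′ ∷ u′) inC inC′ refl refl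
            with single (simple s∈ (inC (there (start∈ v)))) j k
          ... | refl = cong (_ ∷_) (determined simple v w u u′ (inC ∘ there) (inC′ ∘ there) s∈ (_ , j)
                  (λ i → All.lookup x i refl) (λ i → All.lookup x′ i refl))

          same-second : ∀ {f} (P Q : Path) → Via (_≡ f) (walk P) → Via (_≡ f) (walk Q) → pathEdges P ≡ pathEdges Q
          same-second P Q = second-vertex (walk P) (walk Q) (distinct P) (distinct Q) (on-cycle z∈ P) (on-cycle z∈ Q)

          second-of : (w : Walk {G} s z) → Unique (vertices w) → (∀ {q} → q ∈ vertices w → q ∈ C) →
                   ∃[ f ] f ∈ C × Adjacent s f × Via (_≡ f) w
          second-of [ _ ]          _ _   = ⊥-elim (s≢z refl)
          second-of (_ -⟨ j ⟩- w) _ inC = _ , inC (there (start∈ w)) , (_ , j) , refl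

          via-mono : ∀ {F F′ : Vertex G → Set} → (∀ {v} → F v → F′ v) → ∀ {a b} (w : Walk {G} a b) → Via F w → Via F′ w
          via-mono f (_ -⟨ _ ⟩- _) p = f p

          z-on-simple-cycle : Balanced
          z-on-simple-cycle with path?
          ... | no ¬P = balanced {0} ((λ ()) , λ ()) [] z≤n λ Q → ⊥-elim (¬P Q)
          ... | yes P with second-of (walk P) (distinct P) (on-cycle z∈ P)
          ... | f , f∈ , sf , viaP with path-via? (λ v → ¬? (v ≟ f))
          ... | yes (Q , viaQ) = two-cut P Q either
            where
            either : ∀ R → pathEdges R ≡ pathEdges P ⊎ pathEdges R ≡ pathEdges Q
            either R with second-of (walk R) (distinct R) (on-cycle z∈ R) | second-of (walk Q) (distinct Q) (on-cycle z∈ Q)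
            ... | h , h∈ , sh , viaR | g , g∈ , sg , viaQ′ with h ≟ f
            ...   | yes refl = inj₁ (same-second R P viaR viaP)
            ...   | no h≢f with third s∈ sf sh sg f∈ h∈ g∈ (≢-sym h≢f) (≢-sym (g≢f (walk Q) viaQ viaQ′))
              where
              g≢f : ∀ {a b} (w : Walk {G} a b) → Via (_≢ f) w → Via (_≡ g) w → g ≢ f
              g≢f (_ -⟨ _ ⟩- _) p refl = p
            ...     | refl = inj₂ (same-second R Q viaR viaQ′)
          -- With a single edge list both arguments of `two-cut` coincide and share a time, so its
          -- case of a common time applies.
          ... | no ¬Q = two-cut P P λ R → inj₁ (only R)
            where
            only : ∀ R → pathEdges R ≡ pathEdges P
            only R with second-of (walk R) (distinct R) (on-cycle z∈ R)
            ... | h , _ , _ , viaR with h ≟ f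
            ...   | yes refl = same-second R P viaR viaP
            ...   | no h≢f = ⊥-elim (¬Q (R , via-mono (λ { refl → h≢f }) (walk R) viaR))

        s-on-cycle : Balanced
        s-on-cycle with z ∈? C
        ... | no z∉  = z-off-cycle z∉
        ... | yes z∈ with any? (λ v → any? λ n → v ∈? C ×-dec n ∈? C ×-dec double? v n)
        ...   | yes (v , n , v∈ , n∈ , vn) = z-on-triangle z∈ v∈ n∈ vn
        ...   | no ¬d = z-on-simple-cycle z∈ λ v∈ n∈ vn → ¬d (_ , _ , v∈ , n∈ , vn)

      module _ (acyclic : ∀ {a b} → Adjacent s a → Adjacent s b → Conn (Away s s) a b → a ≡ b) where

        start : (P : Path) → Next (walk P)
        start P = follow (walk P) (distinct P) s≢z

        same-start : ∀ P Q → Next.y (start P) ≡ Next.y (start Q)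
        same-start P Q with start P | start Q
        ... | next j _ v _ s∉ _ _ | next k _ w _ s∉′ _ _ = acyclic (_ , j) (_ , k)
          (walk⇒conn v (λ i → (λ { refl → s∉ i }) , (λ { refl → s∉ i })) ◅◅
           conn-sym (walk⇒conn w λ i → (λ { refl → s∉′ i }) , (λ { refl → s∉′ i })))

        only-z : ∀ {t} (w : Walk {G} t z) → Unique (vertices w) → t ≡ z → ∀ {v} → v ∈ vertices w → v ≡ z
        only-z [ _ ]          _       _    (here refl) = refl
        only-z (_ -⟨ _ ⟩- w) (x ∷ _) refl _ = ⊥-elim (All.lookup x (end∈ w) refl)

        decompose : ∀ {u t} (w : Walk {G} u t) (u≢t : u ≢ t) (p : Unique (vertices w)) →
                    ∀ {v} → v ∈ vertices w → v ≡ u ⊎ v ∈ vertices (Next.rest (follow w p u≢t))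
        decompose [ _ ]          u≢t p       _         = ⊥-elim (u≢t refl)
        decompose (_ -⟨ _ ⟩- w) u≢t (_ ∷ _) (here eq) = inj₁ eq
        decompose (_ -⟨ _ ⟩- w) u≢t (_ ∷ _) (there i) = inj₂ i

        -- All paths agree on the second vertex because `s` lies on no cycle, and on the following
        -- ones by `same-next`, applied to the double edge just traversed. A single edge met on the
        -- way is a cut; if `z` is reached by at most two double edges, there is at most one inner
        -- vertex; a third double edge would be `Bad₁`.
        s-not-on-cycle : Balanced
        s-not-on-cycle with path?
        ... | no ¬P = balanced {0} ((λ ()) , λ ()) [] z≤n λ Q → ⊥-elim (¬P Q)
        ... | yes R = first-step
          where
          a = Next.y (start R)

          first-step : Balanced
          first-step with double? s a
          ... | no ¬sa = edge-cut (Next.e (start R)) λ P → ∈-resp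
                  (single ¬sa (subst (λ y → Joins G (Next.e (start P)) s y) (same-start P R) (Next.joins (start P)))
                    (Next.joins (start R))) (Next.e∈ (start P))
          ... | yes sa with a ≟ z
          ...   | yes a≡z = short-in {t = z} λ P i → case decompose (walk P) s≢z (distinct P) i of λ
                    { (inj₁ p) → inj₁ p
                    ; (inj₂ k) → inj₂ (inj₁ (only-z (Next.rest (start P)) (Next.unique (start P))
                                   (trans (same-start P R) a≡z) k)) }
          ...   | no a≢z = second-step
            where
            y≢z : ∀ P → Next.y (start P) ≢ z
            y≢z P p = a≢z (trans (same-start R P) p)
            again : ∀ P → Next (Next.rest (start P))
            again P = follow (Next.rest (start P)) (Next.unique (start P)) (y≢z P)
            transport : ∀ {x y y′} {w : Walk {G} y z} {w′ : Walk {G} y′ z} → y′ ≡ y → Double x y → x ∉ vertices w → x ∉ vertices w′ →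
                        (X : Next w) (Y : Next w′) → Next.y X ≡ Next.y Y
            transport refl xy = same-next (double-sym xy)
            same-again : ∀ P → Next.y (again P) ≡ Next.y (again R)
            same-again P = sym (transport (same-start P R) sa (Next.u∉ (start R)) (Next.u∉ (start P)) (again R) (again P))
            c = Next.y (again R)
            joins₂ : ∀ P → Joins G (Next.e (again P)) a c
            joins₂ P = subst (λ y → Joins G (Next.e (again P)) y c) (same-start P R)
              (subst (Joins G (Next.e (again P)) (Next.y (start P))) (same-again P) (Next.joins (again P)))

            second-step : Balanced
            second-step with double? a c
            ... | no ¬ac = edge-cut (Next.e (again R)) λ P →
                    ∈-resp (single ¬ac (joins₂ P) (joins₂ R)) (Next.edges⊆ (start P) (Next.e∈ (again P)))
            ... | yes ac with c ≟ z
            ...   | yes c≡z = short-in {t = a} λ P i → case decompose (walk P) s≢z (distinct P) i of λ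
                      { (inj₁ p) → inj₁ p
                      ; (inj₂ k) → case decompose (Next.rest (start P)) (y≢z P) (Next.unique (start P)) k of λ
                          { (inj₁ p) → inj₂ (inj₂ (trans p (same-start P R)))
                          ; (inj₂ l) → inj₂ (inj₁ (only-z (Next.rest (again P)) (Next.unique (again P))
                                         (trans (same-again P) c≡z) l)) } }
            ...   | no c≢z = edge-cut (Next.e (finally R)) λ P →
                      ∈-resp (single ¬cd (joins₃ P) (joins₃ R))
                        (Next.edges⊆ (start P) (Next.edges⊆ (again P) (Next.e∈ (finally P))))
              where
              finally : ∀ P → Next (Next.rest (again P))
              finally P = follow (Next.rest (again P)) (Next.unique (again P)) λ p → c≢z (trans (sym (same-again P)) p)
              same-finally : ∀ P → Next.y (finally P) ≡ Next.y (finally R)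
              same-finally P = sym (transport (same-again P) ac (Next.u∉ (again R))
                (subst (_∉ vertices (Next.rest (again P))) (same-start P R) (Next.u∉ (again P))) (finally R) (finally P))
              d = Next.y (finally R)
              joins₃ : ∀ P → Joins G (Next.e (finally P)) c d
              joins₃ P = subst (λ y → Joins G (Next.e (finally P)) y d) (same-again P)
                (subst (Joins G (Next.e (finally P)) (Next.y (again P))) (same-finally P) (Next.joins (finally P)))
              c∈ : c ∈ vertices (Next.rest (again R))
              c∈ = start∈ (Next.rest (again R))
              d∈ : d ∈ vertices (Next.rest (again R))
              d∈ = Next.vertices⊆ (finally R) (start∈ (Next.rest (finally R)))
              ¬cd : ¬ Double c d
              ¬cd cd = ¬bad₁ (s , a , c , d ,
                (λ p → Next.u∉ (start R) (∈-resp (sym p) (Next.vertices⊆ (again R) c∈))) ,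
                (λ p → Next.u∉ (start R) (∈-resp (sym p) (Next.vertices⊆ (again R) d∈))) ,
                (λ p → Next.u∉ (again R) (∈-resp (sym p) d∈)) , sa , ac , cd)

      all-balanced : Balanced
      all-balanced with any? (λ a → any? λ b → ¬? (a ≟ b) ×-dec adj? s a ×-dec adj? s b ×-dec conn? (away? s s) a b)
      ... | yes (a , b , a≢b , sa , sb , a~b) = let C , s∈ , cyclic = cycle a≢b sa sb a~b in s-on-cycle s∈ cyclic
      ... | no ¬cyc = s-not-on-cycle λ {a} {b} sa sb a~b → case a ≟ b of λ
              { (yes p) → p ; (no p) → ⊥-elim (¬cyc (a , b , p , sa , sb , a~b)) }

    ¬bad⇒mengerian : Mengerian G
    ¬bad⇒mengerian Λ s z s≢z = all-balanced Λ s≢z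

-- Models by internally disjoint routes

module Realisation (G : Graph) where
  open Theory G

  -- An edge of H with the inner vertices and the edges of its route in G.
  Placed : ℕ → Set
  Placed n = (Fin n × Fin n) × List (Vertex G) × List (Edge G)

  pair : ∀ {n} → Placed n → Fin n × Fin n
  pair (p , _ , _) = p

  mids : ∀ {n} → Placed n → List (Vertex G)
  mids (_ , m , _) = m

  trail : ∀ {n} → Placed n → List (Edge G)
  trail (_ , _ , es) = es

  inner : ∀ {n} → List (Placed n) → List (Vertex G)
  inner = concatMap mids

  Route : Vertex G → List (Vertex G) → List (Edge G) → Vertex G → Set
  Route a []       (e ∷ [])          b = Joins G e a b
  Route a (w ∷ ws) (e ∷ es@(_ ∷ _)) b = Joins G e a w × Route w ws es b
  Route a _        _                 b = ⊥

  -- Only edges realised by single edges of G may be parallel, so that an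
  -- m-subdivision never splits two routes at once.
  record Compatible {n} (k l : Placed n) : Set where
    constructor compat
    field
      apart : ∀ {a b} → JoinsPair (pair k) a b → JoinsPair (pair l) a b →
              mids k ≡ [] × mids l ≡ [] × trail k ≢ trail l
  open Compatible

  record Model {n} (L : List (Placed n)) : Set where
    field
      place      : Fin n → Vertex G
      injective  : ∀ {i j} → place i ≡ place j → i ≡ j
      routes     : All (λ l → Route (place (proj₁ (pair l))) (mids l) (trail l) (place (proj₂ (pair l)))) L
      unique     : Unique (inner L)
      fresh      : ∀ {v} → v ∈ inner L → ∀ i → v ≢ place i
      compatible : AllPairs Compatible L

  lift : ∀ {n} → Placed n → Placed (suc n)
  lift ((u , v) , r) = (suc u , suc v) , r

  -- Follows `subdivideEdges` on edges with routes. The first inner vertex of the route becomes the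
  -- new vertex `zero`, so the first half is a single edge and the second half keeps the remaining
  -- route.
  subdivideL : ∀ {n} (x y : Fin n) → List (Placed n) → List (Placed (suc n))
  subdivideL x y [] = []
  subdivideL x y (l@((u , v) , m , es) ∷ L) with joinsPair? (u , v) x y
  ... | yes _ = ((suc u , zero) , [] , take 1 es) ∷ ((zero , suc v) , drop 1 m , drop 1 es) ∷ subdivideL x y L
  ... | no  _ = lift l ∷ subdivideL x y L

  pairs-subdivideL : ∀ {n} (x y : Fin n) L → map pair (subdivideL x y L) ≡ subdivideEdges x y (map pair L)
  pairs-subdivideL x y [] = refl
  pairs-subdivideL x y (((u , v) , _) ∷ L) with joinsPair? (u , v) x y
  ... | yes _ = cong (λ l → _ ∷ _ ∷ l) (pairs-subdivideL x y L)
  ... | no  _ = cong (_ ∷_) (pairs-subdivideL x y L)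

  swap-joins : ∀ {n} {p : Fin n × Fin n} {a b} → JoinsPair p a b → JoinsPair p b a
  swap-joins = λ { (inj₁ q) → inj₂ q ; (inj₂ q) → inj₁ q }

  same-pair : ∀ {n} {u v a b : Fin n} {q} → JoinsPair (u , v) a b → JoinsPair q a b → JoinsPair q u v
  same-pair (inj₁ (refl , refl)) j = j
  same-pair (inj₂ (refl , refl)) j = swap-joins j

  module _ {n} {x y : Fin n} where

    all-subdivideL : ∀ {Q : Placed (suc n) → Set} L →
      All (λ l → (¬ JoinsPair (pair l) x y → Q (lift l)) ×
                 (JoinsPair (pair l) x y → Q ((suc (proj₁ (pair l)) , zero) , [] , take 1 (trail l)) ×
                    Q ((zero , suc (proj₂ (pair l))) , drop 1 (mids l) , drop 1 (trail l)))) L →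
      All Q (subdivideL x y L)
    all-subdivideL [] [] = []
    all-subdivideL (((u , v) , _) ∷ L) ((q , q′) ∷ qs) with joinsPair? (u , v) x y
    ... | yes j = proj₁ (q′ j) ∷ proj₂ (q′ j) ∷ all-subdivideL L qs
    ... | no ¬j = q ¬j ∷ all-subdivideL L qs

    inner-untouched : ∀ L → All (λ l → ¬ JoinsPair (pair l) x y) L → inner (subdivideL x y L) ≡ inner L
    inner-untouched [] [] = refl
    inner-untouched (((u , v) , m , _) ∷ L) (¬j ∷ ¬js) with joinsPair? (u , v) x y
    ... | yes j = ⊥-elim (¬j j)
    ... | no _  = cong (m ++_) (inner-untouched L ¬js)

    suc-pair : ∀ {u v : Fin n} {p} → JoinsPair (suc (proj₁ p) , suc (proj₂ p)) (Fin.suc u) (Fin.suc v) → JoinsPair p u v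
    suc-pair (inj₁ (refl , refl)) = inj₁ (refl , refl)
    suc-pair (inj₂ (refl , refl)) = inj₂ (refl , refl)

    lift-compatible : ∀ {k l} → Compatible k l → Compatible (lift k) (lift l)
    lift-compatible c = compat λ j k → apart c (inj₁ (refl , refl)) (suc-pair (same-pair j k))

    long-unparallel : ∀ {k l w ws} → Compatible k l → mids k ≡ w ∷ ws → JoinsPair (pair k) x y → ¬ JoinsPair (pair l) x y
    long-unparallel c eq j k with trans (sym eq) (proj₁ (apart c j k))
    ... | ()

    Old : Placed (suc n) → Set
    Old ((p , q) , _) = p ≢ zero × q ≢ zero

    off-old : ∀ {k l} → Old k → proj₁ (pair l) ≡ zero ⊎ proj₂ (pair l) ≡ zero → Compatible k l
    off-old (p≢ , q≢) z = compat λ j k → case same-pair k j , z of λ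
      { (inj₁ (refl , refl) , inj₁ r) → ⊥-elim (p≢ r)
      ; (inj₁ (refl , refl) , inj₂ r) → ⊥-elim (q≢ r)
      ; (inj₂ (refl , refl) , inj₁ r) → ⊥-elim (q≢ r)
      ; (inj₂ (refl , refl) , inj₂ r) → ⊥-elim (p≢ r) }

    compatible-sym : ∀ {k l : Placed (suc n)} → Compatible k l → Compatible l k
    compatible-sym c = compat λ j k → let p , q , r = apart c k j in q , p , r ∘ sym

    old-lift : ∀ l → Old (lift l)
    old-lift _ = (λ ()) , λ ()

    compatible-subdivideL : ∀ L → All (NoLoop ∘ pair) L →
      All (λ l → JoinsPair (pair l) x y → ∃[ w ] ∃[ ws ] mids l ≡ w ∷ ws) L →
      AllPairs Compatible L → AllPairs Compatible (subdivideL x y L)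
    compatible-subdivideL [] _ _ [] = []
    compatible-subdivideL (l@((u , v) , m , es) ∷ L) (u≢v ∷ nl) (long ∷ longs) (c ∷ cs) with joinsPair? (u , v) x y
    ... | no ¬j = all-subdivideL L (All.map (λ d → (λ _ → lift-compatible d) ,
                    (λ _ → off-old (old-lift l) (inj₂ refl) , off-old (old-lift l) (inj₁ refl))) c)
                  ∷ compatible-subdivideL L nl longs cs
    ... | yes j = (compat (λ { (inj₁ (refl , refl)) (inj₁ (() , _))
                      ; (inj₁ (refl , refl)) (inj₂ (_ , q)) → ⊥-elim (u≢v (sym (suc-injective q)))
                      ; (inj₂ (refl , refl)) (inj₁ (_ , q)) → ⊥-elim (u≢v (sym (suc-injective q)))
                      ; (inj₂ (refl , refl)) (inj₂ (() , _)) })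
                    ∷ rest (inj₂ refl)) ∷ rest (inj₁ refl) ∷ compatible-subdivideL L nl longs cs
      where
      rest : ∀ {k} → proj₁ (pair k) ≡ zero ⊎ proj₂ (pair k) ≡ zero → All (Compatible k) (subdivideL x y L)
      rest {k} z = all-subdivideL L (All.map (λ {l′} d →
        (λ _ → compatible-sym {lift l′} {k} (off-old (old-lift l′) z)) ,
        (λ j′ → ⊥-elim (long-unparallel {l} {l′} d (proj₂ (proj₂ (long j))) j j′))) c)

    -- A route with inner vertices has no parallel partner, so only this one is split; it gives up
    -- its first inner vertex and all others stay.
    inner-subdivideL : ∀ {l w ws} L → l ∈ L → mids l ≡ w ∷ ws → JoinsPair (pair l) x y →
      AllPairs Compatible L → w ∷ inner (subdivideL x y L) ↭ inner L
    inner-subdivideL (((u , v) , m , _) ∷ L) (here refl) eq j (c ∷ _) with joinsPair? (u , v) x y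
    inner-subdivideL {l} (((u , v) , w ∷ ws , _) ∷ L) (here refl) refl j (c ∷ _) | yes _ =
      subst (λ i → w ∷ ws ++ inner (subdivideL x y L) ↭ w ∷ ws ++ i)
        (inner-untouched L (All.map (λ {l′} d → long-unparallel {l} {l′} d refl j) c)) ↭-refl
    ... | no ¬j = ⊥-elim (¬j j)
    inner-subdivideL {l} (l′@((u , v) , m , _) ∷ L) (there i) eq j (c ∷ cs) with joinsPair? (u , v) x y
    ... | yes j′ with trans (sym eq) (proj₁ (proj₂ (apart (All.lookup c i) j′ j)))
    ...   | ()
    inner-subdivideL {l} {w} (l′@((u , v) , m , _) ∷ L) (there i) eq j (c ∷ cs) | no _ =
      ↭-trans (↭-sym (shift w m _)) (++⁺ˡ m (inner-subdivideL L i eq j cs))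

  module _ {n} {L : List (Placed n)} (μ : Model L) (noLoops : All (NoLoop ∘ pair) L) where
    open Model μ

    Long : Placed n → Set
    Long l = ∃[ w ] ∃[ ws ] mids l ≡ w ∷ ws

    long? : Decidable Long
    long? (_ , [] , _)     = no λ ()
    long? (_ , w ∷ ws , _) = yes (w , ws , refl)

    subdivided : ∀ {l x y w ws} → l ∈ L → pair l ≡ (x , y) → mids l ≡ w ∷ ws → Model (subdivideL x y L)
    subdivided {l} {x} {y} {w} {ws} l∈ refl eq = record
      { place = place′ ; injective = injective′
      ; routes = all-subdivideL L (All.tabulate λ {k} k∈ → (λ _ → All.lookup routes k∈) , λ j → split k k∈ j)
      ; unique = AllPairs.tail uniq
      ; fresh = λ { i zero refl → Unique[x∷xs]⇒x∉xs uniq i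
                  ; i (suc j) → fresh (∈-resp-↭ perm (there i)) j }
      ; compatible = compatible-subdivideL L noLoops (All.tabulate λ k∈ j → w , ws , trans (cong mids (only k∈ j)) eq) compatible
      }
      where
      jl : JoinsPair (pair l) x y
      jl = inj₁ (refl , refl)
      only : ∀ {k} → k ∈ L → JoinsPair (pair k) x y → k ≡ l
      only k∈ j with pairwise compatible k∈ l∈
      ... | inj₁ p = p
      ... | inj₂ (inj₁ c) = case trans (sym eq) (proj₁ (proj₂ (apart c j jl))) of λ ()
      ... | inj₂ (inj₂ c) = case trans (sym eq) (proj₁ (apart c jl j)) of λ ()
      perm : w ∷ inner (subdivideL x y L) ↭ inner L
      perm = inner-subdivideL L l∈ eq jl compatible
      uniq : Unique (w ∷ inner (subdivideL x y L))
      uniq = Unique-resp-↭ (setoid (Vertex G)) (↭⇒↭ₛ (↭-sym perm)) unique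
      place′ : Fin (suc n) → Vertex G
      place′ zero    = w
      place′ (suc i) = place i
      w≢ : ∀ i → w ≢ place i
      w≢ = fresh (∈-resp-↭ perm (here refl))
      injective′ : ∀ {i j} → place′ i ≡ place′ j → i ≡ j
      injective′ {zero}  {zero}  _ = refl
      injective′ {zero}  {suc j} p = ⊥-elim (w≢ j p)
      injective′ {suc i} {zero}  p = ⊥-elim (w≢ i (sym p))
      injective′ {suc i} {suc j} p = cong suc (injective p)
      cut : ∀ {a b} m es → m ≡ w ∷ ws → Route a m es b → Route a [] (take 1 es) w × Route w (drop 1 m) (drop 1 es) b
      cut (_ ∷ _) (e ∷ _ ∷ _) refl (j , r) = j , r
      split : ∀ k → k ∈ L → JoinsPair (pair k) x y →
              Route (place (proj₁ (pair k))) [] (take 1 (trail k)) w ×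
              Route w (drop 1 (mids k)) (drop 1 (trail k)) (place (proj₂ (pair k)))
      split k k∈ j = cut (mids k) (trail k) (trans (cong mids (only k∈ j)) eq) (All.lookup routes k∈)

    Direct : Placed n → Set
    Direct l = ∃[ e ] trail l ≡ e ∷ [] × Joins G e (place (proj₁ (pair l))) (place (proj₂ (pair l)))

    direct : (∀ {l} → l ∈ L → ¬ Long l) → All Direct L
    direct short = All.tabulate λ {l} l∈ → go (mids l) (trail l) (short l∈) (All.lookup routes l∈)
      where
      go : ∀ {a b} m es → ¬ (∃[ w ] ∃[ ws ] m ≡ w ∷ ws) → Route a m es b → ∃[ e ] es ≡ e ∷ [] × Joins G e a b
      go []      (e ∷ []) _ j = e , refl , j
      go (_ ∷ _) _        s _ = ⊥-elim (s (_ , _ , refl))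

    picked : ∀ {L} → All Direct L → (i : Fin (length (map pair L))) →
             ∃[ l ] l ∈ L × pair l ≡ lookup (map pair L) i × Direct l
    picked (_∷_ {x = l} d ds) zero    = l , here refl , refl , d
    picked (d ∷ ds)           (suc i) = let l , l∈ , r = picked ds i in l , there l∈ , r

    pick : ∀ {L} → All Direct L → Fin (length (map pair L)) → Edge G
    pick ds i = proj₁ (proj₂ (proj₂ (proj₂ (picked ds i))))

    -- Routes over the same single edge of `G` have the same end vertices and hence belong to
    -- parallel edges, whose trails `apart` makes different.
    clash : ∀ {k l} → Compatible k l → (d : Direct k) (d′ : Direct l) → proj₁ d ≢ proj₁ d′
    clash c (e , eq , j) (_ , eq′ , j′) refl with sameEnds j j′
    ... | inj₁ (p , q) with injective p | injective q
    ...   | p′ | q′ = proj₂ (proj₂ (apart c (inj₁ (refl , refl)) (inj₁ (sym p′ , sym q′)))) (trans eq (sym eq′))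
    clash c (e , eq , j) (_ , eq′ , j′) refl | inj₂ (p , q) with injective p | injective q
    ...   | p′ | q′ = proj₂ (proj₂ (apart c (inj₁ (refl , refl)) (inj₂ (sym q′ , sym p′)))) (trans eq (sym eq′))

    pick-injective : ∀ {L} (ds : All Direct L) → AllPairs Compatible L → ∀ {i j} → pick ds i ≡ pick ds j → i ≡ j
    pick-injective (d ∷ ds) (c ∷ cs) {zero}  {zero}  _ = refl
    pick-injective (d ∷ ds) (c ∷ cs) {zero}  {suc j} p =
      let l , l∈ , _ , d′ = picked ds j in ⊥-elim (clash (All.lookup c l∈) d d′ p)
    pick-injective (d ∷ ds) (c ∷ cs) {suc i} {zero}  p =
      let l , l∈ , _ , d′ = picked ds i in ⊥-elim (clash (All.lookup c l∈) d d′ (sym p))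
    pick-injective (d ∷ ds) (c ∷ cs) {suc i} {suc j} p = cong suc (pick-injective ds cs p)

    embedded : ∀ {ll} → (∀ {l} → l ∈ L → ¬ Long l) → IsoToSubgraph (graph n (map pair L) ll) G
    embedded short = record
      { onVertex = place ; onEdge = pick ds
      ; vertexInjective = injective
      ; edgeInjective = pick-injective ds compatible
      ; incidence = λ {i} → incident i }
      where
      ds = direct short
      incident : ∀ i {x y} → JoinsPair (lookup (map pair L) i) x y → Joins G (pick ds i) (place x) (place y)
      incident i j with picked ds i
      ... | l , _ , eq , e , _ , k with subst (λ p → JoinsPair p _ _) (sym eq) j
      ...   | inj₁ (refl , refl) = k
      ...   | inj₂ (refl , refl) = joins-sym k

  all-pairs : ∀ {n} {L : List (Placed n)} {P : Fin n × Fin n → Set} → All P (map pair L) → All (P ∘ pair) L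
  all-pairs {L = []}    []       = []
  all-pairs {L = _ ∷ _} (p ∷ ps) = p ∷ all-pairs ps

  ∈⇒joins : ∀ {n} {es : List (Fin n × Fin n)} {x y} → (x , y) ∈ es → ∃[ e ] JoinsPair (lookup es e) x y
  ∈⇒joins (here refl) = zero , inj₁ (refl , refl)
  ∈⇒joins (there i)   = let e , j = ∈⇒joins i in suc e , j

  -- Each m-subdivision turns one inner vertex into a branch vertex, so the number of inner vertices
  -- is the measure. When none is left, every route is one edge and the model is an embedding.
  realise : ∀ k {n es ll} (L : List (Placed n)) → es ≡ map pair L → Model L → length (inner L) ≤ k →
            graph n es ll IsMTopologicalMinorOf G
  realise k {ll = ll} L refl μ ≤k with Any.any? (long? μ (all-pairs ll)) L
  ... | no ¬long = _ , ε , embedded μ (all-pairs ll) λ l∈ long → ¬long (lose l∈ long)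
  ... | yes long with find long
  ... | l@((x , y) , _) , l∈ , w , ws , eq with k
  ...   | zero = case ≤-trans (≤-reflexive shrinks) ≤k of λ ()
    where shrinks = ↭-length (inner-subdivideL {x = x} {y} L l∈ eq (inj₁ (refl , refl)) (Model.compatible μ))
  ...   | suc k =
    let K , steps , iso = realise k (subdivideL x y L) (sym (pairs-subdivideL x y L))
                            (subdivided μ (all-pairs ll) l∈ refl eq)
                            (s≤s⁻¹ (≤-trans (≤-reflexive shrinks) ≤k))
    in K , subdivide x y (∈⇒joins (∈-map⁺ pair l∈)) ◅ steps , iso
    where shrinks = ↭-length (inner-subdivideL {x = x} {y} L l∈ eq (inj₁ (refl , refl)) (Model.compatible μ))

-- Minors in bad configurations

module Models (G : Graph) where
  open Theory G
  open Realisation G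
  open Colouring G using (Theta; Bowtie; bad₅⇒theta; bad₃⇒bowtie⊎bad₅)

  interior : ∀ {a b} → Walk {G} a b → List (Vertex G)
  interior [ _ ]                            = []
  interior (_ -⟨ _ ⟩- [ _ ])                = []
  interior (_ -⟨ _ ⟩- w@(y -⟨ _ ⟩- _))     = y ∷ interior w

  interior⊆ : ∀ {a b v} (w : Walk {G} a b) → v ∈ interior w → v ∈ vertices w
  interior⊆ (_ -⟨ _ ⟩- w@(y -⟨ _ ⟩- _)) (here refl) = there (here refl)
  interior⊆ (_ -⟨ _ ⟩- w@(y -⟨ _ ⟩- _)) (there i)   = there (interior⊆ w i)

  interior-≢ : ∀ {a b v} (w : Walk {G} a b) → Unique (vertices w) → v ∈ interior w → v ≢ a × v ≢ b
  interior-≢ (_ -⟨ _ ⟩- w@(y -⟨ _ ⟩- w′)) (x ∷ y≢ ∷ _) (here refl) =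
    ≢-sym (All.lookup x (here refl)) , All.lookup y≢ (end∈ w′)
  interior-≢ (_ -⟨ _ ⟩- w@(y -⟨ _ ⟩- _)) (x ∷ u) (there i) =
    ≢-sym (All.lookup x (interior⊆ w i)) , proj₂ (interior-≢ w u i)

  interior-unique : ∀ {a b} (w : Walk {G} a b) → Unique (vertices w) → Unique (interior w)
  interior-unique [ _ ]                        _       = []
  interior-unique (_ -⟨ _ ⟩- [ _ ])            _       = []
  interior-unique (_ -⟨ _ ⟩- w@(y -⟨ _ ⟩- _)) (_ ∷ u) =
    All.tabulate (λ i → ≢-sym (proj₁ (interior-≢ w u i))) ∷ interior-unique w u

  route : ∀ {a b} (w : Walk {G} a b) → a ≢ b → Route a (interior w) (edges w) b
  route [ _ ]             a≢b = a≢b refl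
  route (_ -⟨ j ⟩- w)    _   = go j w
    where
    go : ∀ {a c b e} (j : Joins G e a c) (w : Walk {G} c b) → Route a (interior (a -⟨ j ⟩- w)) (e ∷ edges w) b
    go j [ _ ]            = j
    go j (_ -⟨ k ⟩- w) = j , go k w

  record Split {x y} (w : Walk {G} x y) (h : Vertex G) : Set where
    field
      pre         : Walk {G} x h
      suf         : Walk {G} h y
      pre-unique  : Unique (vertices pre)
      suf-unique  : Unique (vertices suf)
      pre⊆        : ∀ {v} → v ∈ vertices pre → v ∈ vertices w
      suf⊆        : ∀ {v} → v ∈ vertices suf → v ∈ vertices w
      meet        : ∀ {v} → v ∈ vertices pre → v ∈ vertices suf → v ≡ h

  split : ∀ {x y h} (w : Walk {G} x y) → Unique (vertices w) → h ∈ vertices w → Split w h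
  split w@([ _ ]) u (here refl) = record
    { pre = w ; suf = w ; pre-unique = u ; suf-unique = u ; pre⊆ = id ; suf⊆ = id ; meet = λ { (here p) _ → p } }
  split w@(x -⟨ _ ⟩- _) u (here refl) = record
    { pre = [ x ] ; suf = w ; pre-unique = [] ∷ [] ; suf-unique = u
    ; pre⊆ = λ { (here p) → here p } ; suf⊆ = id ; meet = λ { (here p) _ → p } }
  split (x -⟨ j ⟩- w) (x≢ ∷ u) (there i) = record
    { pre = x -⟨ j ⟩- pre ; suf = suf
    ; pre-unique = All≢ (λ k → All.lookup x≢ (pre⊆ k) refl) ∷ pre-unique ; suf-unique = suf-unique
    ; pre⊆ = λ { (here p) → here p ; (there k) → there (pre⊆ k) } ; suf⊆ = there ∘ suf⊆
    ; meet = λ { (here refl) l → ⊥-elim (All.lookup x≢ (suf⊆ l) refl) ; (there k) l → meet k l } }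
    where open Split (split w u i)

  record Hit {a b} (w : Walk {G} a b) (l : List (Vertex G)) : Set where
    field
      {h}     : Vertex G
      h∈      : h ∈ l
      walk    : Walk {G} a h
      within  : ∀ {v} → v ∈ vertices walk → v ∈ vertices w
      only    : ∀ {v} → v ∈ vertices walk → v ∈ l → v ≡ h

  first-hit : ∀ {a b l} (w : Walk {G} a b) → b ∈ l → Hit w l
  first-hit [ x ] b∈ = record { h∈ = b∈ ; walk = [ x ] ; within = id ; only = λ { (here p) _ → p } }
  first-hit {a} {l = l} (_ -⟨ j ⟩- w) b∈ with a ∈? l
  ... | yes a∈ = record { h∈ = a∈ ; walk = [ a ] ; within = λ { (here p) → here p } ; only = λ { (here p) _ → p } }
  ... | no a∉  = record
    { h∈ = h∈ ; walk = a -⟨ j ⟩- walk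
    ; within = λ { (here p) → here p ; (there i) → there (within i) }
    ; only = λ { (here refl) v∈ → ⊥-elim (a∉ v∈) ; (there i) v∈ → only i v∈ } }
    where open Hit (first-hit w b∈)

  -- In the models below the pairs are concrete numerals, so evaluating `joinsPair?` shows that they
  -- are not parallel.
  off : ∀ {n} {u v : Fin n} {p r r′} {_ : False (joinsPair? p u v)} → Compatible ((u , v) , r) (p , r′)
  off {_} {_} {_} {_} {_} {_} {no-join} = compat λ j k → ⊥-elim (toWitnessFalse no-join (same-pair j k))

  twin : ∀ {n} {p q : Fin n × Fin n} {e f} → e ≢ f → Compatible (p , [] , e ∷ []) (q , [] , f ∷ [])
  twin e≢f = compat λ _ _ → refl , refl , λ { refl → e≢f refl }

  module _ {n} {L : List (Placed n)} (vs : Vec (Vertex G) n) where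

    model : VecUnique.Unique vs →
            All (λ l → Route (Vec.lookup vs (proj₁ (pair l))) (mids l) (trail l) (Vec.lookup vs (proj₂ (pair l)))) L →
            Unique (inner L) → (∀ {v} → v ∈ inner L → VecAll.All (v ≢_) vs) → AllPairs Compatible L →
            ∀ {ll} → graph n (map pair L) ll IsMTopologicalMinorOf G
    model distinct routes unique fresh compatible = realise _ L refl (record
      { place = Vec.lookup vs ; injective = VecUnique.lookup-injective distinct _ _ ; routes = routes
      ; unique = unique ; fresh = λ i j → VecAll.lookup⁺ (fresh i) j ; compatible = compatible }) ≤-refl

  pattern _∷ᵥ_ x xs = VecAll._∷_ x xs
  pattern []ᵥ = VecAll.[]
  pattern _∷ᵤ_ x xs = VecAllPairs._∷_ x xs
  pattern []ᵤ = VecAllPairs.[]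
  infixr 5 _∷ᵥ_ _∷ᵤ_

  ++[] : ∀ {l : List (Vertex G)} → Unique l → Unique (l ++ [])
  ++[] = subst Unique (sym (++-identityʳ _))

  ++[]⁻ : ∀ {l : List (Vertex G)} {v} → v ∈ l ++ [] → v ∈ l
  ++[]⁻ = subst (_ ∈_) (++-identityʳ _)

  bad₁⇒M₁ : Bad₁ → M₁ IsMTopologicalMinorOf G
  bad₁⇒M₁ (a , b , c , d , a≢c , a≢d , b≢d , (e₁ , e₂ , e≢ , E₁ , E₂)
          , (f₁ , f₂ , f≢ , F₁ , F₂) , (g₁ , g₂ , g≢ , G₁ , G₂)) =
    model {L = (_ , [] , e₁ ∷ []) ∷ (_ , [] , e₂ ∷ []) ∷ (_ , [] , f₁ ∷ []) ∷ (_ , [] , f₂ ∷ [])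
             ∷ (_ , [] , g₁ ∷ []) ∷ (_ , [] , g₂ ∷ []) ∷ []}
      (a Vec.∷ b Vec.∷ c Vec.∷ d Vec.∷ Vec.[])
      ((joins-≢ E₁ ∷ᵥ a≢c ∷ᵥ a≢d ∷ᵥ []ᵥ) ∷ᵤ (joins-≢ F₁ ∷ᵥ b≢d ∷ᵥ []ᵥ) ∷ᵤ (joins-≢ G₁ ∷ᵥ []ᵥ) ∷ᵤ []ᵥ ∷ᵤ []ᵤ)
      (E₁ ∷ E₂ ∷ F₁ ∷ F₂ ∷ G₁ ∷ G₂ ∷ []) [] (λ ())
      ((twin e≢ ∷ off ∷ off ∷ off ∷ off ∷ []) ∷ (off ∷ off ∷ off ∷ off ∷ []) ∷ (twin f≢ ∷ off ∷ off ∷ [])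
        ∷ (off ∷ off ∷ []) ∷ (twin g≢ ∷ []) ∷ [] ∷ [])

  bad₂⇒M₂ : Bad₂ → M₂ IsMTopologicalMinorOf G
  bad₂⇒M₂ (u , v , x , y , x≢y , x≢v , y≢v , (e , f , e≢f , E , F) , (g , G₁) , (h , H) , x~y)
    with conn⇒path (≢-sym (joins-≢ G₁) , x≢v) x~y
  ... | simplePath w unique within =
    model {L = (_ , [] , g ∷ []) ∷ (_ , interior w , edges w) ∷ (_ , [] , h ∷ []) ∷ (_ , [] , e ∷ [])
             ∷ (_ , [] , f ∷ []) ∷ []}
      (u Vec.∷ x Vec.∷ y Vec.∷ v Vec.∷ Vec.[])
      ((joins-≢ G₁ ∷ᵥ joins-≢ H ∷ᵥ joins-≢ E ∷ᵥ []ᵥ) ∷ᵤ (x≢y ∷ᵥ x≢v ∷ᵥ []ᵥ) ∷ᵤ (y≢v ∷ᵥ []ᵥ) ∷ᵤ []ᵥ ∷ᵤ []ᵤ)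
      (G₁ ∷ route w x≢y ∷ joins-sym H ∷ E ∷ F ∷ []) (++[] (interior-unique w unique))
      (λ i → let k = ++[]⁻ i ; ≢u , ≢v = within (interior⊆ w k) ; ≢x , ≢y = interior-≢ w unique k
             in ≢u ∷ᵥ ≢x ∷ᵥ ≢y ∷ᵥ ≢v ∷ᵥ []ᵥ)
      ((off ∷ off ∷ off ∷ off ∷ []) ∷ (off ∷ off ∷ off ∷ []) ∷ (off ∷ off ∷ []) ∷ (twin e≢f ∷ []) ∷ [] ∷ [])

  bad₄⇒M₄ : Bad₄ → M₄ IsMTopologicalMinorOf G
  bad₄⇒M₄ (x , y , a , b , a≢b , a≢y , b≢x , (e , f , e≢f , E , F) , (g , G₁) , (h , H) , a~b)
    with conn⇒path (b≢x , ≢-sym (joins-≢ H)) (conn-sym a~b)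
  ... | simplePath w unique within =
    model {L = (_ , [] , e ∷ []) ∷ (_ , [] , f ∷ []) ∷ (_ , [] , h ∷ []) ∷ (_ , interior w , edges w)
             ∷ (_ , [] , g ∷ []) ∷ []}
      (x Vec.∷ y Vec.∷ b Vec.∷ a Vec.∷ Vec.[])
      ((joins-≢ E ∷ᵥ ≢-sym b≢x ∷ᵥ joins-≢ G₁ ∷ᵥ []ᵥ) ∷ᵤ (joins-≢ H ∷ᵥ ≢-sym a≢y ∷ᵥ []ᵥ) ∷ᵤ (≢-sym a≢b ∷ᵥ []ᵥ) ∷ᵤ []ᵥ ∷ᵤ []ᵤ)
      (E ∷ F ∷ H ∷ route w (≢-sym a≢b) ∷ joins-sym G₁ ∷ []) (++[] (interior-unique w unique))
      (λ i → let k = ++[]⁻ i ; ≢x , ≢y = within (interior⊆ w k) ; ≢b , ≢a = interior-≢ w unique k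
             in ≢x ∷ᵥ ≢y ∷ᵥ ≢b ∷ᵥ ≢a ∷ᵥ []ᵥ)
      ((twin e≢f ∷ off ∷ off ∷ off ∷ []) ∷ (off ∷ off ∷ off ∷ []) ∷ (off ∷ off ∷ []) ∷ (off ∷ []) ∷ [] ∷ [])

  bowtie⇒M₃ : Bowtie → M₃ IsMTopologicalMinorOf G
  bowtie⇒M₃ (u , a , b , c , d , a≢b , a≢c , a≢d , b≢c , b≢d , c≢d
            , (e , A) , (f , B) , (g , C) , (h , D) , a~b , c~d , ¬a~c)
    with conn⇒path (≢-sym (joins-≢ A) , ≢-sym (joins-≢ A)) a~b | conn⇒path (≢-sym (joins-≢ C) , ≢-sym (joins-≢ C)) c~d
  ... | simplePath w unique within | simplePath w′ unique′ within′ =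
    model {L = (_ , [] , e ∷ []) ∷ (_ , interior w , edges w) ∷ (_ , [] , f ∷ [])
             ∷ (_ , [] , g ∷ []) ∷ (_ , interior w′ , edges w′) ∷ (_ , [] , h ∷ []) ∷ []}
      (u Vec.∷ a Vec.∷ b Vec.∷ c Vec.∷ d Vec.∷ Vec.[])
      ((joins-≢ A ∷ᵥ joins-≢ B ∷ᵥ joins-≢ C ∷ᵥ joins-≢ D ∷ᵥ []ᵥ) ∷ᵤ (a≢b ∷ᵥ a≢c ∷ᵥ a≢d ∷ᵥ []ᵥ)
        ∷ᵤ (b≢c ∷ᵥ b≢d ∷ᵥ []ᵥ) ∷ᵤ (c≢d ∷ᵥ []ᵥ) ∷ᵤ []ᵥ ∷ᵤ []ᵤ)
      (A ∷ route w a≢b ∷ joins-sym B ∷ C ∷ route w′ c≢d ∷ joins-sym D ∷ [])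
      (Unique.++⁺ (interior-unique w unique) (++[] (interior-unique w′ unique′))
        λ (i , k) → apart (interior⊆ w i) (interior⊆ w′ (++[]⁻ k)))
      (λ i → [ (λ k → let ≢a , ≢b = interior-≢ w unique k ; k′ = interior⊆ w k
                      in proj₁ (within k′) ∷ᵥ ≢a ∷ᵥ ≢b ∷ᵥ (λ { refl → apart k′ (start∈ w′) })
                         ∷ᵥ (λ { refl → apart k′ (end∈ w′) }) ∷ᵥ []ᵥ)
             , (λ k → let ≢c , ≢d = interior-≢ w′ unique′ (++[]⁻ k) ; k′ = interior⊆ w′ (++[]⁻ k)
                      in proj₁ (within′ k′) ∷ᵥ (λ { refl → apart (start∈ w) k′ })
                         ∷ᵥ (λ { refl → apart (end∈ w) k′ }) ∷ᵥ ≢c ∷ᵥ ≢d ∷ᵥ []ᵥ) ]′ (∈-++⁻ (interior w) i))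
      ((off ∷ off ∷ off ∷ off ∷ off ∷ []) ∷ (off ∷ off ∷ off ∷ off ∷ []) ∷ (off ∷ off ∷ off ∷ [])
        ∷ (off ∷ off ∷ []) ∷ (off ∷ []) ∷ [] ∷ [])
    where
    reach : ∀ {x y v} (w : Walk {G} x y) → (∀ {q} → q ∈ vertices w → Away u u q) → Unique (vertices w) →
            v ∈ vertices w → Conn (Away u u) x v
    reach w within unique i = let open Split (split w unique i) in walk⇒conn pre (within ∘ pre⊆)
    -- A common vertex of the two arcs would connect `a` to `c` without `u`.
    apart : ∀ {v} → v ∈ vertices w → v ∈ vertices w′ → ⊥
    apart i k = ¬a~c (reach w within unique i ◅◅ conn-sym (reach w′ within′ unique′ k))

  -- The branch vertices are u and the first vertex h of the walk from c on the
  -- path from x to y.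
  branch : ∀ {u c x y w} → x ≢ y → x ≢ c → y ≢ c → w ≢ u → Adjacent u x → Adjacent u y → Adjacent u c → Adjacent c w →
           (q : SimplePath (Away u c) x y) (H : Σ (Walk {G} w x) λ v → ∀ {t} → t ∈ vertices v → Away u c t) →
           Hit.h (first-hit {l = vertices (SimplePath.walk q)} (proj₁ H) (start∈ (SimplePath.walk q))) ≢ y →
           M₅ IsMTopologicalMinorOf G
  branch {u} {c} {x} {y} x≢y x≢c y≢c w≢u (e , X) (f , Y) (g , C) (_ , W) (simplePath q q-unique q-away) (r , r-away) h≢y
    with shorten (Hit.walk (first-hit r (start∈ q))) (untimed _)
  ... | shortened t _ t-unique t⊆ _ =
    model {L = (_ , [] , g ∷ []) ∷ (_ , interior c⇝h , edges c⇝h) ∷ (_ , interior suf , edges suf) ∷ (_ , [] , f ∷ [])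
             ∷ (_ , interior u⇝h , edges u⇝h) ∷ []}
      (u Vec.∷ c Vec.∷ h Vec.∷ y Vec.∷ Vec.[])
      ((joins-≢ C ∷ᵥ ≢-sym h≢u ∷ᵥ joins-≢ Y ∷ᵥ []ᵥ) ∷ᵤ (≢-sym h≢c ∷ᵥ ≢-sym y≢c ∷ᵥ []ᵥ) ∷ᵤ (h≢y ∷ᵥ []ᵥ) ∷ᵤ []ᵥ ∷ᵤ []ᵤ)
      (C ∷ route c⇝h (≢-sym h≢c) ∷ route suf h≢y ∷ joins-sym Y ∷ route u⇝h (≢-sym h≢u) ∷ [])
      (Unique.++⁺ (interior-unique c⇝h c-unique)
        (Unique.++⁺ (interior-unique suf suf-unique) (++[] (interior-unique u⇝h u-unique))
          λ (i , k) → let ≢u , ≢h = interior-≢ u⇝h u-unique (++[]⁻ k)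
                      in ≢h (meet (in-pre (interior⊆ u⇝h (++[]⁻ k)) ≢u) (interior⊆ suf i)))
        λ (i , k) → let ≢c , ≢h = interior-≢ c⇝h c-unique i
                        i′ = in-t (interior⊆ c⇝h i) ≢c
                    in ≢h (only (t⊆ i′) ([ suf⊆ ∘ interior⊆ suf
                         , (λ l → pre⊆ (in-pre (interior⊆ u⇝h (++[]⁻ l)) (proj₁ (interior-≢ u⇝h u-unique (++[]⁻ l))))) ]′
                         (∈-++⁻ (interior suf) k))))
      (λ i → [ (λ k → let ≢c , ≢h = interior-≢ c⇝h c-unique k ; k′ = in-t (interior⊆ c⇝h k) ≢c
                      in proj₁ (r-away (within (t⊆ k′))) ∷ᵥ ≢c ∷ᵥ ≢h
                         ∷ᵥ (λ { refl → ≢h (only (t⊆ k′) (end∈ q)) }) ∷ᵥ []ᵥ)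
             , (λ k → [ (λ l → let ≢h , ≢y = interior-≢ suf suf-unique l ; ≢u , ≢c = q-away (suf⊆ (interior⊆ suf l))
                               in ≢u ∷ᵥ ≢c ∷ᵥ ≢h ∷ᵥ ≢y ∷ᵥ []ᵥ)
                      , (λ l → let l′ = ++[]⁻ l ; ≢u , ≢h = interior-≢ u⇝h u-unique l′
                                   l″ = in-pre (interior⊆ u⇝h l′) ≢u
                               in ≢u ∷ᵥ proj₂ (q-away (pre⊆ l″)) ∷ᵥ ≢h
                                  ∷ᵥ (λ { refl → ≢h (meet l″ (end∈ suf)) }) ∷ᵥ []ᵥ) ]′ (∈-++⁻ (interior suf) k)) ]′
             (∈-++⁻ (interior c⇝h) i))
      ((off ∷ off ∷ off ∷ off ∷ []) ∷ (off ∷ off ∷ off ∷ []) ∷ (off ∷ off ∷ []) ∷ (off ∷ []) ∷ [] ∷ [])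
    where
    open Hit (first-hit r (start∈ q)) using (h; h∈; within; only)
    open Split (split q q-unique h∈)
    h≢u : h ≢ u
    h≢u = proj₁ (q-away h∈)
    h≢c : h ≢ c
    h≢c = proj₂ (q-away h∈)
    c⇝h : Walk {G} c h
    c⇝h = c -⟨ W ⟩- t
    c-unique : Unique (vertices c⇝h)
    c-unique = All≢ (λ i → proj₂ (r-away (within (t⊆ i))) refl) ∷ t-unique
    u⇝h : Walk {G} u h
    u⇝h = u -⟨ X ⟩- pre
    u-unique : Unique (vertices u⇝h)
    u-unique = All≢ (λ i → proj₁ (q-away (pre⊆ i)) refl) ∷ pre-unique
    in-t : ∀ {v} → v ∈ vertices c⇝h → v ≢ c → v ∈ vertices t
    in-t (here p)  n = ⊥-elim (n p)
    in-t (there i) _ = i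
    in-pre : ∀ {v} → v ∈ vertices u⇝h → v ≢ u → v ∈ vertices pre
    in-pre (here p)  n = ⊥-elim (n p)
    in-pre (there i) _ = i

  -- `branch` does not apply if the walk from `w` first hits the path at its end `b`. Then `a` and
  -- `b` exchange roles: the walk up to that hit meets the path nowhere else, so its first hit with
  -- the reversed path is not `a`.
  theta⇒M₅ : Theta → M₅ IsMTopologicalMinorOf G
  theta⇒M₅ (u , a , b , c , w , a≢b , a≢c , b≢c , w≢u , w≢a , A , B , C , W , w~a , a~b) = go
    where
    w-away : Away u c w
    w-away = w≢u , ≢-sym (adj-≢ W)
    q : SimplePath (Away u c) a b
    q = conn⇒path (≢-sym (adj-≢ A) , a≢c) a~b
    module q = SimplePath q
    reversed : Conn (_∈ vertices q.walk) b a
    reversed = conn-sym (walk⇒conn q.walk id)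
    q′ : SimplePath (_∈ vertices q.walk) b a
    q′ = conn⇒path (end∈ q.walk) reversed
    module q′ = SimplePath q′
    w⇝a : Σ (Walk {G} w a) λ v → ∀ {t} → t ∈ vertices v → Away u c t
    w⇝a = conn⇒walk w-away w~a
    module H = Hit (first-hit {l = vertices q.walk} (proj₁ w⇝a) (start∈ q.walk))
    go : M₅ IsMTopologicalMinorOf G
    go with H.h ≟ b
    ... | no h≢b = branch a≢b a≢c b≢c w≢u A B C W q w⇝a h≢b
    ... | yes h≡b = branch (≢-sym a≢b) b≢c a≢c w≢u B A C W
            (simplePath q′.walk q′.unique (q.within ∘ q′.within)) w⇝b λ h′≡a →
              a≢b (trans (H.only (back (∈-resp h′≡a (end∈ H′.walk))) (start∈ q.walk)) h≡b)
      where
      un : ∀ {h b} (p : h ≡ b) (v : Walk {G} w h) {t} → t ∈ vertices (subst (Walk w) p v) → t ∈ vertices v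
      un refl v i = i
      w⇝b : Σ (Walk {G} w b) λ v → ∀ {t} → t ∈ vertices v → Away u c t
      w⇝b = subst (Walk w) h≡b H.walk , λ i → proj₂ w⇝a (H.within (un h≡b H.walk i))
      module H′ = Hit (first-hit {l = vertices q′.walk} (proj₁ w⇝b) (start∈ q′.walk))
      back : ∀ {t} → t ∈ vertices H′.walk → t ∈ vertices H.walk
      back i = un h≡b H.walk (H′.within i)

  bad⇒minor : Bad → ¬ All (λ M → ¬ (M IsMTopologicalMinorOf G)) (M₁ ∷ M₂ ∷ M₃ ∷ M₄ ∷ M₅ ∷ [])
  bad⇒minor bad (¬M₁ ∷ ¬M₂ ∷ ¬M₃ ∷ ¬M₄ ∷ ¬M₅ ∷ []) = case bad of λ
    { (inj₁ b) → ¬M₁ (bad₁⇒M₁ b)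
    ; (inj₂ (inj₁ b)) → ¬M₂ (bad₂⇒M₂ b)
    ; (inj₂ (inj₂ (inj₁ b))) → [ ¬M₃ ∘ bowtie⇒M₃ , ¬M₅ ∘ theta⇒M₅ ∘ bad₅⇒theta ]′ (bad₃⇒bowtie⊎bad₅ b)
    ; (inj₂ (inj₂ (inj₂ (inj₁ b)))) → ¬M₄ (bad₄⇒M₄ b)
    ; (inj₂ (inj₂ (inj₂ (inj₂ b)))) → ¬M₅ (theta⇒M₅ (bad₅⇒theta b)) }

-- Bad configurations survive m-subdivision

module Subdivision (H : Graph) (p q : Vertex H) where
  open Theory H
  private module H′ = Theory (mSubdivide H p q)

  -- Images with different origins are different edges; this is how a double adjacency survives in
  -- `double-heir`.
  origin : ∀ es → Fin (length (subdivideEdges p q es)) → Fin (length es)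
  origin ((u , v) ∷ es) i with joinsPair? (u , v) p q
  origin ((u , v) ∷ es) zero          | yes _ = zero
  origin ((u , v) ∷ es) (suc zero)    | yes _ = zero
  origin ((u , v) ∷ es) (suc (suc i)) | yes _ = suc (origin es i)
  origin ((u , v) ∷ es) zero          | no _  = zero
  origin ((u , v) ∷ es) (suc i)       | no _  = suc (origin es i)

  Image : ∀ es → Fin (length es) → Fin (suc (order H)) → Fin (suc (order H)) → Set
  Image es e a b = ∃[ f ] origin es f ≡ e × JoinsPair (lookup (subdivideEdges p q es) f) a b

  suc-joins : ∀ {n} {r : Fin n × Fin n} {a b} → JoinsPair r a b → JoinsPair (suc (proj₁ r) , suc (proj₂ r)) (suc a) (suc b)
  suc-joins (inj₁ (refl , refl)) = inj₁ (refl , refl)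
  suc-joins (inj₂ (refl , refl)) = inj₂ (refl , refl)

  kept-edge : ∀ es e {a b} → ¬ JoinsPair (lookup es e) p q → JoinsPair (lookup es e) a b → Image es e (suc a) (suc b)
  kept-edge ((u , v) ∷ es) e ¬j k with joinsPair? (u , v) p q
  kept-edge ((u , v) ∷ es) zero ¬j k | yes j = ⊥-elim (¬j j)
  kept-edge ((u , v) ∷ es) zero ¬j k | no _  = zero , refl , suc-joins k
  kept-edge ((u , v) ∷ es) (suc e) ¬j k | yes _ with kept-edge es e ¬j k
  ... | f , eq , l = suc (suc f) , cong suc eq , l
  kept-edge ((u , v) ∷ es) (suc e) ¬j k | no _ with kept-edge es e ¬j k
  ... | f , eq , l = suc f , cong suc eq , l

  half-edge : ∀ es e {a b} → JoinsPair (lookup es e) p q → JoinsPair (lookup es e) a b → Image es e (suc a) zero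
  half-edge ((u , v) ∷ es) e j k with joinsPair? (u , v) p q
  half-edge ((u , v) ∷ es) zero j k | no ¬j = ⊥-elim (¬j j)
  half-edge ((u , v) ∷ es) zero j (inj₁ (refl , refl)) | yes _ = zero , refl , inj₁ (refl , refl)
  half-edge ((u , v) ∷ es) zero j (inj₂ (refl , refl)) | yes _ = suc zero , refl , inj₂ (refl , refl)
  half-edge ((u , v) ∷ es) (suc e) j k | yes _ with half-edge es e j k
  ... | f , eq , l = suc (suc f) , cong suc eq , l
  half-edge ((u , v) ∷ es) (suc e) j k | no _ with half-edge es e j k
  ... | f , eq , l = suc f , cong suc eq , l

  Split : Vertex H → Vertex H → Set
  Split a b = JoinsPair (a , b) p q

  split? : ∀ a b → Dec (Split a b)
  split? a b = joinsPair? (a , b) p q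

  split-edge : ∀ {r a b} → JoinsPair r a b → Split a b → JoinsPair r p q
  split-edge j (inj₁ (refl , refl)) = j
  split-edge (inj₁ j) (inj₂ (refl , refl)) = inj₂ j
  split-edge (inj₂ j) (inj₂ (refl , refl)) = inj₁ j

  edge-split : ∀ {r a b} → JoinsPair r a b → JoinsPair r p q → Split a b
  edge-split (inj₁ (refl , refl)) k = k
  edge-split (inj₂ (refl , refl)) (inj₁ (refl , refl)) = inj₂ (refl , refl)
  edge-split (inj₂ (refl , refl)) (inj₂ (refl , refl)) = inj₁ (refl , refl)

  split-sym : ∀ {a b} → Split a b → Split b a
  split-sym (inj₁ (x , y)) = inj₂ (y , x)
  split-sym (inj₂ (x , y)) = inj₁ (y , x)

  split-det : ∀ {a b c} → Split a b → Split a c → b ≡ c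
  split-det (inj₁ (refl , refl)) (inj₁ (_ , refl))    = refl
  split-det (inj₁ (refl , refl)) (inj₂ (refl , refl)) = refl
  split-det (inj₂ (refl , refl)) (inj₁ (refl , refl)) = refl
  split-det (inj₂ (refl , refl)) (inj₂ (_ , refl))    = refl

  -- The neighbour of suc u that replaces the neighbour v of u.
  data Heir (u v : Vertex H) : Vertex (mSubdivide H p q) → Set where
    new : Split u v → Heir u v zero
    old : ¬ Split u v → Heir u v (suc v)

  heir : ∀ u v → ∃ (Heir u v)
  heir u v with split? u v
  ... | yes s = zero , new s
  ... | no ¬s = suc v , old ¬s

  edge-heir : ∀ e {u v v′} → Joins H e u v → Heir u v v′ → Image (edgeList H) e (suc u) v′
  edge-heir e j (new s)  = half-edge (edgeList H) e (split-edge {lookup (edgeList H) e} j s) j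
  edge-heir e j (old ¬s) = kept-edge (edgeList H) e (λ s → ¬s (edge-split {lookup (edgeList H) e} j s)) j

  adj-heir : ∀ {u v v′} → Adjacent u v → Heir u v v′ → H′.Adjacent (suc u) v′
  adj-heir (e , j) h = let f , _ , k = edge-heir e j h in f , k

  double-heir : ∀ {u v v′} → Double u v → Heir u v v′ → H′.Double (suc u) v′
  double-heir (e , f , e≢f , j , k) h =
    let e′ , p , j′ = edge-heir e j h ; f′ , q , k′ = edge-heir f k h
    in e′ , f′ , (λ eq → e≢f (trans (sym p) (trans (cong (origin (edgeList H)) eq) q))) , j′ , k′

  heir-≢ : ∀ {u v w v′ w′} → v ≢ w → Heir u v v′ → Heir u w w′ → v′ ≢ w′
  heir-≢ v≢w (new s) (new t) refl = v≢w (split-det s t)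
  heir-≢ v≢w (old _) (old _) refl = v≢w refl

  heir-≢suc : ∀ {u v w v′} → v ≢ w → Heir u v v′ → v′ ≢ suc w
  heir-≢suc v≢w (old _) refl = v≢w refl

  self : ∀ {u} → p ≢ q → Heir u u (suc u)
  self p≢q = old λ { (inj₁ (refl , refl)) → p≢q refl ; (inj₂ (refl , refl)) → p≢q refl }

  -- A step along the split multiedge becomes two steps through `zero`. If the deleted vertex `v′`
  -- is `zero` itself, the split pair is `u`, `v`, and a step away from both is never split.
  conn-heir : ∀ {u v v′ a b} → Heir u v v′ → Conn (Away u v) a b → H′.Conn (H′.Away (suc u) v′) (suc a) (suc b)
  conn-heir r = Star.kleisliStar suc (lift r)
    where
    away : ∀ {u v v′ a} → Heir u v v′ → Away u v a → H′.Away (suc u) v′ (suc a)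
    away (new _) (≢u , _)  = (λ { refl → ≢u refl }) , λ ()
    away (old _) (≢u , ≢v) = (λ { refl → ≢u refl }) , λ { refl → ≢v refl }
    zero-away : ∀ {u v v′ a b} → Heir u v v′ → Away u v a → Split a b → v′ ≢ zero
    zero-away (new s) (≢u , ≢v) t refl with s | t
    ... | inj₁ (refl , refl) | inj₁ (refl , _) = ≢u refl
    ... | inj₁ (refl , refl) | inj₂ (refl , _) = ≢v refl
    ... | inj₂ (refl , refl) | inj₁ (refl , _) = ≢v refl
    ... | inj₂ (refl , refl) | inj₂ (refl , _) = ≢u refl
    lift : ∀ {u v v′ a b} → Heir u v v′ → Step (Away u v) a b → H′.Conn (H′.Away (suc u) v′) (suc a) (suc b)
    lift {a = a} {b} r (ab , pa , pb) with heir a b | heir b a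
    ... | _ , new s | _ , new t = (adj-heir ab (new s) , away r pa , z) ◅
                                  (H′.adj-sym (adj-heir (adj-sym ab) (new t)) , z , away r pb) ◅ ε
      where z = (λ ()) , ≢-sym (zero-away r pa s)
    ... | _ , old ¬s | _ = (adj-heir ab (old ¬s) , away r pa , away r pb) ◅ ε
    ... | _ , new s | _ , old ¬t = ⊥-elim (¬t (split-sym s))

  attach : ∀ {u x x′} {P : Vertex (mSubdivide H p q) → Set} → Adjacent u x → Heir u x x′ →
           P x′ → P (suc x) → H′.Conn P x′ (suc x)
  attach ux (old _) _ _ = ε
  attach ux (new s) a b = (H′.adj-sym (adj-heir (adj-sym ux) (new (split-sym s))) , a , b) ◅ ε

  -- If one of the three double edges is split, the path has four of them; the first three are
  -- taken.
  preserved₁ : Bad₁ → H′.Bad₁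
  preserved₁ (a , b , c , d , a≢c , a≢d , b≢d , ab , bc , cd) with split? a b | split? b c | split? c d
  ... | yes s | _ | _ = suc a , zero , suc b , suc c , (λ { refl → a≢b refl }) , (λ { refl → a≢c refl }) , (λ ()) ,
        double-heir ab (new s) , H′.double-sym (double-heir (double-sym ab) (new (split-sym s))) ,
        double-heir bc (old λ t → a≢c (split-det (split-sym s) t))
    where a≢b = adj-≢ (double⇒adj ab)
  ... | no ¬s | yes t | _ = suc a , suc b , zero , suc c , (λ ()) , (λ { refl → a≢c refl }) , (λ { refl → b≢c refl }) ,
        double-heir ab (old ¬s) , double-heir bc (new t) ,
        H′.double-sym (double-heir (double-sym bc) (new (split-sym t)))
    where b≢c = adj-≢ (double⇒adj bc)
  ... | no ¬s | no ¬t | yes r = suc a , suc b , suc c , zero , (λ { refl → a≢c refl }) , (λ ()) , (λ ()) ,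
        double-heir ab (old ¬s) , double-heir bc (old ¬t) , double-heir cd (new r)
  ... | no ¬s | no ¬t | no ¬r = suc a , suc b , suc c , suc d ,
        (λ { refl → a≢c refl }) , (λ { refl → a≢d refl }) , (λ { refl → b≢d refl }) ,
        double-heir ab (old ¬s) , double-heir bc (old ¬t) , double-heir cd (old ¬r)

  module _ {u v : Vertex H} {v′} (r : Heir u v v′) where

    -- An heir is the neighbour itself or the new vertex next to it, so the old walk is prolonged by
    -- at most one step at each end.
    connect : ∀ {x y x′ y′} → Adjacent u x → Adjacent u y → Heir u x x′ → Heir u y y′ →
              x′ ≢ v′ → suc x ≢ v′ → y′ ≢ v′ → suc y ≢ v′ →
              Conn (Away u v) x y → H′.Conn (H′.Away (suc u) v′) x′ y′
    connect ux uy hx hy a b c d x~y =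
      attach ux hx (heir-≢u ux hx , a) ((λ { refl → adj-≢ ux refl }) , b) ◅◅ conn-heir r x~y ◅◅
      H′.conn-sym (attach uy hy (heir-≢u uy hy , c) ((λ { refl → adj-≢ uy refl }) , d))
      where
      heir-≢u : ∀ {x x′} → Adjacent u x → Heir u x x′ → x′ ≢ suc u
      heir-≢u ux h = heir-≢suc (≢-sym (adj-≢ ux)) h

  ≢heir : ∀ {u v w v′} → v ≢ w → Heir u v v′ → suc w ≢ v′
  ≢heir n r = ≢-sym (heir-≢suc n r)

  preserved₂ : Bad₂ → H′.Bad₂
  preserved₂ (u , v , x , y , x≢y , x≢v , y≢v , uv , ux , uy , x~y) with heir u v | heir u x | heir u y
  ... | v′ , hv | x′ , hx | y′ , hy = suc u , v′ , x′ , y′ , heir-≢ x≢y hx hy , heir-≢ x≢v hx hv , heir-≢ y≢v hy hv ,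
        double-heir uv hv , adj-heir ux hx , adj-heir uy hy ,
        connect hv ux uy hx hy (heir-≢ x≢v hx hv) (≢heir (≢-sym x≢v) hv) (heir-≢ y≢v hy hv) (≢heir (≢-sym y≢v) hv) x~y

  module _ (p≢q : p ≢ q) where

    connect-at : ∀ {u x y x′ y′} → Adjacent u x → Adjacent u y → Heir u x x′ → Heir u y y′ →
                 Conn (Away u u) x y → H′.Conn (H′.Away (suc u) (suc u)) x′ y′
    connect-at ux uy hx hy = connect (self p≢q) ux uy hx hy
      (heir-≢suc (≢-sym (adj-≢ ux)) hx) (λ { refl → adj-≢ ux refl })
      (heir-≢suc (≢-sym (adj-≢ uy)) hy) (λ { refl → adj-≢ uy refl })

    preserved₃ : Bad₃ → H′.Bad₃
    preserved₃ (u , a , b , c , d , ab , ac , ad , bc , bd , cd , A , B , C , D , a~b , c~d)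
      with heir u a | heir u b | heir u c | heir u d
    ... | a′ , ha | b′ , hb | c′ , hc | d′ , hd′ = suc u , a′ , b′ , c′ , d′ ,
          heir-≢ ab ha hb , heir-≢ ac ha hc , heir-≢ ad ha hd′ , heir-≢ bc hb hc , heir-≢ bd hb hd′ , heir-≢ cd hc hd′ ,
          adj-heir A ha , adj-heir B hb , adj-heir C hc , adj-heir D hd′ ,
          connect-at A B ha hb a~b , connect-at C D hc hd′ c~d

    preserved₅ : Bad₅ → H′.Bad₅
    preserved₅ (u , a , b , c , ab , ac , bc , A , B , C , a~b , b~c) with heir u a | heir u b | heir u c
    ... | a′ , ha | b′ , hb | c′ , hc = suc u , a′ , b′ , c′ ,
          heir-≢ ab ha hb , heir-≢ ac ha hc , heir-≢ bc hb hc ,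
          adj-heir A ha , adj-heir B hb , adj-heir C hc ,
          connect-at A B ha hb a~b , connect-at B C hb hc b~c

    preserved₄ : Bad₄ → H′.Bad₄
    preserved₄ (x , y , a , b , a≢b , a≢y , b≢x , xy , xa , yb , a~b) with split? x y
    -- The half from `x` to the new vertex takes over as the double edge; `y`, adjacent to the new
    -- vertex, takes over the role of `b`.
    ... | yes s = suc x , zero , suc a , suc y ,
          (λ { refl → a≢y refl }) , (λ ()) , (λ { refl → adj-≢ (double⇒adj xy) refl }) ,
          double-heir xy (new s) , adj-heir xa (old λ t → a≢y (sym (split-det s t))) ,
          H′.adj-sym (adj-heir (adj-sym (double⇒adj xy)) (new (split-sym s))) ,
          conn-heir (new s) a~b ◅◅ (H′.adj-sym (adj-heir yb (old λ t → b≢x (sym (split-det (split-sym s) t)))) ,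
            ((λ { refl → b≢x refl }) , λ ()) , ((λ { refl → adj-≢ (double⇒adj xy) refl }) , λ ())) ◅ ε
    ... | no ¬s with heir x a | heir y b
    ...   | a′ , ha | b′ , hb = suc x , suc y , a′ , b′ , distinct ha hb , heir-≢suc a≢y ha , heir-≢suc b≢x hb ,
          double-heir xy (old ¬s) , adj-heir xa ha , adj-heir yb hb ,
          attach xa ha (heir-≢suc (≢-sym (adj-≢ xa)) ha , heir-≢suc a≢y ha)
                       ((λ { refl → adj-≢ xa refl }) , (λ { refl → a≢y refl }))
          ◅◅ conn-heir (old ¬s) a~b ◅◅
          H′.conn-sym (attach yb hb (heir-≢suc b≢x hb , heir-≢suc (≢-sym (adj-≢ yb)) hb)
                       ((λ { refl → b≢x refl }) , (λ { refl → adj-≢ yb refl })))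
      where
      -- If both heirs were the new vertex, `xa` and `yb` would be the same multiedge.
      distinct : ∀ {a′ b′} → Heir x a a′ → Heir y b b′ → a′ ≢ b′
      distinct (old _) (old _) refl = a≢b refl
      distinct (new s) (new t) refl with s | t
      ... | inj₁ (refl , refl) | inj₁ (refl , _) = adj-≢ (double⇒adj xy) refl
      ... | inj₁ (refl , refl) | inj₂ (refl , _) = a≢y refl
      ... | inj₂ (refl , refl) | inj₁ (refl , _) = a≢y refl
      ... | inj₂ (refl , refl) | inj₂ (refl , _) = adj-≢ (double⇒adj xy) refl

    preserved : Bad → H′.Bad
    preserved (inj₁ b)                      = inj₁ (preserved₁ b)
    preserved (inj₂ (inj₁ b))               = inj₂ (inj₁ (preserved₂ b))
    preserved (inj₂ (inj₂ (inj₁ b)))        = inj₂ (inj₂ (inj₁ (preserved₃ b)))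
    preserved (inj₂ (inj₂ (inj₂ (inj₁ b)))) = inj₂ (inj₂ (inj₂ (inj₁ (preserved₄ b))))
    preserved (inj₂ (inj₂ (inj₂ (inj₂ b)))) = inj₂ (inj₂ (inj₂ (inj₂ (preserved₅ b))))

-- Bad configurations in supergraphs and in the five minors

module _ {K G : Graph} (iso : IsoToSubgraph K G) where
  open IsoToSubgraph iso
  private
    module K = Theory K
    module G = Theory G

  iso-adj : ∀ {a b} → K.Adjacent a b → G.Adjacent (onVertex a) (onVertex b)
  iso-adj (e , j) = onEdge e , incidence j

  iso-double : ∀ {a b} → K.Double a b → G.Double (onVertex a) (onVertex b)
  iso-double (e , f , n , j , k) = onEdge e , onEdge f , n ∘ edgeInjective , incidence j , incidence k

  iso-≢ : ∀ {a b} → a ≢ b → onVertex a ≢ onVertex b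
  iso-≢ n = n ∘ vertexInjective

  iso-conn : ∀ {u v a b} → K.Conn (K.Away u v) a b → G.Conn (G.Away (onVertex u) (onVertex v)) (onVertex a) (onVertex b)
  iso-conn = Star.gmap onVertex λ (j , (p , q) , (r , s)) → iso-adj j , (iso-≢ p , iso-≢ q) , (iso-≢ r , iso-≢ s)

  iso-bad : K.Bad → G.Bad
  iso-bad (inj₁ (a , b , c , d , ac , ad , bd , ab , bc , cd)) =
    inj₁ (_ , _ , _ , _ , iso-≢ ac , iso-≢ ad , iso-≢ bd , iso-double ab , iso-double bc , iso-double cd)
  iso-bad (inj₂ (inj₁ (u , v , x , y , xy , xv , yv , uv , ux , uy , x~y))) =
    inj₂ (inj₁ (_ , _ , _ , _ , iso-≢ xy , iso-≢ xv , iso-≢ yv , iso-double uv , iso-adj ux , iso-adj uy , iso-conn x~y))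
  iso-bad (inj₂ (inj₂ (inj₁ (u , a , b , c , d , ab , ac , ad , bc , bd , cd , A , B , C , D , a~b , c~d)))) =
    inj₂ (inj₂ (inj₁ (_ , _ , _ , _ , _ , iso-≢ ab , iso-≢ ac , iso-≢ ad , iso-≢ bc , iso-≢ bd , iso-≢ cd ,
      iso-adj A , iso-adj B , iso-adj C , iso-adj D , iso-conn a~b , iso-conn c~d)))
  iso-bad (inj₂ (inj₂ (inj₂ (inj₁ (x , y , a , b , ab , ay , bx , xy , xa , yb , a~b))))) =
    inj₂ (inj₂ (inj₂ (inj₁ (_ , _ , _ , _ , iso-≢ ab , iso-≢ ay , iso-≢ bx , iso-double xy , iso-adj xa , iso-adj yb , iso-conn a~b))))
  iso-bad (inj₂ (inj₂ (inj₂ (inj₂ (u , a , b , c , ab , ac , bc , A , B , C , a~b , b~c))))) =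
    inj₂ (inj₂ (inj₂ (inj₂ (_ , _ , _ , _ , iso-≢ ab , iso-≢ ac , iso-≢ bc , iso-adj A , iso-adj B , iso-adj C , iso-conn a~b , iso-conn b~c))))

star-bad : ∀ {H K} → Star _⟶ᵐ_ H K → Theory.Bad H → Theory.Bad K
star-bad ε b = b
star-bad {H} (subdivide x y xy ◅ st) b = star-bad st (Subdivision.preserved H x y (Theory.adj-≢ H xy) b)

minor-bad : ∀ {H G} → H IsMTopologicalMinorOf G → Theory.Bad H → Theory.Bad G
minor-bad (K , st , iso) b = iso-bad iso (star-bad st b)

pattern ⟨_⟩₁ e = e , inj₁ (refl , refl)
pattern ⟨_⟩₂ e = e , inj₂ (refl , refl)

bad-M₁ : Theory.Bad M₁
bad-M₁ = inj₁ (# 0 , # 1 , # 2 , # 3 , (λ ()) , (λ ()) , (λ ()) , double (# 0) (# 1) (λ ()) , double (# 2) (# 3) (λ ()) , double (# 4) (# 5) (λ ()))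
  where
  double : ∀ {a b} e f → e ≢ f → {_ : True (Theory.joins? M₁ e a b)} {_ : True (Theory.joins? M₁ f a b)} → Theory.Double M₁ a b
  double e f n {p} {q} = e , f , n , toWitness p , toWitness q

bad-M₂ : Theory.Bad M₂
bad-M₂ = inj₂ (inj₁ (# 0 , # 3 , # 1 , # 2 , (λ ()) , (λ ()) , (λ ()) ,
  (# 3 , # 4 , (λ ()) , inj₁ (refl , refl) , inj₁ (refl , refl)) , ⟨ # 0 ⟩₁ , ⟨ # 2 ⟩₂ ,
  (⟨ # 1 ⟩₁ , ((λ ()) , λ ()) , ((λ ()) , λ ())) ◅ ε))

bad-M₃ : Theory.Bad M₃
bad-M₃ = inj₂ (inj₂ (inj₁ (# 0 , # 1 , # 2 , # 3 , # 4 , (λ ()) , (λ ()) , (λ ()) , (λ ()) , (λ ()) , (λ ()) ,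
  ⟨ # 0 ⟩₁ , ⟨ # 2 ⟩₂ , ⟨ # 3 ⟩₁ , ⟨ # 5 ⟩₂ ,
  (⟨ # 1 ⟩₁ , ((λ ()) , λ ()) , ((λ ()) , λ ())) ◅ ε , (⟨ # 4 ⟩₁ , ((λ ()) , λ ()) , ((λ ()) , λ ())) ◅ ε)))

bad-M₄ : Theory.Bad M₄
bad-M₄ = inj₂ (inj₂ (inj₂ (inj₁ (# 0 , # 1 , # 3 , # 2 , (λ ()) , (λ ()) , (λ ()) ,
  (# 0 , # 1 , (λ ()) , inj₁ (refl , refl) , inj₁ (refl , refl)) , ⟨ # 4 ⟩₂ , ⟨ # 2 ⟩₁ ,
  (⟨ # 3 ⟩₂ , ((λ ()) , λ ()) , ((λ ()) , λ ())) ◅ ε))))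

bad-M₅ : Theory.Bad M₅
bad-M₅ = inj₂ (inj₂ (inj₂ (inj₂ (# 0 , # 1 , # 2 , # 3 , (λ ()) , (λ ()) , (λ ()) ,
  ⟨ # 0 ⟩₁ , ⟨ # 4 ⟩₁ , ⟨ # 3 ⟩₂ ,
  (⟨ # 1 ⟩₁ , ((λ ()) , λ ()) , ((λ ()) , λ ())) ◅ ε , (⟨ # 2 ⟩₁ , ((λ ()) , λ ()) , ((λ ()) , λ ())) ◅ ε))))

¬bad⇒no-minors : ∀ {G} → ¬ Theory.Bad G → All (λ M → ¬ (M IsMTopologicalMinorOf G)) (M₁ ∷ M₂ ∷ M₃ ∷ M₄ ∷ M₅ ∷ [])
¬bad⇒no-minors ¬b = (λ m → ¬b (minor-bad m bad-M₁)) ∷ (λ m → ¬b (minor-bad m bad-M₂)) ∷ (λ m → ¬b (minor-bad m bad-M₃))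
  ∷ (λ m → ¬b (minor-bad m bad-M₄)) ∷ (λ m → ¬b (minor-bad m bad-M₅)) ∷ []

-- Polynomials bounding times and sizes

infixl 6 _⊕_
infixl 7 _⊗_

data Poly : Set where
  X       : Poly
  con     : ℕ → Poly
  _⊕_ _⊗_ : Poly → Poly → Poly

⟪_⟫ : Poly → ℕ → ℕ
⟪ X ⟫     n = n
⟪ con c ⟫ n = c
⟪ p ⊕ q ⟫ n = ⟪ p ⟫ n + ⟪ q ⟫ n
⟪ p ⊗ q ⟫ n = ⟪ p ⟫ n * ⟪ q ⟫ n

poly-mono : ∀ p {m n} → m ≤ n → ⟪ p ⟫ m ≤ ⟪ p ⟫ n
poly-mono X       m≤n = m≤n
poly-mono (con c) m≤n = ≤-refl
poly-mono (p ⊕ q) m≤n = +-mono-≤ (poly-mono p m≤n) (poly-mono q m≤n)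
poly-mono (p ⊗ q) m≤n = *-mono-≤ (poly-mono p m≤n) (poly-mono q m≤n)

_⊙_ : Poly → Poly → Poly
X       ⊙ r = r
con c   ⊙ r = con c
(p ⊕ q) ⊙ r = (p ⊙ r) ⊕ (q ⊙ r)
(p ⊗ q) ⊙ r = (p ⊙ r) ⊗ (q ⊙ r)

⊙-correct : ∀ p r n → ⟪ p ⊙ r ⟫ n ≡ ⟪ p ⟫ (⟪ r ⟫ n)
⊙-correct X       r n = refl
⊙-correct (con c) r n = refl
⊙-correct (p ⊕ q) r n = cong₂ _+_ (⊙-correct p r n) (⊙-correct q r n)
⊙-correct (p ⊗ q) r n = cong₂ _*_ (⊙-correct p r n) (⊙-correct q r n)

poly-⊙ : ∀ p r {m} n → m ≤ ⟪ r ⟫ n → ⟪ p ⟫ m ≤ ⟪ p ⊙ r ⟫ n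
poly-⊙ p r n m≤ = ≤-trans (poly-mono p m≤) (≤-reflexive (sym (⊙-correct p r n)))

-- Degrees are added even for a sum: for `1 ≤ n` a larger exponent only increases the bound.
monomial-bound : ∀ p → ∃[ b ] ∃[ d ] (∀ n → 1 ≤ n → ⟪ p ⟫ n ≤ b * n ^ d)
monomial-bound X       = 1 , 1 , λ n _ → ≤-reflexive (sym (trans (ℕ.*-identityˡ (n ^ 1)) (ℕ.^-identityʳ n)))
monomial-bound (con c) = c , 0 , λ n _ → ≤-reflexive (sym (ℕ.*-identityʳ c))
monomial-bound (p ⊕ q) with monomial-bound p | monomial-bound q
... | b , d , f | c , e , g = b + c , d + e , λ n 1≤n → ≤-trans
  (+-mono-≤ (≤-trans (f n 1≤n) (ℕ.*-monoʳ-≤ b (grow n 1≤n (m≤m+n d e))))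
            (≤-trans (g n 1≤n) (ℕ.*-monoʳ-≤ c (grow n 1≤n (m≤n+m e d)))))
  (≤-reflexive (sym (ℕ.*-distribʳ-+ (n ^ (d + e)) b c)))
  where
  grow : ∀ n → 1 ≤ n → ∀ {i j} → i ≤ j → n ^ i ≤ n ^ j
  grow (suc n) _ = ℕ.^-monoʳ-≤ (suc n)
monomial-bound (p ⊗ q) with monomial-bound p | monomial-bound q
... | b , d , f | c , e , g = b * c , d + e , λ n 1≤n → ≤-trans (*-mono-≤ (f n 1≤n) (g n 1≤n))
  (≤-reflexive (trans (ℕ.[m*n]*[o*p]≡[m*o]*[n*p] b (n ^ d) c (n ^ e))
                      (cong (b * c *_) (sym (ℕ.^-distribˡ-+-* n d e)))))

-- Polynomial-time functions on trees

size≥1 : ∀ t → 1 ≤ size t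
size≥1 nil     = s≤s z≤n
size≥1 (_ ∙ _) = s≤s z≤n

left≤ : ∀ t → size (left t) ≤ size t
left≤ nil     = ≤-refl
left≤ (l ∙ r) = ≤-trans (m≤m+n (size l) (size r)) (n≤1+n _)

right≤ : ∀ t → size (right t) ≤ size t
right≤ nil     = ≤-refl
right≤ (l ∙ r) = ≤-trans (m≤n+m (size r) (size l)) (n≤1+n _)

⟨_⟩ : Tree → Store 1
⟨ t ⟩ = t Vec.∷ Vec.[]

select : Bool → Tree → Tree → Tree
select true  a b = a
select false a b = b

-- A program for a function keeps its argument on top of a stack, all in
-- variable 0, and replaces it by the result.
record PT : Set where
  field
    fun     : Tree → Tree
    prog    : Cmd 1
    timeP   : Poly
    sizeP   : Poly
    run     : ∀ x s → ∃[ t ] prog ⊢ ⟨ x ∙ s ⟩ ⇓[ t ] ⟨ fun x ∙ s ⟩ × t ≤ ⟪ timeP ⟫ (size x)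
    bounded : ∀ x → size (fun x) ≤ ⟪ sizeP ⟫ (size x)
open PT

v₀ : Expr 1
v₀ = var zero

set : Expr 1 → Cmd 1
set e = zero := e

-- Redirects an expression about the bare argument to the top of the stack.
onTop : Expr 1 → Expr 1
onTop (var zero)   = hd v₀
onTop nil        = nil
onTop (cons a b) = cons (onTop a) (onTop b)
onTop (hd a)     = hd (onTop a)
onTop (tl a)     = tl (onTop a)

eval-onTop : ∀ e x s → eval (onTop e) ⟨ x ∙ s ⟩ ≡ eval e ⟨ x ⟩
eval-onTop (var zero) x s = refl
eval-onTop nil        x s = refl
eval-onTop (cons a b) x s = cong₂ _∙_ (eval-onTop a x s) (eval-onTop b x s)
eval-onTop (hd a)     x s = cong left (eval-onTop a x s)
eval-onTop (tl a)     x s = cong right (eval-onTop a x s)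

exprSize : Expr 1 → Poly
exprSize (var _)    = X
exprSize nil        = con 1
exprSize (cons a b) = con 1 ⊕ (exprSize a ⊕ exprSize b)
exprSize (hd a)     = exprSize a
exprSize (tl a)     = exprSize a

exprSize-correct : ∀ e x → size (eval e ⟨ x ⟩) ≤ ⟪ exprSize e ⟫ (size x)
exprSize-correct (var zero) x = ≤-refl
exprSize-correct nil        x = ≤-refl
exprSize-correct (cons a b) x = s≤s (+-mono-≤ (exprSize-correct a x) (exprSize-correct b x))
exprSize-correct (hd a)     x = ≤-trans (left≤ (eval a ⟨ x ⟩)) (exprSize-correct a x)
exprSize-correct (tl a)     x = ≤-trans (right≤ (eval a ⟨ x ⟩)) (exprSize-correct a x)

expr : Expr 1 → PT
expr e = record
  { fun = λ x → eval e ⟨ x ⟩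
  ; prog = set (cons (onTop e) (tl v₀))
  ; timeP = con (suc (cost (cons (onTop e) (tl v₀))))
  ; sizeP = exprSize e
  ; run = λ x s → _ , subst (λ y → set _ ⊢ ⟨ x ∙ s ⟩ ⇓[ _ ] ⟨ y ∙ s ⟩) (eval-onTop e x s) assign , ≤-refl
  ; bounded = exprSize-correct e }

infixr 9 _∘ₚ_
_∘ₚ_ : PT → PT → PT
f ∘ₚ g = record
  { fun = λ x → fun f (fun g x)
  ; prog = prog g ⨾ prog f
  ; timeP = timeP g ⊕ (timeP f ⊙ sizeP g)
  ; sizeP = sizeP f ⊙ sizeP g
  ; run = λ x s →
      let t , G , t≤ = run g x s ; u , F , u≤ = run f (fun g x) s
      in t + u , seq G F , +-mono-≤ t≤ (≤-trans u≤ (poly-⊙ (timeP f) (sizeP g) (size x) (bounded g x)))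
  ; bounded = λ x → ≤-trans (bounded f (fun g x)) (poly-⊙ (sizeP f) (sizeP g) (size x) (bounded g x)) }

push : Cmd 1
push = set (cons (hd v₀) v₀)

-- The argument is duplicated and, after the first run, exchanged with the first result so that `g`
-- finds it on top. The constant 5 is the time of `push`.
pairₚ : PT → PT → PT
pairₚ f g = record
  { fun = λ x → fun f x ∙ fun g x
  ; prog = push ⨾ (prog f ⨾ (set swap ⨾ (prog g ⨾ set join)))
  ; timeP = con 5 ⊕ (timeP f ⊕ (con (suc (cost swap)) ⊕ (timeP g ⊕ con (suc (cost join)))))
  ; sizeP = con 1 ⊕ (sizeP f ⊕ sizeP g)
  ; run = λ x s →
      let t , F , t≤ = run f x (x ∙ s) ; u , G , u≤ = run g x (fun f x ∙ s)
      in _ , seq assign (seq F (seq assign (seq G assign))) ,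
         +-monoʳ-≤ 5 (+-mono-≤ t≤ (+-monoʳ-≤ (suc (cost swap)) (+-monoˡ-≤ (suc (cost join)) u≤)))
  ; bounded = λ x → s≤s (+-mono-≤ (bounded f x) (bounded g x)) }
  where
  swap = cons (hd (tl v₀)) (cons (hd v₀) (tl (tl v₀)))
  join = cons (cons (hd (tl v₀)) (hd v₀)) (tl (tl v₀))

-- The bounds charge both branches, as `Poly` has no maximum. The constants are 5 for `push`, 3 for
-- the test and 3 for popping the condition.
ifₚ : PT → PT → PT → PT
ifₚ c f g = record
  { fun = λ x → select (truth (fun c x)) (fun f x) (fun g x)
  ; prog = push ⨾ (prog c ⨾ (if hd v₀ then (set (tl v₀) ⨾ prog f) else (set (tl v₀) ⨾ prog g)))
  ; timeP = con 5 ⊕ (timeP c ⊕ (con 3 ⊕ (con 3 ⊕ (timeP f ⊕ timeP g))))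
  ; sizeP = sizeP f ⊕ sizeP g
  ; run = go
  ; bounded = λ x → bound (truth (fun c x)) x }
  where
  bound : ∀ b x → size (select b (fun f x) (fun g x)) ≤ ⟪ sizeP f ⊕ sizeP g ⟫ (size x)
  bound true  x = ≤-trans (bounded f x) (m≤m+n _ _)
  bound false x = ≤-trans (bounded g x) (m≤n+m _ _)
  go : ∀ x s → ∃[ t ] (push ⨾ (prog c ⨾ (if hd v₀ then (set (tl v₀) ⨾ prog f) else (set (tl v₀) ⨾ prog g))))
         ⊢ ⟨ x ∙ s ⟩ ⇓[ t ] ⟨ select (truth (fun c x)) (fun f x) (fun g x) ∙ s ⟩
         × t ≤ ⟪ con 5 ⊕ (timeP c ⊕ (con 3 ⊕ (con 3 ⊕ (timeP f ⊕ timeP g)))) ⟫ (size x)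
  go x s with run c x (x ∙ s) | truth (fun c x) in eq
  ... | t , C , t≤ | true = let u , F , u≤ = run f x s in
    _ , seq assign (seq C (ifT eq (seq assign F))) ,
    +-monoʳ-≤ 5 (+-mono-≤ t≤ (+-monoʳ-≤ 3 (+-monoʳ-≤ 3 (≤-trans u≤ (m≤m+n _ _)))))
  ... | t , C , t≤ | false = let u , G , u≤ = run g x s in
    _ , seq assign (seq C (ifF eq (seq assign G))) ,
    +-monoʳ-≤ 5 (+-mono-≤ t≤ (+-monoʳ-≤ 3 (+-monoʳ-≤ 3 (≤-trans u≤ (m≤n+m _ _)))))

-- foldₚ traverses a list l with a fixed environment e and an accumulator a; the
-- step sees all of the remaining list.  Additive growth of the accumulator
-- keeps the iteration polynomial.
module Fold (step : PT) (growth : Poly)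
            (grows : ∀ l e a → size (fun step (l ∙ (e ∙ a))) ≤ size a + ⟪ growth ⟫ (size l + size e)) where

  go : Tree → Tree → Tree → Tree
  go nil     e a = a
  go (h ∙ t) e a = go t e (fun step ((h ∙ t) ∙ (e ∙ a)))

  go-size : ∀ l e a {N} → size l + size e ≤ N → size (go l e a) ≤ size a + size l * ⟪ growth ⟫ N
  go-size nil     e a ≤N = m≤m+n _ _
  go-size (h ∙ t) e a {N} ≤N = begin
    size (go t e a′)                                    ≤⟨ go-size t e a′ (≤-trans (+-monoˡ-≤ (size e) (right≤ (h ∙ t))) ≤N) ⟩
    size a′ + size t * ⟪ growth ⟫ N                     ≤⟨ +-monoˡ-≤ _ (≤-trans (grows (h ∙ t) e a) (+-monoʳ-≤ (size a) (poly-mono growth ≤N))) ⟩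
    size a + ⟪ growth ⟫ N + size t * ⟪ growth ⟫ N       ≡⟨ ℕ.+-assoc (size a) _ _ ⟩
    size a + suc (size t) * ⟪ growth ⟫ N                ≤⟨ +-monoʳ-≤ (size a) (ℕ.*-monoˡ-≤ (⟪ growth ⟫ N) (s≤s (m≤n+m (size t) (size h)))) ⟩
    size a + size (h ∙ t) * ⟪ growth ⟫ N                ∎
    where
    open ℕ.≤-Reasoning
    a′ = fun step ((h ∙ t) ∙ (e ∙ a))

  -- The function of a fold is total on trees, so `norm` forces any argument into the shape of list,
  -- environment and accumulator; missing parts read as `nil`. `back` drops the first list element
  -- and installs the new accumulator.
  top rest back norm : Expr 1
  top  = hd (tl v₀)
  rest = tl (tl v₀)
  back = cons (cons (tl (hd top)) (cons (hd (tl top)) (hd v₀))) rest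
  norm = cons (cons (hd (hd v₀)) (cons (hd (tl (hd v₀))) (tl (tl (hd v₀))))) (tl v₀)

  body loop : Cmd 1
  body = push ⨾ (prog step ⨾ set back)
  loop = while hd (hd v₀) loop body

  -- Time of an iteration on states of size at most `M`: 4 for the guard, 5 for `push`, then the
  -- step and `back`.
  round : ℕ → ℕ
  round M = 4 + (5 + (⟪ timeP step ⟫ M + suc (cost back)))

  -- `N` bounds list plus environment, and `M` bounds every state of the loop, with all future
  -- growth of the accumulator included; the 2 counts the two pairing nodes of a state. Both stay
  -- fixed, so all iterations are charged alike.
  loop-run : ∀ l e a s {N M} → size l + size e ≤ N → 2 + (N + (size a + size l * ⟪ growth ⟫ N)) ≤ M →
             ∃[ t ] loop ⊢ ⟨ (l ∙ (e ∙ a)) ∙ s ⟩ ⇓[ t ] ⟨ (nil ∙ (e ∙ go l e a)) ∙ s ⟩ × t ≤ size l * round M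
  loop-run nil e a s _ _ = 4 , whileF refl , s≤s (s≤s (s≤s (s≤s z≤n)))
  loop-run (h ∙ t) e a s {N} {M} ≤N ≤M =
    let x = (h ∙ t) ∙ (e ∙ a)
        a′ = fun step x
        u , S , u≤ = run step x (x ∙ s)
        x≤ : size x ≤ M
        x≤ = ≤-trans (≤-reflexive (cong suc (ℕ.+-suc (size (h ∙ t)) _)))
               (≤-trans (s≤s (s≤s (≤-trans (≤-reflexive (sym (ℕ.+-assoc (size (h ∙ t)) (size e) (size a))))
                 (+-mono-≤ ≤N (m≤m+n (size a) _))))) ≤M)
        a′≤ : size a′ + size t * ⟪ growth ⟫ N ≤ size a + size (h ∙ t) * ⟪ growth ⟫ N
        a′≤ = ≤-trans (+-monoˡ-≤ _ (≤-trans (grows (h ∙ t) e a) (+-monoʳ-≤ (size a) (poly-mono growth ≤N))))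
                (≤-trans (≤-reflexive (ℕ.+-assoc (size a) _ _))
                  (+-monoʳ-≤ (size a) (ℕ.*-monoˡ-≤ (⟪ growth ⟫ N) (s≤s (m≤n+m (size t) (size h))))))
        w , W , w≤ = loop-run t e a′ s (≤-trans (+-monoˡ-≤ (size e) (right≤ (h ∙ t))) ≤N)
                       (≤-trans (+-monoʳ-≤ 2 (+-monoʳ-≤ N a′≤)) ≤M)
    in _ , whileT refl (seq assign (seq S assign)) W ,
       ≤-trans (+-mono-≤ (+-monoʳ-≤ 4 (+-monoʳ-≤ 5 (+-monoˡ-≤ (suc (cost back)) (≤-trans u≤ (poly-mono (timeP step) x≤))))) w≤)
         (ℕ.*-monoˡ-≤ (round M) (s≤s (m≤n+m (size t) (size h))))

  N₀ A₀ M₀ : Poly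
  N₀ = X ⊕ X
  A₀ = X ⊕ X ⊗ (growth ⊙ N₀)
  M₀ = con 2 ⊕ (N₀ ⊕ A₀)

  module _ (x : Tree) where

    private
      l = left x
      e = left (right x)
      a = right (right x)

    l≤ : size l ≤ size x
    l≤ = left≤ x

    e≤ : size e ≤ size x
    e≤ = ≤-trans (left≤ (right x)) (right≤ x)

    a≤ : size a ≤ size x
    a≤ = ≤-trans (right≤ (right x)) (right≤ x)

    ≤N₀ : size l + size e ≤ ⟪ N₀ ⟫ (size x)
    ≤N₀ = +-mono-≤ l≤ e≤

    ≤A₀ : size a + size l * ⟪ growth ⟫ (⟪ N₀ ⟫ (size x)) ≤ ⟪ A₀ ⟫ (size x)
    ≤A₀ = +-mono-≤ a≤ (*-mono-≤ l≤ (≤-reflexive (sym (⊙-correct growth N₀ (size x)))))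

    fold-size : size (go l e a) ≤ ⟪ A₀ ⟫ (size x)
    fold-size = ≤-trans (go-size l e a ≤N₀) ≤A₀

    fold-run : ∀ s → ∃[ t ] (set norm ⨾ (loop ⨾ set (cons (tl (tl (hd v₀))) (tl v₀)))) ⊢ ⟨ x ∙ s ⟩ ⇓[ t ] ⟨ go l e a ∙ s ⟩
               × t ≤ suc (cost norm) + (size x * round (⟪ M₀ ⟫ (size x)) + 8)
    fold-run s =
      let t , W , t≤ = loop-run l e a s {M = ⟪ M₀ ⟫ (size x)} ≤N₀ (+-monoʳ-≤ 2 (+-monoʳ-≤ (⟪ N₀ ⟫ (size x)) ≤A₀))
      in _ , seq assign (seq W assign) ,
         +-monoʳ-≤ (suc (cost norm)) (+-monoˡ-≤ 8 (≤-trans t≤ (ℕ.*-monoˡ-≤ (round (⟪ M₀ ⟫ (size x))) l≤)))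

  foldₚ : PT
  foldₚ = record
    { fun = λ x → go (left x) (left (right x)) (right (right x))
    ; prog = set norm ⨾ (loop ⨾ set (cons (tl (tl (hd v₀))) (tl v₀)))
    ; timeP = con (suc (cost norm)) ⊕ (X ⊗ (con 4 ⊕ (con 5 ⊕ ((timeP step ⊙ M₀) ⊕ con (suc (cost back))))) ⊕ con 8)
    ; sizeP = A₀
    ; run = λ x s → let t , R , t≤ = fold-run x s in t , R , ≤-trans t≤ (+-monoʳ-≤ (suc (cost norm)) (+-monoˡ-≤ 8
        (ℕ.*-monoʳ-≤ (size x) (+-monoʳ-≤ 4 (+-monoʳ-≤ 5 (+-monoˡ-≤ (suc (cost back))
          (≤-reflexive (sym (⊙-correct (timeP step) M₀ (size x))))))))))
    ; bounded = fold-size }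

-- The input is placed on an empty stack in time 4 and the result popped in time 3.
poly-time : ∀ {A : Set} (encode : A → Tree) (Q : A → Set) (f : PT) →
            (∀ x → truth (fun f (encode x)) ≡ true ⇔ Q x) → PolyTimeDecidable encode Q
poly-time encode Q f correct =
  0 , set (cons v₀ nil) ⨾ (prog f ⨾ set (hd v₀)) , b , d , λ x →
    let t , F , t≤ = run f (encode x) nil
    in _ , _ , seq assign (seq F assign) ,
       ≤-trans (≤-trans (+-monoʳ-≤ 4 (+-monoˡ-≤ 3 t≤)) (bound (size (encode x)) (size≥1 (encode x)))) (m≤m+n _ b) ,
       correct x
  where
  monomial = monomial-bound (con 4 ⊕ (timeP f ⊕ con 3))
  b = proj₁ monomial
  d = proj₁ (proj₂ monomial)
  bound = proj₂ (proj₂ monomial)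

-- Boolean combinations of tests

open PT using (fun)
open Equivalence using (to; from)

Holds : Tree → Set
Holds t = truth t ≡ true

¬holds : ∀ {t} → truth t ≡ false → ¬ Holds t
¬holds p q with trans (sym p) q
... | ()

one : Expr 1
one = cons nil nil

trueₚ falseₚ : PT
trueₚ  = expr one
falseₚ = expr nil

notₚ : PT → PT
notₚ f = ifₚ f falseₚ trueₚ

andₚ orₚ : PT → PT → PT
andₚ f g = ifₚ f g falseₚ
orₚ f g  = ifₚ f trueₚ g

not-true : ∀ {A : Set} b → b ≡ true ⇔ A → Holds (select b nil (nil ∙ nil)) ⇔ (¬ A)
not-true true  F = mk⇔ (λ ()) λ ¬a → ⊥-elim (¬a (to F refl))
not-true false F = mk⇔ (λ _ a → case from F a of λ ()) λ _ → refl

and-true : ∀ {A B : Set} b {t} → b ≡ true ⇔ A → Holds t ⇔ B → Holds (select b t nil) ⇔ (A × B)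
and-true true  F G = mk⇔ (λ q → to F refl , to G q) (from G ∘ proj₂)
and-true false F G = mk⇔ (λ ()) λ (a , _) → case from F a of λ ()

or-true : ∀ {A B : Set} b {t} → b ≡ true ⇔ A → Holds t ⇔ B → Holds (select b (nil ∙ nil) t) ⇔ (A ⊎ B)
or-true true  F G = mk⇔ (λ _ → inj₁ (to F refl)) λ _ → refl
or-true false F G = mk⇔ (inj₂ ∘ to G) [ (λ a → case from F a of λ ()) , from G ]′

not-holds : ∀ f x {A : Set} → Holds (fun f x) ⇔ A → Holds (fun (notₚ f) x) ⇔ (¬ A)
not-holds f x = not-true (truth (fun f x))

and-holds : ∀ f g x {A B : Set} → Holds (fun f x) ⇔ A → Holds (fun g x) ⇔ B → Holds (fun (andₚ f g) x) ⇔ (A × B)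
and-holds f g x = and-true (truth (fun f x))

or-holds : ∀ f g x {A B : Set} → Holds (fun f x) ⇔ A → Holds (fun g x) ⇔ B → Holds (fun (orₚ f g) x) ⇔ (A ⊎ B)
or-holds f g x = or-true (truth (fun f x))

-- Unary numbers

opaque

  -- Folding over the second number removes one layer of the first per layer; the tail of `nil` is
  -- `nil`, which makes the subtraction truncated.
  monusₚ : PT
  monusₚ = Fold.foldₚ (expr (tl (tl (tl v₀)))) (con 0) (λ l e a → ≤-trans (right≤ a) (m≤m+n _ _))
    ∘ₚ expr (cons (tl v₀) (cons nil (hd v₀)))

  fun-monus : ∀ m n → fun monusₚ (encodeℕ m ∙ encodeℕ n) ≡ encodeℕ (m ∸ n)
  fun-monus m       zero    = refl
  fun-monus zero    (suc n) = trans (fun-monus zero n) (cong encodeℕ (ℕ.0∸n≡0 n))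
  fun-monus (suc m) (suc n) = fun-monus m n

holds-encodeℕ : ∀ n → Holds (encodeℕ n) ⇔ 0 < n
holds-encodeℕ zero    = mk⇔ (λ ()) λ ()
holds-encodeℕ (suc n) = mk⇔ (λ _ → s≤s z≤n) λ _ → refl

swapₚ : PT
swapₚ = expr (cons (tl v₀) (hd v₀))

opaque

  -- The machine has no equality test; unary numbers agree when both truncated differences vanish.
  eqₚ : PT
  eqₚ = notₚ (orₚ monusₚ (monusₚ ∘ₚ swapₚ))

  eq-holds : ∀ m n → Holds (fun eqₚ (encodeℕ m ∙ encodeℕ n)) ⇔ m ≡ n
  eq-holds m n = mk⇔
    (λ h → let no-gap = to differ h in ℕ.≤-antisym
        (ℕ.m∸n≡0⇒m≤n (gap (no-gap ∘ inj₁))) (ℕ.m∸n≡0⇒m≤n (gap (no-gap ∘ inj₂))))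
    (λ { refl → from differ [ (λ p → <-irrefl (sym (ℕ.n∸n≡0 m)) p) , (λ p → <-irrefl (sym (ℕ.n∸n≡0 m)) p) ]′ })
    where
    gap : ∀ {k} → ¬ 0 < k → k ≡ 0
    gap {zero}  _ = refl
    gap {suc k} p = ⊥-elim (p (s≤s z≤n))
    positive-gap : ∀ i j → Holds (fun monusₚ (encodeℕ i ∙ encodeℕ j)) ⇔ 0 < i ∸ j
    positive-gap i j = subst (λ t → Holds t ⇔ 0 < i ∸ j) (sym (fun-monus i j)) (holds-encodeℕ (i ∸ j))
    differ : Holds (fun eqₚ (encodeℕ m ∙ encodeℕ n)) ⇔ (¬ (0 < m ∸ n ⊎ 0 < n ∸ m))
    differ = not-holds (orₚ monusₚ (monusₚ ∘ₚ swapₚ)) (encodeℕ m ∙ encodeℕ n)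
      (or-holds monusₚ (monusₚ ∘ₚ swapₚ) (encodeℕ m ∙ encodeℕ n) (positive-gap m n) (positive-gap n m))

eqOf : Expr 1 → Expr 1 → PT
eqOf a b = eqₚ ∘ₚ expr (cons a b)

encodeV : ∀ {n} → Fin n → Tree
encodeV v = encodeℕ (toℕ v)

encodeE : ∀ {n} → Fin n × Fin n → Tree
encodeE (u , v) = encodeV u ∙ encodeV v

eqV : ∀ {n} (u v : Fin n) → Holds (fun eqₚ (encodeV u ∙ encodeV v)) ⇔ u ≡ v
eqV u v = mk⇔ (toℕ-injective ∘ to (eq-holds _ _)) (from (eq-holds _ _) ∘ cong toℕ)

-- In the step of a fold: the current element, the environment, the accumulator.
cur env acc : Expr 1
cur = hd (hd v₀)
env = hd (tl v₀)
acc = tl (tl v₀)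

select-size : ∀ b {s t n} → size s ≤ n → size t ≤ n → size (select b s t) ≤ n
select-size true  p q = p
select-size false p q = q

some-grows : ∀ b a n → size (select b (nil ∙ nil) a) ≤ size a + (3 + n)
some-grows b a n = select-size b (≤-trans (m≤m+n 3 n) (m≤n+m _ (size a))) (m≤m+n _ _)

-- Multiplicities

module _ {n} (x y : Fin n) where

  multiplicity : List (Fin n × Fin n) → ℕ
  multiplicity []       = 0
  multiplicity (p ∷ es) with joinsPair? p x y
  ... | yes _ = suc (multiplicity es)
  ... | no  _ = multiplicity es

opaque

  joinsₚ : PT
  joinsₚ = orₚ (andₚ (eqOf (hd cur) (hd env)) (eqOf (tl cur) (tl env)))
               (andₚ (eqOf (hd cur) (tl env)) (eqOf (tl cur) (hd env)))

  joins-holds : ∀ {n} (p : Fin n × Fin n) (x y : Fin n) r a →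
                Holds (fun joinsₚ ((encodeE p ∙ r) ∙ ((encodeV x ∙ encodeV y) ∙ a))) ⇔ JoinsPair p x y
  joins-holds (u , v) x y r a =
    or-holds (andₚ (eqOf (hd cur) (hd env)) (eqOf (tl cur) (tl env))) (andₚ (eqOf (hd cur) (tl env)) (eqOf (tl cur) (hd env))) t
      (and-holds (eqOf (hd cur) (hd env)) (eqOf (tl cur) (tl env)) t (eqV u x) (eqV v y))
      (and-holds (eqOf (hd cur) (tl env)) (eqOf (tl cur) (hd env)) t (eqV u y) (eqV v x))
    where
    t : Tree
    t = (encodeE (u , v) ∙ r) ∙ ((encodeV x ∙ encodeV y) ∙ a)

opaque

  countStep : PT
  countStep = ifₚ joinsₚ (expr (cons nil acc)) (expr acc)

  count-grows : ∀ l e a → size (fun countStep (l ∙ (e ∙ a))) ≤ size a + 2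
  count-grows l e a = select-size (truth (fun joinsₚ (l ∙ (e ∙ a)))) (≤-reflexive (ℕ.+-comm 2 (size a))) (m≤m+n _ _)

module Count = Fold countStep (con 2) count-grows

opaque
  unfolding countStep

  countₚ : PT
  countₚ = Count.foldₚ

  fun-count : ∀ {n} (x y : Fin n) es k → fun countₚ (encodeList encodeE es ∙ ((encodeV x ∙ encodeV y) ∙ encodeℕ k))
              ≡ encodeℕ (multiplicity x y es + k)
  fun-count x y [] k = refl
  fun-count x y (p ∷ es) k with truth (fun joinsₚ ((encodeE p ∙ encodeList encodeE es) ∙ ((encodeV x ∙ encodeV y) ∙ encodeℕ k))) in h | joinsPair? p x y
  ... | true | yes _ = trans (fun-count x y es (suc k)) (cong encodeℕ (ℕ.+-suc (multiplicity x y es) k))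
  ... | false | no  _ = fun-count x y es k
  ... | true | no ¬j = ⊥-elim (¬j (to (joins-holds p x y (encodeList encodeE es) (encodeℕ k)) h))
  ... | false | yes j = ⊥-elim (¬holds h (from (joins-holds p x y (encodeList encodeE es) (encodeℕ k)) j))

module _ {n} (x y : Fin n) where

  multiplicity>0 : ∀ es → 0 < multiplicity x y es ⇔ (∃[ e ] JoinsPair (lookup es e) x y)
  multiplicity>0 [] = mk⇔ (λ ()) λ ()
  multiplicity>0 (p ∷ es) with joinsPair? p x y
  ... | yes j = mk⇔ (λ _ → zero , j) λ _ → s≤s z≤n
  ... | no ¬j = mk⇔ (λ h → let e , k = to (multiplicity>0 es) h in suc e , k)
                    λ { (zero , j) → ⊥-elim (¬j j) ; (suc e , j) → from (multiplicity>0 es) (e , j) }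

  Twice : List (Fin n × Fin n) → Set
  Twice es = ∃[ e ] ∃[ f ] e ≢ f × JoinsPair (lookup es e) x y × JoinsPair (lookup es f) x y

  multiplicity>1 : ∀ es → 1 < multiplicity x y es ⇔ Twice es
  multiplicity>1 [] = mk⇔ (λ ()) λ ()
  multiplicity>1 (p ∷ es) with joinsPair? p x y
  ... | yes j = mk⇔ (λ { (s≤s h) → let e , k = to (multiplicity>0 es) h in zero , suc e , (λ ()) , j , k })
                    λ { (zero , zero , n , _) → ⊥-elim (n refl)
                      ; (suc e , _ , _ , k , _) → s≤s (from (multiplicity>0 es) (e , k))
                      ; (zero , suc f , _ , _ , k) → s≤s (from (multiplicity>0 es) (f , k)) }
  ... | no ¬j = mk⇔ (λ h → let e , f , n , k , l = to (multiplicity>1 es) h in suc e , suc f , n ∘ suc-injective , k , l)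
                    λ { (zero , _ , _ , j , _) → ⊥-elim (¬j j)
                      ; (suc _ , zero , _ , _ , j) → ⊥-elim (¬j j)
                      ; (suc e , suc f , n , k , l) → from (multiplicity>1 es) (e , f , n ∘ cong suc , k , l) }

-- Membership and reachability

encodeR : ∀ {n} → List (Fin n) → Tree
encodeR = encodeList encodeV

opaque

  memberStep : PT
  memberStep = ifₚ (eqOf cur env) trueₚ (expr acc)

  member-grows : ∀ l e a → size (fun memberStep (l ∙ (e ∙ a))) ≤ size a + 3
  member-grows l e a = some-grows (truth (fun (eqOf cur env) (l ∙ (e ∙ a)))) a 0

module Member = Fold memberStep (con 3) member-grows

opaque
  unfolding memberStep

  memberₚ : PT
  memberₚ = Member.foldₚ

  member-correct : ∀ {n} (v : Fin n) r a → Holds (fun memberₚ (encodeR r ∙ (encodeV v ∙ a))) ⇔ (v ∈ r ⊎ Holds a)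
  member-correct v [] a = mk⇔ inj₂ [ (λ ()) , id ]′
  member-correct v (w ∷ r) a with truth (fun eqₚ (encodeV w ∙ encodeV v)) in h
  ... | true = mk⇔ (λ _ → inj₁ (here (sym (to (eqV w v) h)))) λ _ → from (member-correct v r (nil ∙ nil)) (inj₂ refl)
  ... | false = mk⇔ ([ inj₁ ∘ there , inj₂ ]′ ∘ to (member-correct v r a))
    [ (λ { (here refl) → ⊥-elim (¬holds h (from (eqV w v) refl)) ; (there i) → from (member-correct v r a) (inj₁ i) })
    , from (member-correct v r a) ∘ inj₂ ]′

member-holds : ∀ {n} (v : Fin n) r → Holds (fun memberₚ (encodeR r ∙ (encodeV v ∙ nil))) ⇔ v ∈ r
member-holds v r = mk⇔ ([ id , (λ ()) ]′ ∘ to (member-correct v r nil)) (from (member-correct v r nil) ∘ inj₁)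

memberOf : Expr 1 → Expr 1 → PT
memberOf v r = memberₚ ∘ₚ expr (cons r (cons v nil))

awayₚ : Expr 1 → PT
awayₚ p = andₚ (notₚ (eqOf p (hd env))) (notₚ (eqOf p (tl env)))

state : ∀ {n} (u v p q : Fin n) → Tree → List (Fin n) → Tree
state u v p q es r = (encodeE (p , q) ∙ es) ∙ ((encodeV u ∙ encodeV v) ∙ encodeR r)

opaque

  usableₚ : PT
  usableₚ = andₚ (awayₚ (hd cur)) (awayₚ (tl cur))

  usable-holds : ∀ {n} (u v p q : Fin n) es r → Holds (fun usableₚ (state u v p q es r))
                 ⇔ ((p ≢ u × p ≢ v) × (q ≢ u × q ≢ v))
  usable-holds {n} u v p q es r = and-holds (awayₚ (hd cur)) (awayₚ (tl cur)) x (away (hd cur) p refl) (away (tl cur) q refl)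
    where
    x : Tree
    x = state u v p q es r
    same : ∀ P E (w w′ : Fin n) → eval P ⟨ x ⟩ ≡ encodeV w → eval E ⟨ x ⟩ ≡ encodeV w′ → Holds (fun (eqOf P E) x) ⇔ w ≡ w′
    same P E w w′ eq eq′ = subst (λ t → Holds (fun eqₚ t) ⇔ w ≡ w′) (sym (cong₂ _∙_ eq eq′)) (eqV w w′)
    away : ∀ P (w : Fin n) → eval P ⟨ x ⟩ ≡ encodeV w → Holds (fun (awayₚ P) x) ⇔ (w ≢ u × w ≢ v)
    away P w eq = and-holds (notₚ (eqOf P (hd env))) (notₚ (eqOf P (tl env))) x
      (not-holds (eqOf P (hd env)) x (same P (hd env) w u eq refl)) (not-holds (eqOf P (tl env)) x (same P (tl env) w v eq refl))

opaque

  visitStep : PT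
  visitStep = ifₚ usableₚ
    (ifₚ (memberOf (hd cur) acc) (expr (cons (tl cur) acc))
      (ifₚ (memberOf (tl cur) acc) (expr (cons (hd cur) acc)) (expr acc)))
    (expr acc)

  visit-grows : ∀ l e a → size (fun visitStep (l ∙ (e ∙ a))) ≤ size a + ⟪ X ⊕ con 1 ⟫ (size l + size e)
  visit-grows l e a = select-size (truth (fun usableₚ x))
    (select-size (truth (fun (memberOf (hd cur) acc) x)) (cons-size (right≤ (left l)))
      (select-size (truth (fun (memberOf (tl cur) acc) x)) (cons-size (left≤ (left l))) (m≤m+n _ _)))
    (m≤m+n _ _)
    where
    x : Tree
    x = l ∙ (e ∙ a)
    cons-size : ∀ {t} → size t ≤ size (left l) → suc (size t + size a) ≤ size a + (size l + size e + 1)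
    cons-size {t} t≤ = ≤-trans (s≤s (≤-trans (≤-reflexive (ℕ.+-comm (size t) (size a)))
        (+-monoʳ-≤ (size a) (≤-trans t≤ (≤-trans (left≤ l) (m≤m+n _ (size e)))))))
      (≤-reflexive (trans (sym (ℕ.+-suc (size a) _)) (cong (size a +_) (ℕ.+-comm 1 _))))

module Reach {G : Graph} (u v : Vertex G) where
  open Theory G

  Usable : Vertex G × Vertex G → Set
  Usable (p , q) = Away u v p × Away u v q

  usable? : ∀ e → Dec (Usable e)
  usable? (p , q) = away? u v p ×-dec away? u v q

  -- An end is added even if it is already listed. This costs at most one entry per edge and sweep,
  -- which keeps the growth additive.
  visit : Vertex G × Vertex G → List (Vertex G) → List (Vertex G)
  visit (p , q) r with usable? (p , q) | p ∈? r | q ∈? r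
  ... | no _  | _     | _     = r
  ... | yes _ | yes _ | _     = q ∷ r
  ... | yes _ | no _  | yes _ = p ∷ r
  ... | yes _ | no _  | no _  = r

  sweep : List (Vertex G × Vertex G) → List (Vertex G) → List (Vertex G)
  sweep []       r = r
  sweep (e ∷ es) r = sweep es (visit e r)

  opaque
    unfolding visitStep

    visit-correct : ∀ p q es r → fun visitStep (state u v p q es r) ≡ encodeR (visit (p , q) r)
    visit-correct p q es r with truth (fun usableₚ (state u v p q es r)) in h | usable? (p , q)
    ... | true | no ¬a = ⊥-elim (¬a (to (usable-holds u v p q es r) h))
    ... | false | yes a = ⊥-elim (¬holds h (from (usable-holds u v p q es r) a))
    ... | false | no _ = refl
    ... | true | yes _
      with truth (fun memberₚ (encodeR r ∙ (encodeV p ∙ nil))) in i | p ∈? r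
    ...   | true  | no ¬m = ⊥-elim (¬m (to (member-holds p r) i))
    ...   | false | yes m = ⊥-elim (¬holds i (from (member-holds p r) m))
    ...   | true  | yes _ = refl
    ...   | false | no _
      with truth (fun memberₚ (encodeR r ∙ (encodeV q ∙ nil))) in j | q ∈? r
    ...     | true  | no ¬m = ⊥-elim (¬m (to (member-holds q r) j))
    ...     | false | yes m = ⊥-elim (¬holds j (from (member-holds q r) m))
    ...     | true  | yes _ = refl
    ...     | false | no _  = refl

  sweeps : ℕ → List (Vertex G) → List (Vertex G)
  sweeps zero    r = r
  sweeps (suc k) r = sweeps k (sweep (edgeList G) r)

  visit⊇ : ∀ e r {x} → x ∈ r → x ∈ visit e r
  visit⊇ (p , q) r x∈ with usable? (p , q) | p ∈? r | q ∈? r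
  ... | no _  | _     | _     = x∈
  ... | yes _ | yes _ | _     = there x∈
  ... | yes _ | no _  | yes _ = there x∈
  ... | yes _ | no _  | no _  = x∈

  sweep⊇ : ∀ es r {x} → x ∈ r → x ∈ sweep es r
  sweep⊇ []       r x∈ = x∈
  sweep⊇ (e ∷ es) r x∈ = sweep⊇ es (visit e r) (visit⊇ e r x∈)

  sweeps⊇ : ∀ k r {x} → x ∈ r → x ∈ sweeps k r
  sweeps⊇ zero    r x∈ = x∈
  sweeps⊇ (suc k) r x∈ = sweeps⊇ k _ (sweep⊇ (edgeList G) r x∈)

  visit-step : ∀ e r {x y} → JoinsPair e x y → Away u v x → Away u v y → x ∈ r → y ∈ visit e r
  visit-step (p , q) r j ax ay x∈ with usable? (p , q) | p ∈? r | q ∈? r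
  visit-step (p , q) r (inj₁ (refl , refl)) ax ay x∈ | no ¬a | _ | _ = ⊥-elim (¬a (ax , ay))
  visit-step (p , q) r (inj₂ (refl , refl)) ax ay x∈ | no ¬a | _ | _ = ⊥-elim (¬a (ay , ax))
  visit-step (p , q) r (inj₁ (refl , refl)) ax ay x∈ | yes _ | yes _ | _ = here refl
  visit-step (p , q) r (inj₂ (refl , refl)) ax ay x∈ | yes _ | yes p∈ | _ = there p∈
  visit-step (p , q) r (inj₁ (refl , refl)) ax ay x∈ | yes _ | no p∉ | _ = ⊥-elim (p∉ x∈)
  visit-step (p , q) r (inj₂ (refl , refl)) ax ay x∈ | yes _ | no _ | yes _ = here refl
  visit-step (p , q) r (inj₂ (refl , refl)) ax ay x∈ | yes _ | no _ | no q∉ = ⊥-elim (q∉ x∈)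

  sweep-step : ∀ es e r {x y} → JoinsPair (lookup es e) x y → Away u v x → Away u v y → x ∈ r → y ∈ sweep es r
  sweep-step (d ∷ es) zero    r j ax ay x∈ = sweep⊇ es (visit d r) (visit-step d r j ax ay x∈)
  sweep-step (d ∷ es) (suc e) r j ax ay x∈ = sweep-step es e (visit d r) j ax ay (visit⊇ d r x∈)

  -- A sweep passes over all edges and so advances at least one step along the walk.
  sweeps-complete : ∀ {a b} (w : Walk {G} a b) → (∀ {x} → x ∈ vertices w → Away u v x) →
                    ∀ k r → length (vertices w) ≤ suc k → a ∈ r → b ∈ sweeps k r
  sweeps-complete [ _ ] all k r _ a∈ = sweeps⊇ k r a∈
  sweeps-complete (a -⟨ j ⟩- [ b ]) all zero r (s≤s ()) a∈
  sweeps-complete (a -⟨ j ⟩- (_ -⟨ _ ⟩- _)) all zero r (s≤s ()) a∈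
  sweeps-complete (_-⟨_⟩-_ a {e = e} j w) all (suc k) r (s≤s l) a∈ = sweeps-complete w (all ∘ there) k _ l
    (sweep-step (edgeList G) e r j (all (here refl)) (all (there (start∈ w))) a∈)

  module _ (a : Vertex G) where

    Reached : List (Vertex G) → Set
    Reached r = ∀ {x} → x ∈ r → Conn (Away u v) a x

    visit-sound : ∀ e r → Adjacent (proj₁ e) (proj₂ e) → Reached r → Reached (visit e r)
    visit-sound (p , q) r pq sound x∈ with usable? (p , q) | p ∈? r | q ∈? r
    visit-sound (p , q) r pq sound x∈ | no _ | _ | _ = sound x∈
    visit-sound (p , q) r pq sound (here refl) | yes (ap , aq) | yes p∈ | _ = sound p∈ ◅◅ (pq , ap , aq) ◅ ε
    visit-sound (p , q) r pq sound (there i) | yes _ | yes _ | _ = sound i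
    visit-sound (p , q) r pq sound (here refl) | yes (ap , aq) | no _ | yes q∈ = sound q∈ ◅◅ (adj-sym pq , aq , ap) ◅ ε
    visit-sound (p , q) r pq sound (there i) | yes _ | no _ | yes _ = sound i
    visit-sound (p , q) r pq sound x∈ | yes _ | no _ | no _ = sound x∈

    sweep-sound : ∀ es r → (∀ e → Adjacent (proj₁ (lookup es e)) (proj₂ (lookup es e))) → Reached r → Reached (sweep es r)
    sweep-sound []       r adj sound = sound
    sweep-sound (e ∷ es) r adj sound = sweep-sound es (visit e r) (adj ∘ suc) (visit-sound e r (adj zero) sound)

    sweeps-sound : ∀ k r → Reached r → Reached (sweeps k r)
    sweeps-sound zero    r sound = sound
    sweeps-sound (suc k) r sound =
      sweeps-sound k _ (sweep-sound (edgeList G) r (λ e → e , inj₁ (refl , refl)) sound)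

    reached⇔conn : ∀ b → b ∈ sweeps (order G) (a ∷ []) ⇔ Conn (Away u v) a b
    reached⇔conn b = mk⇔ (sweeps-sound (order G) (a ∷ []) λ { (here refl) → ε }) λ
      { ε → sweeps⊇ (order G) (a ∷ []) (here refl)
      ; c@((_ , aw , _) ◅ _) → let open SimplePath (conn⇒path aw c) in
          sweeps-complete walk within (order G) (a ∷ []) (≤-trans (unique⇒length≤ unique) (n≤1+n _)) (here refl) }

module Visit = Fold visitStep (X ⊕ con 1) visit-grows

roundGrowth : Poly
roundGrowth = X ⊗ (X ⊕ con 1)

opaque

  roundₚ : PT
  roundₚ = Visit.foldₚ ∘ₚ expr (cons (tl env) (cons (hd env) acc))

  round-grows : ∀ l e a → size (fun roundₚ (l ∙ (e ∙ a))) ≤ size a + ⟪ roundGrowth ⟫ (size l + size e)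
  round-grows l e a = ≤-trans (Visit.go-size (right e) (left e) a parts)
      (+-monoʳ-≤ (size a) (*-mono-≤ (≤-trans (right≤ e) (m≤n+m (size e) (size l))) ≤-refl))
    where
    pieces : ∀ e → size (right e) + size (left e) ≤ suc (size e)
    pieces nil     = ≤-refl
    pieces (x ∙ y) = ≤-trans (≤-reflexive (ℕ.+-comm (size y) (size x))) (≤-trans (n≤1+n _) (n≤1+n _))
    parts : size (right e) + size (left e) ≤ size l + size e
    parts = ≤-trans (pieces e) (+-monoˡ-≤ (size e) (size≥1 l))

  fun-round : ∀ {G} (u v : Vertex G) l es r → fun roundₚ (l ∙ (((encodeV u ∙ encodeV v) ∙ encodeList encodeE es) ∙ encodeR r))
              ≡ encodeR (Reach.sweep {G} u v es r)
  fun-round u v l [] r = refl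
  fun-round {G} u v l ((p , q) ∷ es) r = trans
    (cong (Visit.go (encodeList encodeE es) (encodeV u ∙ encodeV v)) (Reach.visit-correct {G} u v p q (encodeList encodeE es) r))
    (fun-round {G} u v l es (Reach.visit {G} u v (p , q) r))

module Rounds = Fold roundₚ roundGrowth round-grows

opaque

  -- The unary order of the graph serves as a loop counter whose elements are ignored; each
  -- iteration is one sweep.
  reachₚ : PT
  reachₚ = Rounds.foldₚ

  fun-reach : ∀ {G} (u v : Vertex G) k r →
              fun reachₚ (encodeℕ k ∙ (((encodeV u ∙ encodeV v) ∙ encodeList encodeE (edgeList G)) ∙ encodeR r))
              ≡ encodeR (Reach.sweeps {G} u v k r)
  fun-reach u v zero r = refl
  fun-reach {G} u v (suc k) r = trans
    (cong (Rounds.go (encodeℕ k) ((encodeV u ∙ encodeV v) ∙ encodeList encodeE (edgeList G)))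
      (fun-round {G} u v (encodeℕ (suc k)) (edgeList G) r))
    (fun-reach {G} u v k (Reach.sweep {G} u v (edgeList G) r))

-- Polynomial-time queries about k vertices of a graph

-- The vertices form a stack above the graph, so variables are de Bruijn indices and a quantifier
-- pushes one vertex.
encodeEnv : ∀ G {k} → Vec (Vertex G) k → Tree
encodeEnv G Vec.[]      = encodeGraph G
encodeEnv G (v Vec.∷ ρ) = encodeV v ∙ encodeEnv G ρ

dropₑ : ℕ → Expr 1
dropₑ zero    = v₀
dropₑ (suc k) = tl (dropₑ k)

record Query (k : ℕ) (Q : ∀ G → Vec (Vertex G) k → Set) : Set where
  constructor query
  field
    test    : PT
    correct : ∀ G ρ → Holds (fun test (encodeEnv G ρ)) ⇔ Q G ρ
open Query

eval-shift : ∀ i l r → eval (dropₑ (suc i)) ⟨ l ∙ r ⟩ ≡ eval (dropₑ i) ⟨ r ⟩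
eval-shift zero    l r = refl
eval-shift (suc i) l r = cong right (eval-shift i l r)

varₑ : ℕ → Expr 1
varₑ i = hd (dropₑ i)

eval-var : ∀ G {k} (i : Fin k) (ρ : Vec (Vertex G) k) → eval (varₑ (toℕ i)) ⟨ encodeEnv G ρ ⟩ ≡ encodeV (Vec.lookup ρ i)
eval-var G zero    (v Vec.∷ ρ) = refl
eval-var G (suc i) (v Vec.∷ ρ) = trans (cong left (eval-shift (toℕ i) (encodeV v) (encodeEnv G ρ))) (eval-var G i ρ)

eval-graph : ∀ G {k} (ρ : Vec (Vertex G) k) → eval (dropₑ k) ⟨ encodeEnv G ρ ⟩ ≡ encodeGraph G
eval-graph G Vec.[]      = refl
eval-graph G {suc k} (v Vec.∷ ρ) = trans (eval-shift k (encodeV v) (encodeEnv G ρ)) (eval-graph G ρ)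

infixr 2 _∧_
infixr 1 _∨_

_∧_ : ∀ {k P Q} → Query k P → Query k Q → Query k (λ G ρ → P G ρ × Q G ρ)
P ∧ Q = query (andₚ (test P) (test Q)) λ G ρ → and-holds (test P) (test Q) (encodeEnv G ρ) (correct P G ρ) (correct Q G ρ)

_∨_ : ∀ {k P Q} → Query k P → Query k Q → Query k (λ G ρ → P G ρ ⊎ Q G ρ)
P ∨ Q = query (orₚ (test P) (test Q)) λ G ρ → or-holds (test P) (test Q) (encodeEnv G ρ) (correct P G ρ) (correct Q G ρ)

∼_ : ∀ {k P} → Query k P → Query k (λ G ρ → ¬ P G ρ)
∼ P = query (notₚ (test P)) λ G ρ → not-holds (test P) (encodeEnv G ρ) (correct P G ρ)

module _ {k : ℕ} where

  differ : (i j : Fin k) → Query k (λ G ρ → Vec.lookup ρ i ≢ Vec.lookup ρ j)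
  differ i j = ∼ query (eqOf (varₑ (toℕ i)) (varₑ (toℕ j))) λ G ρ →
    subst (λ t → Holds (fun eqₚ t) ⇔ Vec.lookup ρ i ≡ Vec.lookup ρ j)
      (sym (cong₂ _∙_ (eval-var G i ρ) (eval-var G j ρ))) (eqV (Vec.lookup ρ i) (Vec.lookup ρ j))

  countArgs : (i j : Fin k) → Expr 1
  countArgs i j = cons (tl (dropₑ k)) (cons (cons (varₑ (toℕ i)) (varₑ (toℕ j))) nil)

  multiplicityₚ : (i j : Fin k) → PT
  multiplicityₚ i j = countₚ ∘ₚ expr (countArgs i j)

  fun-multiplicity : ∀ i j G (ρ : Vec (Vertex G) k) → fun (multiplicityₚ i j) (encodeEnv G ρ)
                     ≡ encodeℕ (multiplicity (Vec.lookup ρ i) (Vec.lookup ρ j) (edgeList G))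
  fun-multiplicity i j G ρ = trans
    (cong (fun countₚ) (cong₂ (λ g p → right g ∙ (p ∙ nil)) (eval-graph G ρ) (cong₂ _∙_ (eval-var G i ρ) (eval-var G j ρ))))
    (trans (fun-count (Vec.lookup ρ i) (Vec.lookup ρ j) (edgeList G) 0) (cong encodeℕ (ℕ.+-identityʳ _)))

  adjacent : (i j : Fin k) → Query k (λ G ρ → Theory.Adjacent G (Vec.lookup ρ i) (Vec.lookup ρ j))
  adjacent i j = query (multiplicityₚ i j) λ G ρ →
    let m = multiplicity>0 (Vec.lookup ρ i) (Vec.lookup ρ j) (edgeList G)
        h = holds-encodeℕ (multiplicity (Vec.lookup ρ i) (Vec.lookup ρ j) (edgeList G))
        eq = cong truth (fun-multiplicity i j G ρ)
    in mk⇔ (λ p → to m (to h (trans (sym eq) p))) λ a → trans eq (from h (from m a))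

  -- The multiplicity is unary, so after removing one layer the value is true exactly from 2 on.
  double : (i j : Fin k) → Query k (λ G ρ → Theory.Double G (Vec.lookup ρ i) (Vec.lookup ρ j))
  double i j = query (expr (tl v₀) ∘ₚ multiplicityₚ i j) λ G ρ →
    let m = multiplicity>1 (Vec.lookup ρ i) (Vec.lookup ρ j) (edgeList G)
        h = holds-right (multiplicity (Vec.lookup ρ i) (Vec.lookup ρ j) (edgeList G))
        eq = cong (truth ∘ right) (fun-multiplicity i j G ρ)
    in mk⇔ (λ p → to m (to h (trans (sym eq) p))) λ a → trans eq (from h (from m a))
    where
    holds-right : ∀ n → Holds (right (encodeℕ n)) ⇔ 1 < n
    holds-right zero          = mk⇔ (λ ()) λ ()
    holds-right (suc zero)    = mk⇔ (λ ()) λ { (s≤s ()) }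
    holds-right (suc (suc n)) = mk⇔ (λ _ → s≤s (s≤s z≤n)) λ _ → refl

  connArgs : (u v a : Fin k) → Expr 1
  connArgs u v a = cons (hd (dropₑ k)) (cons (cons (cons (varₑ (toℕ u)) (varₑ (toℕ v))) (tl (dropₑ k))) (cons (varₑ (toℕ a)) nil))

  connected : (u v a b : Fin k) → Query k (λ G ρ → Theory.Conn G (Theory.Away G (Vec.lookup ρ u) (Vec.lookup ρ v))
                                                     (Vec.lookup ρ a) (Vec.lookup ρ b))
  connected u v a b = query (memberOf (hd v₀) (tl v₀) ∘ₚ pairₚ (expr (varₑ (toℕ b))) (reachₚ ∘ₚ expr (connArgs u v a)))
    λ G ρ →
    let open Reach (Vec.lookup ρ u) (Vec.lookup ρ v)
        r = sweeps (order G) (Vec.lookup ρ a ∷ [])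
        args : eval (connArgs u v a) ⟨ encodeEnv G ρ ⟩ ≡ encodeℕ (order G) ∙ (((encodeV (Vec.lookup ρ u) ∙ encodeV (Vec.lookup ρ v))
                 ∙ encodeList encodeE (edgeList G)) ∙ encodeR (Vec.lookup ρ a ∷ []))
        args = cong₂ (λ g → λ { (x , y) → left g ∙ ((x ∙ right g) ∙ (y ∙ nil)) }) (eval-graph G ρ)
                 (cong₂ _,_ (cong₂ _∙_ (eval-var G u ρ) (eval-var G v ρ)) (eval-var G a ρ))
        eq : truth (fun (memberOf (hd v₀) (tl v₀) ∘ₚ pairₚ (expr (varₑ (toℕ b))) (reachₚ ∘ₚ expr (connArgs u v a))) (encodeEnv G ρ))
             ≡ truth (fun memberₚ (encodeR r ∙ (encodeV (Vec.lookup ρ b) ∙ nil)))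
        eq = cong₂ (λ r b → truth (fun memberₚ (r ∙ (b ∙ nil)))) (trans (cong (fun reachₚ) args) (fun-reach {G} (Vec.lookup ρ u) (Vec.lookup ρ v) (order G) (Vec.lookup ρ a ∷ [])))
               (eval-var G b ρ)
        m = member-holds (Vec.lookup ρ b) r
        c = reached⇔conn (Vec.lookup ρ a) (Vec.lookup ρ b)
    in mk⇔ (λ p → to c (to m (trans (sym eq) p))) λ q → trans eq (from m (from c q))

  -- The tails of the unary code of n are the codes of the vertices 0, …, n − 1.
  existsStep : PT → PT
  existsStep f = ifₚ (f ∘ₚ expr (cons (tl (hd v₀)) env)) trueₚ (expr acc)

  module Exists (f : PT) = Fold (existsStep f) (con 3)
    (λ l e a → some-grows (truth (fun f (right l ∙ e))) a 0)

  existsArgs : Expr 1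
  existsArgs = cons (hd (dropₑ k)) (cons v₀ nil)

  exists-go : ∀ f x n a → Holds (Exists.go f (encodeℕ n) x a) ⇔ (Holds a ⊎ ∃[ m ] m < n × Holds (fun f (encodeℕ m ∙ x)))
  exists-go f x zero a = mk⇔ inj₁ λ { (inj₁ h) → h ; (inj₂ (_ , () , _)) }
  exists-go f x (suc n) a with truth (fun f (encodeℕ n ∙ x)) in h
  ... | true = mk⇔ (λ _ → inj₂ (n , ≤-refl , h)) λ _ → from (exists-go f x n (nil ∙ nil)) (inj₁ refl)
  ... | false = mk⇔ ([ inj₁ , (λ (m , m<n , q) → inj₂ (m , ℕ.m<n⇒m<1+n m<n , q)) ]′ ∘ to (exists-go f x n a))
    [ from (exists-go f x n a) ∘ inj₁
    , (λ { (m , s≤s m≤n , q) → case ℕ.m≤n⇒m<n∨m≡n m≤n of λ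
           { (inj₁ m<n) → from (exists-go f x n a) (inj₂ (m , m<n , q))
           ; (inj₂ refl) → ⊥-elim (¬holds h q) } }) ]′

  exists : ∀ {Q} → Query (suc k) Q → Query k (λ G ρ → ∃[ v ] Q G (v Vec.∷ ρ))
  exists {Q} φ = query (Exists.foldₚ (test φ) ∘ₚ expr existsArgs) λ G ρ →
    let x = encodeEnv G ρ
        eq : truth (fun (Exists.foldₚ (test φ) ∘ₚ expr existsArgs) x) ≡ truth (Exists.go (test φ) (encodeℕ (order G)) x nil)
        eq = cong (λ g → truth (Exists.go (test φ) (left g) x nil)) (eval-graph G ρ)
        e = exists-go (test φ) x (order G) nil
    in mk⇔
      (λ p → case to e (trans (sym eq) p) of λ
        { (inj₁ ()) ; (inj₂ (m , m<n , q)) → fromℕ< m<n , to (correct φ G (fromℕ< m<n Vec.∷ ρ))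
            (subst (λ i → Holds (fun (test φ) (encodeℕ i ∙ x))) (sym (toℕ-fromℕ< m<n)) q) })
      (λ (v , q) → trans eq (from e (inj₂ (toℕ v , toℕ<n v , from (correct φ G (v Vec.∷ ρ)) q))))

-- The decision procedure and the theorem

bad₁? : Query 0 (λ G _ → Theory.Bad₁ G)
bad₁? = exists (exists (exists (exists (differ a c ∧ differ a d ∧ differ b d ∧ double a b ∧ double b c ∧ double c d))))
  where
  a b c d : Fin 4
  -- The innermost quantifier binds index 0, so the vertices are numbered backwards.
  a = # 3
  b = # 2
  c = # 1
  d = # 0

bad₂? : Query 0 (λ G _ → Theory.Bad₂ G)
bad₂? = exists (exists (exists (exists (differ x y ∧ differ x v ∧ differ y v ∧ double u v ∧ adjacent u x ∧ adjacent u y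
          ∧ connected u v x y))))
  where
  u v x y : Fin 4
  u = # 3
  v = # 2
  x = # 1
  y = # 0

bad₃? : Query 0 (λ G _ → Theory.Bad₃ G)
bad₃? = exists (exists (exists (exists (exists (differ a b ∧ differ a c ∧ differ a d ∧ differ b c ∧ differ b d ∧ differ c d
          ∧ adjacent u a ∧ adjacent u b ∧ adjacent u c ∧ adjacent u d ∧ connected u u a b ∧ connected u u c d)))))
  where
  u a b c d : Fin 5
  u = # 4
  a = # 3
  b = # 2
  c = # 1
  d = # 0

bad₄? : Query 0 (λ G _ → Theory.Bad₄ G)
bad₄? = exists (exists (exists (exists (differ a b ∧ differ a y ∧ differ b x ∧ double x y ∧ adjacent x a ∧ adjacent y b
          ∧ connected x y a b))))
  where
  x y a b : Fin 4
  x = # 3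
  y = # 2
  a = # 1
  b = # 0

bad₅? : Query 0 (λ G _ → Theory.Bad₅ G)
bad₅? = exists (exists (exists (exists (differ a b ∧ differ a c ∧ differ b c ∧ adjacent u a ∧ adjacent u b ∧ adjacent u c
          ∧ connected u u a b ∧ connected u u b c))))
  where
  u a b c : Fin 4
  u = # 3
  a = # 2
  b = # 1
  c = # 0

bad? : Query 0 (λ G _ → Theory.Bad G)
bad? = bad₁? ∨ bad₂? ∨ bad₃? ∨ bad₄? ∨ bad₅?

mengerian⇔¬bad : ∀ G → Mengerian G ⇔ (¬ Theory.Bad G)
mengerian⇔¬bad G = mk⇔ (λ men bad → Colouring.bad⇒¬mengerian G bad men) (Cycles.¬bad⇒mengerian G)

theorem1 : ((G : Graph) → Mengerian G ⇔ All (λ M → ¬ (M IsMTopologicalMinorOf G)) (M₁ ∷ M₂ ∷ M₃ ∷ M₄ ∷ M₅ ∷ []))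
    × PolyTimeDecidable encodeGraph Mengerian
theorem1 =
  (λ G → mk⇔ (λ men → ¬bad⇒no-minors (to (mengerian⇔¬bad G) men))
             (λ none → from (mengerian⇔¬bad G) (λ bad → Models.bad⇒minor G bad none))) ,
  poly-time encodeGraph Mengerian (Query.test (∼ bad?)) λ G →
    let good = Query.correct (∼ bad?) G Vec.[]
    in mk⇔ (from (mengerian⇔¬bad G) ∘ to good) (from good ∘ to (mengerian⇔¬bad G))
  where open Equivalence using (to; from)
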